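{- There is an online fractional marking algorithm for Caching with Reserves, namely the fractional marking algorithm $\mathcal A$ described in the context, that is $O(\log k)$-competitive, even when the optimal offline algorithm is allowed to hold fractional pages in the cache. That is, there is an absolute constant $C$ such that for every choice of $m,k,\{\mathcal P(i)\},\{k_i\}$ there is a constant $b$, independent of the number of page requests, such that for every request sequence, with $\sigma$ the resulting instance, $$\mathrm{cost}_{\mathcal A}(\sigma)\le C\ln(1+k)\cdot \mathrm{cost}_{OPT}(\sigma)+b,$$ where $\mathrm{cost}_{OPT}(\sigma)$ is the minimum cost of an offline fractional solution for $\sigma$.
   Context: Caching with Reserves. An instance $\sigma$ consists of agents $[m]=\{1,\dots,m\}$, an integer cache size $k$, pairwise disjoint finite page sets $\mathcal P(i)$, $i\in[m]$, with $\mathcal P=\bigcup_i\mathcal P(i)$ (pages of $\mathcal P(i)$ are called $i$-pages), integer reserves $k_i\ge 0$ with $\sum_i k_i<k$, and a sequence of requested pages $p_1,p_2,\dots\in\mathcal P$; $i_t$ denotes the agent owning $p_t$. A fractional algorithm maintains $x_p\in[0,1]$ for all $p\in\mathcal P$ (the portion of $p$ in cache) with $\sum_{p\in\mathcal P}x_p\le k$ and $\sum_{p\in\mathcal P(i)}x_p\ge k_i$ for all $i$; write $y_p=1-x_p$. When $p_t$ is requested it pays $1-x_{p_t}$ (value just before the request) and must set $x_{p_t}=1$. The cost is the total paid. An online algorithm sees $p_t$ only at time $t$; an offline one knows the whole sequence. Fractional marking algorithm $\mathcal A$. It maintains $\sum_{p}y_p=|\mathcal P|-k$. Initially the cache holds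 $k$ pages integrally; $P(i,0)$ is the set of $i$-pages among them, with $|P(i,0)|\ge k_i$. Initially all agents are non-isolated, no page is marked, the global phase counter is $r_0=1$ and the local phase counters are $r_i=1$, $i\in[m]$. At any time, agent $i$ is tight if $\sum_{p\in\mathcal P(i)}x_p=k_i$ and non-tight if this sum is $>k_i$; the unmarked $i$-pages are the pages of $P(i,r_i-1)$ that are not marked. On request $p_t$: (1) If $y_{p_t}=0$, mark $p_t$. (2) Else, if $i_t$ is isolated: set $y_{p_t}=0$, mark $p_t$, and increase $y_q$ at the same rate for all unmarked $i_t$-pages $q$ in the cache until $\sum_p y_p=|\mathcal P|-k$. If $i_t$ now has $k_{i_t}$ marked pages, it becomes non-isolated. (3) Else, if there is an unmarked page $q$ with $y_q<1$ owned by a non-tight agent (here $i_t$ counts as non-tight): set $y_{p_t}=0$, mark $p_t$, and continuously increase, at the same rate, $y_q$ for those unmarked pages $q$ with $y_q<1$ of currently non-tight agents that have the smallest $y$-value, until $\sum_p y_p=|\mathcal P|-k$ (an agent that becomes tight in the process drops out). (4) Else, the current global phase ends: every agent $i$ with strictly fewer than $k_i$ marked pages is designated isolated (keeping its marks and $r_i$); for every other agent $i$, which is non-isolated, let $P(i,r_i)$ be the set of all (integral and marked) $i$-pages in cache, increase $r_i$ by 1, and unmark all $i$-pages. Then increase $r_0$ by 1 and re-process $p_t$ in the new phase.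
   Formalization: An isolated agent is released as soon as it has k_i marked pages, also when the mark comes from rule (1), since otherwise A can get stuck; and neither A nor OPT may increase x_q for a page q other than the requested one, since free prefetching would make the claim false. -}

module Defs where

open import Level using (Level; _⊔_) renaming (suc to lsuc)
open import Algebra.Bundles using (CommutativeRing)
import Algebra.Definitions.RawMonoid as RawMonoidDefs
open import Data.Bool.Base using (false; if_then_else_; _∧_)
open import Data.Fin.Base using (Fin; toℕ)
import Data.Fin.Properties as Fin
open import Data.Fin.Subset using (Subset; _∈_; _∉_; _∩_; _∪_; ∣_∣; ⁅_⁆; ⊥)
import Data.Fin.Subset as Subset
open import Data.List.Base using (List; []; _∷_; length)
open import Data.Nat.Base as ℕ using (ℕ; suc)
import Data.Nat.Properties as ℕ
open import Data.Product.Base using (_×_; ∃-syntax)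
open import Data.Sum.Base using (_⊎_)
open import Data.Vec.Base using (Vec; []; _∷_; lookup; tabulate)
open import Data.Vec.Functional using (Vector; updateAt)
open import Function.Base using (const)
open import Function.Bundles using (_⇔_)
open import Relation.Binary.Core using (Rel)
open import Relation.Binary.PropositionalEquality.Core using (_≡_; _≢_)
import Relation.Binary.Construct.NonStrictToStrict as ToStrict
open import Relation.Binary.Structures using (IsDecTotalOrder)
open import Relation.Nullary using (¬_; does)

-- The scalars.  Classically ℝ is an instance (as is ℚ); the order is decidable
-- because the algorithm branches on comparisons of scalars.  The value of _⁻¹
-- at 0# is unspecified.

record OrderedField a ℓ₁ ℓ₂ : Set (lsuc (a ⊔ ℓ₁ ⊔ ℓ₂)) where
  infix 8 _⁻¹
  infix 4 _≤_
  field
    commutativeRing : CommutativeRing a ℓ₁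
  open CommutativeRing commutativeRing public
  field
    _≤_             : Rel Carrier ℓ₂
    isDecTotalOrder : IsDecTotalOrder _≈_ _≤_
    +-monoʳ-≤       : ∀ z {x y} → x ≤ y → z + x ≤ z + y
    *-nonNegative   : ∀ {x y} → 0# ≤ x → 0# ≤ y → 0# ≤ x * y
    0≉1             : ¬ 0# ≈ 1#
    _⁻¹             : Carrier → Carrier
    ⁻¹-inverseʳ     : ∀ {x} → ¬ x ≈ 0# → x * x ⁻¹ ≈ 1#

  open IsDecTotalOrder isDecTotalOrder public
    using (_≟_; _≤?_)
  open ToStrict _≈_ _≤_ public using (_<_)
  open RawMonoidDefs +-rawMonoid public using (sum) renaming (_×_ to _·_)

  fromℕ : ℕ → Carrier
  fromℕ n = n · 1#

  sumOver : ∀ {n} → Subset n → Vector Carrier n → Carrier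
  sumOver S f = sum λ p → if lookup S p then f p else 0#

  -- ln (1 + k) is the integral of 1/x over [1 , 1 + k], the supremum over N of
  -- the right-endpoint Riemann sums with mesh 1/N, whose j-th term (1 ≤ j ≤ kN)
  -- is (1/N) · 1/(1 + j/N) = 1/(N + j).

  riemannSum : (k N : ℕ) → Carrier
  riemannSum k N = sum {k ℕ.* N} λ j → fromℕ (N ℕ.+ suc (toℕ j)) ⁻¹

  -- u ≥ ln (1 + k)
  ln[1+_]≤_ : ℕ → Carrier → Set ℓ₂
  ln[1+ k ]≤ u = ∀ N → riemannSum k N ≤ u

sumℕ : ∀ {n} → Vector ℕ n → ℕ
sumℕ = RawMonoidDefs.sum ℕ.+-0-rawMonoid

-- Everything about an instance except the request sequence.  Making the
-- page sets the fibres of owner makes them disjoint.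

record Setting : Set where
  field
    m          : ℕ
    ∣𝒫∣        : ℕ
    owner      : Fin ∣𝒫∣ → Fin m
    k          : ℕ
    reserve    : Fin m → ℕ
    Σreserve<k : sumℕ reserve ℕ.< k

  Agent Page : Set
  Agent = Fin m
  Page  = Fin ∣𝒫∣

  pagesOf : Agent → Subset ∣𝒫∣
  pagesOf i = tabulate λ p → does (owner p Fin.≟ i)

  record InitialCache : Set where
    field
      pages      : Subset ∣𝒫∣
      full       : ∣ pages ∣ ≡ k
      reserve-ok : ∀ i → reserve i ℕ.≤ ∣ pages ∩ pagesOf i ∣

module Caching {a ℓ₁ ℓ₂} (K : OrderedField a ℓ₁ ℓ₂) (I : Setting) where
  open OrderedField K
  open Setting I

  -- Page-indexed scalars: portions x in the cache, or their complements y.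
  Alloc : Set a
  Alloc = Page → Carrier

  record Feasible (x : Alloc) : Set (a ⊔ ℓ₂) where
    field
      nonNegative : ∀ p → 0# ≤ x p
      at-most-one : ∀ p → x p ≤ 1#
      capacity    : sum x ≤ fromℕ k
      reserves    : ∀ i → fromℕ (reserve i) ≤ sumOver (pagesOf i) x

  -- Going from x to x′ serves p.  Only the requested page is brought into the
  -- cache: the cost model charges nothing for other pages, so free prefetching
  -- would make every request free when k ≥ 2.
  record Serves (x : Alloc) (p : Page) (x′ : Alloc) : Set (a ⊔ ℓ₁ ⊔ ℓ₂) where
    field
      feasible    : Feasible x′
      requested   : x′ p ≈ 1#
      no-prefetch : ∀ q → q ≢ p → x′ q ≤ x q

  data ServesAll (x : Alloc) : (σ : List Page) → Vec Alloc (length σ) → Set (a ⊔ ℓ₁ ⊔ ℓ₂) where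
    []  : ServesAll x [] []
    _∷_ : ∀ {p σ x′ xs} → Serves x p x′ → ServesAll x′ σ xs → ServesAll x (p ∷ σ) (x′ ∷ xs)

  cost : Alloc → (σ : List Page) → Vec Alloc (length σ) → Carrier
  cost x []      []        = 0#
  cost x (p ∷ σ) (x′ ∷ xs) = (1# - x p) + cost x′ σ xs

  record Solution (σ : List Page) : Set (a ⊔ ℓ₁ ⊔ ℓ₂) where
    field
      x₀        : Alloc
      xs        : Vec Alloc (length σ)
      feasible₀ : Feasible x₀
      served    : ServesAll x₀ σ xs

    totalCost : Carrier
    totalCost = cost x₀ σ xs

  module Marking where

    -- snapshot ∩ pagesOf i is P(i, rᵢ - 1).  The phase counters only index
    -- these sets, of which just the latest is ever used.
    record State : Set a where
      field
        y        : Alloc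
        marked   : Subset ∣𝒫∣
        snapshot : Subset ∣𝒫∣
        isolated : Subset m

    open State

    portion : State → Alloc
    portion s p = 1# - y s p

    initial : InitialCache → State
    initial C = record
      { y        = λ p → if lookup (InitialCache.pages C) p then 0# else 1#
      ; marked   = ⊥
      ; snapshot = InitialCache.pages C
      ; isolated = ⊥
      }

    NonTight : Alloc → Agent → Set (ℓ₁ ⊔ ℓ₂)
    NonTight y i = fromℕ (reserve i) < sumOver (pagesOf i) λ p → 1# - y p

    Unmarked : State → Page → Set
    Unmarked s q = q ∈ snapshot s × q ∉ marked s

    marks : State → Agent → ℕ
    marks s i = ∣ marked s ∩ pagesOf i ∣

    -- An isolated agent reaching its reserve in marked pages becomes
    -- non-isolated, however the mark was acquired.
    mark : Page → State → State
    mark p s = record s′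
      { isolated = if does (marks s′ i ℕ.≟ reserve i) then isolated s Subset.- i else isolated s }
      where
      i  = owner p
      s′ = record s { marked = marked s ∪ ⁅ p ⁆ }

    fetch : Page → State → State
    fetch p s = mark p (record s { y = updateAt (y s) p (const 0#) })

    Raised : ∀ {ℓ} → (Page → Set ℓ) → Carrier → Alloc → Alloc → Set (ℓ₁ ⊔ ℓ)
    Raised S δ y z = ∀ q → (S q → z q ≈ y q + δ) × (¬ S q → z q ≈ y q)

    -- The continuous process in which, at each moment, the pages q with
    -- Active y q rise at unit rate, until Σ y = |𝒫| - k.  It is cut into finitely
    -- many pieces during each of which the set of rising pages is constant.
    data Flow {ℓ} (Active : Alloc → Page → Set ℓ) (y : Alloc) : Alloc → Set (a ⊔ ℓ₁ ⊔ ℓ₂ ⊔ ℓ) where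
      stop : sum y ≈ fromℕ ∣𝒫∣ - fromℕ k → Flow Active y y
      rise : ∀ {y′ z} δ → 0# < δ →
             Raised (Active y) δ y y′ →
             (∀ ε w → 0# ≤ ε → ε < δ → Raised (Active y) ε y w → ∀ q → Active w q ⇔ Active y q) →
             sum y′ ≤ fromℕ ∣𝒫∣ - fromℕ k →
             Flow Active y′ z →
             Flow Active y z

    OwnUnmarked : State → Agent → Alloc → Page → Set (ℓ₁ ⊔ ℓ₂)
    OwnUnmarked s i y q = Unmarked s q × owner q ≡ i × y q < 1#

    Available : State → Alloc → Page → Set (ℓ₁ ⊔ ℓ₂)
    Available s y q = Unmarked s q × y q < 1# × NonTight y (owner q)

    LowestAvailable : State → Alloc → Page → Set (ℓ₁ ⊔ ℓ₂)
    LowestAvailable s y q = Available s y q × (∀ q′ → Available s y q′ → y q ≤ y q′)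

    CanEvict : State → Agent → Set (ℓ₁ ⊔ ℓ₂)
    CanEvict s i =
      ∃[ q ] Unmarked s q × y s q < 1# × (owner q ≡ i ⊎ NonTight (y s) (owner q))

    endPhase : State → State
    endPhase s = record
      { y        = y s
      ; marked   = tabulate λ q →
          if stays (owner q) then lookup (marked s) q else false
      ; snapshot = tabulate λ q →
          if stays (owner q) then lookup (snapshot s) q
          else lookup (marked s) q ∧ does (y s q ≟ 0#)
      ; isolated = tabulate stays
      }
      where
      stays = λ i → does (marks s i ℕ.<? reserve i)

    data Step (s : State) (p : Page) : State → Set (a ⊔ ℓ₁ ⊔ ℓ₂) where
      hit : y s p ≈ 0# →
            Step s p (mark p s)
      isolatedMiss : ∀ {z} → ¬ y s p ≈ 0# → owner p ∈ isolated s →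
            Flow (OwnUnmarked (fetch p s) (owner p)) (y (fetch p s)) z →
            Step s p (record (fetch p s) { y = z })
      sharedMiss : ∀ {z} → ¬ y s p ≈ 0# → owner p ∉ isolated s → CanEvict s (owner p) →
            Flow (LowestAvailable (fetch p s)) (y (fetch p s)) z →
            Step s p (record (fetch p s) { y = z })
      newPhase : ∀ {s′} → ¬ y s p ≈ 0# → owner p ∉ isolated s → ¬ CanEvict s (owner p) →
            Step (endPhase s) p s′ →
            Step s p s′

    data Run (s : State) : List Page → State → Set (a ⊔ ℓ₁ ⊔ ℓ₂) where
      []  : Run s [] s
      _∷_ : ∀ {p σ s′ s″} → Step s p s′ → Run s′ σ s″ → Run s (p ∷ σ) s″

    trajectory : ∀ {s σ s″} → Run s σ s″ → Vec Alloc (length σ)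
    trajectory []                   = []
    trajectory (_∷_ {s′ = s′} _ r) = portion s′ ∷ trajectory r

{-# OPTIONS --safe #-}

-- Call a request charged if its page is unmarked and either is new in its local phase or
-- belongs to an agent that was isolated when the global phase began and has been released
-- since.
--
-- Up to a constant, every solution pays at least a quarter of the number of charged
-- requests.  At the end of a phase the algorithm holds max (reserve, marks) for each agent,
-- and a solution holds at least the reserve, so whatever it holds outside the marked pages
-- of the restarted agents, or above the reserve of the isolated ones, is missing from
-- marked pages; it has evicted that much during the phase.
--
-- Up to a constant, the algorithm pays at most 1/1 + … + 1/(k-1) + 2 per charged request.
-- When an uncharged page of level η = y p is requested, only pages of level at least η are
-- raised.  Hence, for every threshold θ, the sum of min (y q , θ) over the unmarked pages q
-- loses θ at each uncharged request with η ≥ θ, while a charged request adds at most 1 to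
-- it: there are at most 1/θ times as many uncharged requests with η ≥ θ as charged ones.
-- Summing this over the thresholds 1/j gives the harmonic number.  What is below 1/k adds
-- up to at most 1 per phase, since k pages are marked, and every phase after the first
-- starts with a charged request.

module Submission where

open import Defs
open import Level using (Level; _⊔_)
open import Algebra.Bundles.Raw using (RawRing)
import Algebra.Construct.NaturalChoice.Min as Min
import Algebra.Properties.AbelianGroup as AbelianGroupProps
import Algebra.Properties.CommutativeMonoid.Sum as CMSum
import Algebra.Properties.CommutativeSemigroup as CSProps
import Algebra.Properties.Monoid.Mult as Mult
import Algebra.Properties.Ring as RingProps
import Algebra.Properties.Semiring.Mult as SMult
import Algebra.Properties.Semiring.Sum as SSum
import Algebra.Solver.Ring
import Algebra.Solver.Ring.AlmostCommutativeRing as ACR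
open import Data.Bool.Base using (Bool; true; false; if_then_else_; _∧_; _∨_; not)
open import Data.Bool.Properties using (¬-not)
open import Data.Empty using (⊥-elim)
open import Data.Fin.Base using (Fin; zero; suc; toℕ)
import Data.Fin.Properties as Fin
open import Data.Fin.Subset using (Subset; inside; outside; _∈_; _∉_; _⊆_; _∩_; _∪_; ∣_∣; ⁅_⁆; ⊥)
import Data.Fin.Subset as Subset
open import Data.Fin.Subset.Properties
  using (_∈?_; x∈⁅x⁆; x∈⁅y⁆⇒x≡y; x∈p∪q⁺; x∈p∪q⁻; x∈p∩q⁺; x∈p∩q⁻; ∉⊥; ∣⊥∣≡0; ⊆-antisym;
         ∪-identityʳ; ∩-distribʳ-∪; p─q⊆p; x∈p∧x≢y⇒x∈p-y; nonempty?; Empty-unique; p⊆q⇒∣p∣≤∣q∣; p⊂q⇒∣p∣<∣q∣)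
open import Data.List.Base using ([]; _∷_)
open import Data.Maybe.Base using (Maybe; just; nothing)
open import Data.Nat.Base as ℕ using (ℕ; zero; suc)
import Data.Nat.Properties as ℕ
open import Data.Product.Base using (_×_; _,_; proj₁; proj₂; ∃; ∃-syntax)
open import Data.Sum.Base using (_⊎_; inj₁; inj₂; [_,_]′)
open import Data.Vec.Base using ([]; _∷_; lookup; tabulate; here; there)
open import Data.Vec.Functional using (Vector)
open import Data.Vec.Functional.Properties using (updateAt-updates; updateAt-minimal)
open import Data.Vec.Properties using (lookup∘tabulate; lookup-zipWith; []=⇒lookup; lookup⇒[]=)
open import Function.Base using (_∘_; id; case_of_; const)
open import Function.Bundles using (_⇔_; mk⇔; Equivalence)
open import Relation.Binary.Bundles using (Poset; TotalOrder)
import Relation.Binary.Construct.NonStrictToStrict as ToStrict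
open import Relation.Binary.Structures using (IsDecTotalOrder)
import Relation.Binary.PropositionalEquality as ≡
open ≡ using (_≡_; _≢_)
open import Relation.Nullary using (¬_; Dec; yes; no; does; contradiction)
open import Relation.Nullary.Decidable using (dec-true; dec-false; decidable-stable; _×-dec_; _⊎-dec_; _→-dec_; ¬?)

-- Isolated agents carry their marks across global phases, so no single interval of time suits all
-- agents, and nothing is counted per phase. Both bounds are potentials compared request by request:
-- `Ψ` stores what an arbitrary solution has paid for and not yet been charged, `A` stores the
-- capped sums of the algorithm at all thresholds together. That an uncharged request raises only
-- pages of level at least η rests on two invariants. The unmarked pages of one agent share a level,
-- which settles isolated agents, since they evict only their own pages. Among agents restarted with
-- the phase, the non-tight ones share the highest level and the tight ones lag behind. Released
-- agents break this pattern: their unmarked pages are entirely out of the cache, yet their misses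
-- evict pages of others at lower levels. Hence these misses must be charged. The continuous
-- eviction is given only through pieces with a constant set of rising pages. Facts about it are
-- obtained by halting a piece at the critical moment, where constancy contradicts the supposed
-- overshoot. That the process exists needs a separate argument by finitely many events.

-- Ordered fields: a ring solver with integer coefficients and the laws of order.

module FieldProperties {a ℓ₁ ℓ₂} (K : OrderedField a ℓ₁ ℓ₂) where

  open OrderedField K hiding (zero)
  open IsDecTotalOrder isDecTotalOrder public
    using (total; antisym; isPartialOrder; isTotalOrder)
    renaming (refl to ≤-refl; reflexive to ≤-reflexive; trans to ≤-trans)
  open RingProps ring using (-‿distribˡ-*; -‿distribʳ-*)
  open AbelianGroupProps +-abelianGroup using (⁻¹-∙-comm; ⁻¹-involutive; ε⁻¹≈ε)

  poset : Poset _ _ _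
  poset = record { isPartialOrder = isPartialOrder }

  totalOrder : TotalOrder _ _ _
  totalOrder = record { isTotalOrder = isTotalOrder }

  open Min totalOrder public using (_⊓_; x⊓y≤x; x⊓y≤y; ⊓-glb; ⊓-mono-≤; ⊓-sel)
  open import Relation.Binary.Reasoning.PartialOrder poset hiding (stop)
  open CMSum +-commutativeMonoid public
    using (∑-distrib-+; ∑-comm; sum-cong-≋; sum-replicate-zero)
  open SSum semiring public using (*-distribˡ-sum)

  fromℕ-+ : ∀ m n → fromℕ (m ℕ.+ n) ≈ fromℕ m + fromℕ n
  fromℕ-+ = Mult.×-homo-+ +-monoid 1#

  fromℕ-* : ∀ m n → fromℕ (m ℕ.* n) ≈ fromℕ m * fromℕ n
  fromℕ-* = SMult.×1-homo-* semiring

  private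
    -- The coefficient (m , n) stands for the integer m - n.
    Coeff : Set
    Coeff = ℕ × ℕ

    coeffs : RawRing _ _
    coeffs = record
      { Carrier = Coeff ; _≈_ = _≡_
      ; _+_ = λ (p , n) (p′ , n′) → p ℕ.+ p′ , n ℕ.+ n′
      ; _*_ = λ (p , n) (p′ , n′) → p ℕ.* p′ ℕ.+ n ℕ.* n′ , p ℕ.* n′ ℕ.+ n ℕ.* p′
      ; -_  = λ (p , n) → n , p
      ; 0#  = 0 , 0
      ; 1#  = 1 , 0
      }
    module ℤ = RawRing coeffs

    value : Coeff → Carrier
    value (p , n) = fromℕ p - fromℕ n

    -- Agrees with `value` but cancels first, so that 0 and 1 become `0#` and `1#` themselves rather
    -- than differences. Solver equations then unfold to the constants that occur in the goals.
    eval : Coeff → Carrier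
    eval (suc p , suc n)        = eval (p , n)
    eval (0 , 0)                = 0#
    eval (1 , 0)                = 1#
    eval (suc (suc p) , 0)      = fromℕ (suc (suc p))
    eval (0 , suc n)            = - fromℕ (suc n)

    x-0≈x : ∀ x → x - 0# ≈ x
    x-0≈x x = trans (+-congˡ ε⁻¹≈ε) (+-identityʳ x)

    interchange : ∀ w x y z → (w + x) + (y + z) ≈ (w + y) + (x + z)
    interchange = CSProps.interchange (record { isCommutativeSemigroup = +-isCommutativeSemigroup })

    eval≈value : ∀ c → eval c ≈ value c
    eval≈value (0 , 0)             = sym (x-0≈x 0#)
    eval≈value (1 , 0)             = sym (trans (x-0≈x _) (+-identityʳ 1#))
    eval≈value (suc (suc p) , 0)   = sym (x-0≈x _)
    eval≈value (0 , suc n)         = sym (+-identityˡ _)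
    eval≈value (suc p , suc n)     = begin-equality
      eval (p , n)                                ≈⟨ eval≈value (p , n) ⟩
      fromℕ p - fromℕ n                           ≈⟨ +-identityˡ _ ⟨
      0# + (fromℕ p - fromℕ n)                    ≈⟨ +-congʳ (-‿inverseʳ 1#) ⟨
      (1# - 1#) + (fromℕ p - fromℕ n)             ≈⟨ interchange _ _ _ _ ⟩
      (1# + fromℕ p) + (- 1# - fromℕ n)           ≈⟨ +-congˡ (⁻¹-∙-comm _ _) ⟩
      fromℕ (suc p) - fromℕ (suc n)               ∎

    value-+ : ∀ c d → value (c ℤ.+ d) ≈ value c + value d
    value-+ (p , n) (p′ , n′) = begin-equality
      fromℕ (p ℕ.+ p′) - fromℕ (n ℕ.+ n′)               ≈⟨ +-cong (fromℕ-+ p p′) (-‿cong (fromℕ-+ n n′)) ⟩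
      (fromℕ p + fromℕ p′) - (fromℕ n + fromℕ n′)       ≈⟨ +-congˡ (⁻¹-∙-comm _ _) ⟨
      (fromℕ p + fromℕ p′) + (- fromℕ n + - fromℕ n′)   ≈⟨ interchange _ _ _ _ ⟩
      value (p , n) + value (p′ , n′)                   ∎

    value-* : ∀ c d → value (c ℤ.* d) ≈ value c * value d
    value-* (p , n) (p′ , n′) = begin-equality
      fromℕ (p ℕ.* p′ ℕ.+ n ℕ.* n′) - fromℕ (p ℕ.* n′ ℕ.+ n ℕ.* p′)
        ≈⟨ value-+ (p ℕ.* p′ , p ℕ.* n′) (n ℕ.* n′ , n ℕ.* p′) ⟩
      (fromℕ (p ℕ.* p′) - fromℕ (p ℕ.* n′)) + (fromℕ (n ℕ.* n′) - fromℕ (n ℕ.* p′))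
        ≈⟨ +-cong (+-cong (fromℕ-* p p′) (-‿cong (fromℕ-* p n′))) (+-cong (fromℕ-* n n′) (-‿cong (fromℕ-* n p′))) ⟩
      (P * P′ - P * N′) + (N * N′ - N * P′)
        ≈⟨ +-cong (+-congˡ (-‿distribʳ-* P N′)) (trans (+-comm _ _) (+-cong (-‿distribˡ-* N P′) negneg)) ⟩
      (P * P′ + P * - N′) + (- N * P′ + - N * - N′)
        ≈⟨ +-cong (distribˡ _ _ _) (distribˡ _ _ _) ⟨
      P * (P′ - N′) + - N * (P′ - N′)
        ≈⟨ distribʳ _ _ _ ⟨
      (P - N) * (P′ - N′) ∎
      where
      P = fromℕ p ; P′ = fromℕ p′ ; N = fromℕ n ; N′ = fromℕ n′
      negneg : N * N′ ≈ - N * - N′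
      negneg = begin-equality
        N * N′         ≈⟨ ⁻¹-involutive _ ⟨
        - - (N * N′)   ≈⟨ -‿cong (-‿distribʳ-* N N′) ⟩
        - (N * - N′)   ≈⟨ -‿distribˡ-* N (- N′) ⟩
        - N * - N′     ∎

    value-neg : ∀ c → value (ℤ.- c) ≈ - value c
    value-neg (p , n) = begin-equality
      fromℕ n - fromℕ p          ≈⟨ +-comm _ _ ⟩
      - fromℕ p + fromℕ n        ≈⟨ +-congˡ (⁻¹-involutive _) ⟨
      - fromℕ p - - fromℕ n      ≈⟨ ⁻¹-∙-comm _ _ ⟩
      - (fromℕ p - fromℕ n)      ∎

    evaluation : coeffs ACR.-Raw-AlmostCommutative⟶ ACR.fromCommutativeRing commutativeRing
    evaluation = record
      { ⟦_⟧    = eval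
      ; +-homo = λ c d → trans (eval≈value (c ℤ.+ d))
                   (trans (value-+ c d) (sym (+-cong (eval≈value c) (eval≈value d))))
      ; *-homo = λ c d → trans (eval≈value (c ℤ.* d))
                   (trans (value-* c d) (sym (*-cong (eval≈value c) (eval≈value d))))
      ; -‿homo = λ c → trans (eval≈value (ℤ.- c))
                   (trans (value-neg c) (-‿cong (sym (eval≈value c))))
      ; 0-homo = refl
      ; 1-homo = refl
      }

    coeff-≟ : ∀ c d → Maybe (eval c ≈ eval d)
    coeff-≟ (p , n) (p′ , n′) with p ℕ.+ n′ ℕ.≟ p′ ℕ.+ n
    ... | no _   = nothing
    ... | yes eq = just (begin-equality
        eval (p , n)              ≈⟨ eval≈value (p , n) ⟩
        value (p , n)             ≈⟨ x-0≈x _ ⟨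
        value (p , n) - 0#        ≈⟨ +-congˡ (-‿cong (-‿inverseʳ N′)) ⟨
        (P - N) - (N′ - N′)       ≈⟨ +-congˡ (trans (sym (⁻¹-∙-comm _ _)) (trans (+-congˡ (⁻¹-involutive _)) (+-comm _ _))) ⟩
        (P - N) + (N′ - N′)       ≈⟨ interchange _ _ _ _ ⟩
        (P + N′) + (- N - N′)     ≈⟨ +-cong (trans (sym (fromℕ-+ p n′)) (trans (reflexive (≡.cong fromℕ eq)) (fromℕ-+ p′ n))) (+-comm _ _) ⟩
        (P′ + N) + (- N′ - N)     ≈⟨ interchange _ _ _ _ ⟩
        (P′ - N′) + (N - N)       ≈⟨ trans (+-congˡ (-‿inverseʳ N)) (+-identityʳ _) ⟩
        value (p′ , n′)           ≈⟨ eval≈value (p′ , n′) ⟨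
        eval (p′ , n′)            ∎)
      where P = fromℕ p ; P′ = fromℕ p′ ; N = fromℕ n ; N′ = fromℕ n′

  module Solver = Algebra.Solver.Ring coeffs (ACR.fromCommutativeRing commutativeRing) evaluation coeff-≟
  open Solver public using (Polynomial; solve; con; _:=_; _:+_; _:*_; _:-_; :-_)

  :0 :1 : ∀ {n} → Polynomial n
  :0 = con (0 , 0)
  :1 = con (1 , 0)

  -- Spelled as a repeated addition of `:1`, ending in `:0`, to match the unfolding of `fromℕ` on
  -- literals.
  :fromℕ : ∀ {n} → ℕ → Polynomial n
  :fromℕ zero    = :0
  :fromℕ (suc n) = :1 :+ :fromℕ n

  -- The second hypothesis says v - u ≈ y - x, without subtraction; the ring solver proves it.
  rearrange-≤ : ∀ {x y u v} → x ≤ y → v + x ≈ u + y → u ≤ v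
  rearrange-≤ {x} {y} {u} {v} x≤y eq = begin
    u               ≈⟨ solve 2 (λ u x → u := (:- x) :+ (u :+ x)) refl u x ⟩
    - x + (u + x)   ≤⟨ +-monoʳ-≤ (- x) (+-monoʳ-≤ u x≤y) ⟩
    - x + (u + y)   ≈⟨ +-congˡ eq ⟨
    - x + (v + x)   ≈⟨ solve 2 (λ v x → (:- x) :+ (v :+ x) := v) refl v x ⟩
    v               ∎

  infixl 5 _⊕_

  _⊕_ : ∀ {w x y z} → w ≤ x → y ≤ z → w + y ≤ x + z
  _⊕_ {w} {x} {y} {z} w≤x y≤z = begin
    w + y ≤⟨ +-monoʳ-≤ w y≤z ⟩
    w + z ≈⟨ +-comm w z ⟩
    z + w ≤⟨ +-monoʳ-≤ z w≤x ⟩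
    z + x ≈⟨ +-comm z x ⟩
    x + z ∎

  ≤-stable : ∀ {x y} → ¬ ¬ x ≤ y → x ≤ y
  ≤-stable = decidable-stable (_ ≤? _)

  ≰⇒> : ∀ {x y} → ¬ x ≤ y → y < x
  ≰⇒> = ToStrict.≰⇒> _≈_ _≤_ sym ≤-reflexive total

  ≮⇒≥ : ∀ {x y} → ¬ x < y → y ≤ x
  ≮⇒≥ = ToStrict.≮⇒≥ _≈_ _≤_ sym _≟_ ≤-reflexive total

  <⇒≱ : ∀ {x y} → x < y → ¬ y ≤ x
  <⇒≱ = ToStrict.<⇒≱ _≈_ _≤_ antisym

  <⇒≤ : ∀ {x y} → x < y → x ≤ y
  <⇒≤ = proj₁

  <-respʳ : ∀ {x y z} → y ≈ z → x < y → x < z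
  <-respʳ y≈z (x≤y , x≉y) = ≤-trans x≤y (≤-reflexive y≈z) , λ x≈z → x≉y (trans x≈z (sym y≈z))

  infix 4 _<?_

  _<?_ : ∀ x y → Dec (x < y)
  _<?_ = ToStrict.<-decidable _≈_ _≤_ _≟_ _≤?_

  rearrange-< : ∀ {x y u v} → x < y → v + x ≈ u + y → u < v
  rearrange-< {x} {y} {u} {v} (x≤y , x≉y) eq = rearrange-≤ x≤y eq , λ u≈v → x≉y (begin-equality
    x               ≈⟨ solve 2 (λ u x → x := (:- u) :+ (u :+ x)) refl u x ⟩
    - u + (u + x)   ≈⟨ +-congˡ (+-congʳ u≈v) ⟩
    - u + (v + x)   ≈⟨ +-congˡ eq ⟩
    - u + (u + y)   ≈⟨ solve 2 (λ u y → (:- u) :+ (u :+ y) := y) refl u y ⟩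
    y               ∎)

  x≤y⇒0≤y-x : ∀ {x y} → x ≤ y → 0# ≤ y - x
  x≤y⇒0≤y-x {x} {y} x≤y = rearrange-≤ x≤y (solve 2 (λ x y → (y :- x) :+ x := :0 :+ y) refl x y)

  x<y⇒0<y-x : ∀ {x y} → x < y → 0# < y - x
  x<y⇒0<y-x {x} {y} x<y = rearrange-< x<y (solve 2 (λ x y → (y :- x) :+ x := :0 :+ y) refl x y)

  *-monoʳ-≤ : ∀ {x y z} → 0# ≤ x → y ≤ z → x * y ≤ x * z
  *-monoʳ-≤ {x} {y} {z} 0≤x y≤z = rearrange-≤ (*-nonNegative 0≤x (x≤y⇒0≤y-x y≤z))
    (solve 3 (λ x y z → x :* z :+ :0 := x :* y :+ x :* (z :- y)) refl x y z)

  *-monoˡ-≤ : ∀ {x y z} → 0# ≤ x → y ≤ z → y * x ≤ z * x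
  *-monoˡ-≤ {x} {y} {z} 0≤x y≤z = begin
    y * x ≈⟨ *-comm y x ⟩
    x * y ≤⟨ *-monoʳ-≤ 0≤x y≤z ⟩
    x * z ≈⟨ *-comm x z ⟩
    z * x ∎

  +-nonNegative : ∀ {x y} → 0# ≤ x → 0# ≤ y → 0# ≤ x + y
  +-nonNegative 0≤x 0≤y = ≤-trans (≤-reflexive (sym (+-identityʳ 0#))) (0≤x ⊕ 0≤y)

  0≤1 : 0# ≤ 1#
  0≤1 with total 0# 1#
  ... | inj₁ 0≤1 = 0≤1
  ... | inj₂ 1≤0 = ≤-trans (*-nonNegative 0≤-1 0≤-1)
    (≤-reflexive (solve 0 ((:- :1) :* (:- :1) := :1) refl))
    where
    0≤-1 : 0# ≤ - 1#
    0≤-1 = rearrange-≤ 1≤0 (solve 0 ((:- :1) :+ :1 := :0 :+ :0) refl)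

  0<1 : 0# < 1#
  0<1 = 0≤1 , 0≉1

  0≤fromℕ : ∀ n → 0# ≤ fromℕ n
  0≤fromℕ zero    = ≤-refl
  0≤fromℕ (suc n) = +-nonNegative 0≤1 (0≤fromℕ n)

  fromℕ-mono : ∀ {m n} → m ℕ.≤ n → fromℕ m ≤ fromℕ n
  fromℕ-mono {n = n} ℕ.z≤n = 0≤fromℕ n
  fromℕ-mono (ℕ.s≤s m≤n)   = ≤-refl ⊕ fromℕ-mono m≤n

  fromℕ-cancel-< : ∀ {m n} → fromℕ m < fromℕ n → m ℕ.< n
  fromℕ-cancel-< m<n = ℕ.≰⇒> λ n≤m → <⇒≱ m<n (fromℕ-mono n≤m)

  0<fromℕ-suc : ∀ n → 0# < fromℕ (suc n)
  0<fromℕ-suc n = ≰⇒> λ 1+n≤0 → <⇒≱ 0<1 (rearrange-≤ (1+n≤0 ⊕ 0≤fromℕ n)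
    (solve 1 (λ n → :0 :+ ((:1 :+ n) :+ :0) := :1 :+ (:0 :+ n)) refl (fromℕ n)))

  fromℕ-mono-< : ∀ {m n} → m ℕ.< n → fromℕ m < fromℕ n
  fromℕ-mono-< {m} {n} m<n = ≰⇒> λ n≤m → <⇒≱ 0<1
    (rearrange-≤ (fromℕ-mono m<n ⊕ n≤m)
      (solve 2 (λ m n → :0 :+ ((:1 :+ m) :+ n) := :1 :+ (n :+ m)) refl (fromℕ m) (fromℕ n)))

  fromℕ-cancel-≤ : ∀ {m n} → fromℕ m ≤ fromℕ n → m ℕ.≤ n
  fromℕ-cancel-≤ m≤n = ℕ.≮⇒≥ λ n<m → <⇒≱ (fromℕ-mono-< n<m) m≤n

  inverse-suc : ∀ n → fromℕ (suc n) * fromℕ (suc n) ⁻¹ ≈ 1#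
  inverse-suc n = ⁻¹-inverseʳ (λ eq → proj₂ (0<fromℕ-suc n) (sym eq))

  0≤⁻¹ : ∀ {x} → 0# < x → 0# ≤ x ⁻¹
  0≤⁻¹ {x} (0≤x , 0≉x) = ≤-stable λ 0≰x⁻¹ → <⇒≱ 0<1 (begin
    1#           ≈⟨ ⁻¹-inverseʳ (0≉x ∘ sym) ⟨
    x * x ⁻¹     ≤⟨ *-monoʳ-≤ 0≤x (<⇒≤ (≰⇒> 0≰x⁻¹)) ⟩
    x * 0#       ≈⟨ zeroʳ x ⟩
    0#           ∎)

  *-positive : ∀ {x y} → 0# < x → 0# < y → 0# < x * y
  *-positive {x} {y} (0≤x , 0≉x) (0≤y , 0≉y) = *-nonNegative 0≤x 0≤y , λ 0≈xy → 0≉y (begin-equality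
    0#               ≈⟨ zeroʳ (x ⁻¹) ⟨
    x ⁻¹ * 0#        ≈⟨ *-congˡ 0≈xy ⟩
    x ⁻¹ * (x * y)   ≈⟨ solve 3 (λ i x y → i :* (x :* y) := (x :* i) :* y) refl (x ⁻¹) x y ⟩
    (x * x ⁻¹) * y   ≈⟨ *-congʳ (⁻¹-inverseʳ (0≉x ∘ sym)) ⟩
    1# * y           ≈⟨ *-identityˡ y ⟩
    y                ∎)

  0<⁻¹ : ∀ {x} → 0# < x → 0# < x ⁻¹
  0<⁻¹ {x} 0<x = 0≤⁻¹ 0<x , λ 0≈x⁻¹ → 0≉1 (begin-equality
    0#        ≈⟨ zeroʳ x ⟨
    x * 0#    ≈⟨ *-congˡ 0≈x⁻¹ ⟩
    x * x ⁻¹  ≈⟨ ⁻¹-inverseʳ (proj₂ 0<x ∘ sym) ⟩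
    1#        ∎)

  -- Inequalities between finite sums.

  sum-mono-at : ∀ {n} {f g : Vector Carrier n} {c} (i : Fin n) →
    (∀ j → f j ≤ g j) → f i + c ≤ g i → sum f + c ≤ sum g
  sum-mono : ∀ {n} {f g : Vector Carrier n} → (∀ j → f j ≤ g j) → sum f ≤ sum g

  sum-mono {zero}  f≤g = ≤-refl
  sum-mono {suc n} f≤g = f≤g zero ⊕ sum-mono (f≤g ∘ suc)

  sum-mono-at {f = f} {g} {c} zero f≤g fᵢ+c≤gᵢ =
    rearrange-≤ (fᵢ+c≤gᵢ ⊕ sum-mono (f≤g ∘ suc))
      (solve 5 (λ a b c d e → (d :+ e) :+ ((a :+ c) :+ b) := ((a :+ b) :+ c) :+ (d :+ e)) refl
        (f zero) (sum (f ∘ suc)) c (g zero) (sum (g ∘ suc)))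
  sum-mono-at {f = f} {g} {c} (suc i) f≤g fᵢ+c≤gᵢ =
    rearrange-≤ (f≤g zero ⊕ sum-mono-at i (f≤g ∘ suc) fᵢ+c≤gᵢ)
      (solve 5 (λ a b c d e → (d :+ e) :+ (a :+ (b :+ c)) := ((a :+ b) :+ c) :+ (d :+ e)) refl
        (f zero) (sum (f ∘ suc)) c (g zero) (sum (g ∘ suc)))

  -- By `sum-mono-at` a surplus `g i - f i` at one index survives in the sums, since no other index
  -- can compensate for it.
  sum-tight : ∀ {n} {f g : Vector Carrier n} → (∀ j → f j ≤ g j) → sum g ≤ sum f → ∀ i → f i ≈ g i
  sum-tight {f = f} {g} f≤g ∑g≤∑f i = antisym (f≤g i)
    (rearrange-≤ (sum-mono-at {c = g i - f i} i f≤g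
        (≤-reflexive (solve 2 (λ x y → x :+ (y :- x) := y) refl (f i) (g i))) ⊕ ∑g≤∑f)
      (solve 4 (λ x y s t → x :+ ((s :+ (y :- x)) :+ t) := y :+ (t :+ s)) refl (f i) (g i) (sum f) (sum g)))

  sum-nonNegative : ∀ {n} {f : Vector Carrier n} → (∀ j → 0# ≤ f j) → 0# ≤ sum f
  sum-nonNegative {n} 0≤f = ≤-trans (≤-reflexive (sym (sum-replicate-zero n))) (sum-mono 0≤f)

  ∑-distrib-- : ∀ {n} (f g : Vector Carrier n) → sum (λ i → f i - g i) ≈ sum f - sum g
  ∑-distrib-- f g = begin-equality
    sum (λ i → f i - g i)                          ≈⟨ solve 2 (λ s t → s := (s :+ t) :- t) refl _ (sum g) ⟩
    sum (λ i → f i - g i) + sum g - sum g          ≈⟨ +-congʳ (∑-distrib-+ _ g) ⟨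
    sum (λ i → f i - g i + g i) - sum g
      ≈⟨ +-congʳ (sum-cong-≋ λ i → solve 2 (λ s t → (s :- t) :+ t := s) refl (f i) (g i)) ⟩
    sum f - sum g ∎

  sum-const : ∀ n x → sum {n} (λ _ → x) ≈ fromℕ n * x
  sum-const zero    x = sym (zeroˡ x)
  sum-const (suc n) x = trans (+-congˡ (sum-const n x))
    (solve 2 (λ n x → x :+ n :* x := (:1 :+ n) :* x) refl (fromℕ n) x)

  -- Nothing is assumed at `i`: moving the two `i`-th terms across leaves an inequality between the
  -- remaining terms. It serves for requests, where only the requested page may change in the other
  -- direction.
  sum-exchange : ∀ {n} {f g : Vector Carrier n} (i : Fin n) →
    (∀ j → j ≢ i → f j ≤ g j) → sum f + g i ≤ sum g + f i
  sum-exchange {f = f} {g} zero f≤g = rearrange-≤ (sum-mono λ j → f≤g (suc j) λ ())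
    (solve 4 (λ a b c d → ((c :+ d) :+ a) :+ b := ((a :+ b) :+ c) :+ d) refl
      (f zero) (sum (f ∘ suc)) (g zero) (sum (g ∘ suc)))
  sum-exchange {f = f} {g} (suc i) f≤g = rearrange-≤
    (f≤g zero (λ ()) ⊕ sum-exchange i λ j j≢i → f≤g (suc j) λ { ≡.refl → j≢i ≡.refl })
    (solve 6 (λ a b c d u v → ((c :+ d) :+ u) :+ (a :+ (b :+ v)) := ((a :+ b) :+ v) :+ (c :+ (d :+ u))) refl
      (f zero) (sum (f ∘ suc)) (g zero) (sum (g ∘ suc)) (f (suc i)) (g (suc i)))

  sum-update : ∀ {n} {f g : Vector Carrier n} (i : Fin n) →
    (∀ j → j ≢ i → f j ≈ g j) → sum f + g i ≈ sum g + f i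
  sum-update i f≈g = antisym (sum-exchange i λ j neq → ≤-reflexive (f≈g j neq))
                             (sum-exchange i λ j neq → ≤-reflexive (sym (f≈g j neq)))

  -- Harmonic sums

  ∑< : ℕ → (ℕ → Carrier) → Carrier
  ∑< zero    f = 0#
  ∑< (suc n) f = ∑< n f + f n

  ∑<-mono : ∀ n {f g} → (∀ j → f j ≤ g j) → ∑< n f ≤ ∑< n g
  ∑<-mono zero    f≤g = ≤-refl
  ∑<-mono (suc n) f≤g = ∑<-mono n f≤g ⊕ f≤g n

  ∑<-+ : ∀ n f g → ∑< n (λ j → f j + g j) ≈ ∑< n f + ∑< n g
  ∑<-+ zero    f g = sym (+-identityʳ 0#)
  ∑<-+ (suc n) f g = trans (+-congʳ (∑<-+ n f g))
    (solve 4 (λ a b c d → (a :+ b) :+ (c :+ d) := (a :+ c) :+ (b :+ d)) refl _ _ (f n) (g n))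

  ∑<-nonNegative : ∀ n {f} → (∀ j → 0# ≤ f j) → 0# ≤ ∑< n f
  ∑<-nonNegative zero    0≤f = ≤-refl
  ∑<-nonNegative (suc n) 0≤f = +-nonNegative (∑<-nonNegative n 0≤f) (0≤f n)

  ∑<-zero : ∀ n {f} → (∀ j → f j ≈ 0#) → ∑< n f ≈ 0#
  ∑<-zero zero    f≈0 = refl
  ∑<-zero (suc n) f≈0 = trans (+-cong (∑<-zero n f≈0) (f≈0 n)) (+-identityʳ 0#)

  ∑<-head : ∀ n f → ∑< (suc n) f ≈ f 0 + ∑< n (f ∘ suc)
  ∑<-head zero    f = +-comm _ _
  ∑<-head (suc n) f = trans (+-congʳ (∑<-head n f)) (+-assoc _ _ _)

  sum-toℕ : ∀ n f → sum {n} (f ∘ toℕ) ≈ ∑< n f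
  sum-toℕ zero    f = refl
  sum-toℕ (suc n) f = trans (+-congˡ (sum-toℕ n (f ∘ suc))) (sym (∑<-head n f))

  1/[1+_] : ℕ → Carrier
  1/[1+ n ] = fromℕ (suc n) ⁻¹

  0<1/[1+n] : ∀ n → 0# < 1/[1+ n ]
  0<1/[1+n] n = 0<⁻¹ (0<fromℕ-suc n)

  0≤1/[1+n] : ∀ n → 0# ≤ 1/[1+ n ]
  0≤1/[1+n] n = <⇒≤ (0<1/[1+n] n)

  1/1≈1 : 1/[1+ 0 ] ≈ 1#
  1/1≈1 = trans (sym (trans (*-congʳ (+-identityʳ 1#)) (*-identityˡ _))) (inverse-suc 0)

  -- The gap between consecutive thresholds, as a multiple of the lower one. The factor `1/[1+ n ]`
  -- is what later adds up to the harmonic number.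
  1/[1+n]-step : ∀ n → 1/[1+ n ] ≈ 1/[1+ suc n ] + 1/[1+ n ] * 1/[1+ suc n ]
  1/[1+n]-step n = begin-equality
    u                                  ≈⟨ trans (*-congˡ (inverse-suc (suc n))) (*-identityʳ u) ⟨
    u * (fromℕ (suc (suc n)) * v)
      ≈⟨ solve 3 (λ u v m → u :* ((:1 :+ m) :* v) := (m :* u) :* v :+ u :* v) refl u v (fromℕ (suc n)) ⟩
    (fromℕ (suc n) * u) * v + u * v    ≈⟨ +-congʳ (trans (*-congʳ (inverse-suc n)) (*-identityˡ v)) ⟩
    v + u * v                          ∎
    where u = 1/[1+ n ] ; v = 1/[1+ suc n ]

  harmonic : ℕ → Carrier
  harmonic n = ∑< n 1/[1+_]

  -- What the capped sum with threshold 1/(j+2) is sure to lose at an uncharged request of level η: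
  -- the whole threshold if η reaches it, otherwise nothing.
  layer : Carrier → ℕ → Carrier
  layer η j = if does (1/[1+ suc j ] ≤? η) then 1/[1+ suc j ] else 0#

  -- The j-th summand is 1/(j+1) - 1/(j+2) or 0, the interval between the thresholds
  -- 1/(j+2) and 1/(j+1) being counted only when η reaches its lower end.
  layer-cake : ∀ n {η} → η ≤ 1# → η ≤ 1/[1+ n ] + ∑< n (λ j → 1/[1+ j ] * layer η j)
  layer-cake zero    {η} η≤1 = begin
    η               ≤⟨ η≤1 ⟩
    1#              ≈⟨ trans (+-identityʳ _) 1/1≈1 ⟨
    1/[1+ 0 ] + 0#  ∎
  layer-cake (suc n) {η} η≤1 with 1/[1+ suc n ] ≤? η in eq
  ... | yes _ = begin
    η                                      ≤⟨ layer-cake n η≤1 ⟩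
    1/[1+ n ] + s                          ≈⟨ +-congʳ (1/[1+n]-step n) ⟩
    1/[1+ suc n ] + 1/[1+ n ] * 1/[1+ suc n ] + s
      ≈⟨ trans (+-assoc _ _ _) (+-congˡ (+-comm _ _)) ⟩
    1/[1+ suc n ] + (s + 1/[1+ n ] * 1/[1+ suc n ]) ∎
    where s = ∑< n (λ j → 1/[1+ j ] * layer η j)
  ... | no 1/≰η = begin
    η                                      ≤⟨ <⇒≤ (≰⇒> 1/≰η) ⟩
    1/[1+ suc n ]                          ≤⟨ rearrange-≤ (∑<-nonNegative n nonneg)
       (solve 3 (λ t s z → (t :+ (s :+ z :* :0)) :+ :0 := t :+ s) refl 1/[1+ suc n ] s 1/[1+ n ]) ⟩
    1/[1+ suc n ] + (s + 1/[1+ n ] * 0#)   ∎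
    where
    s = ∑< n (λ j → 1/[1+ j ] * layer η j)
    nonneg : ∀ j → 0# ≤ 1/[1+ j ] * layer η j
    nonneg j with does (1/[1+ suc j ] ≤? η)
    ... | true  = *-nonNegative (0≤1/[1+n] j) (0≤1/[1+n] (suc j))
    ... | false = *-nonNegative (0≤1/[1+n] j) ≤-refl

  -- The Riemann sum with `N = 1` suffices. It equals `R`, that is 1/2 + ... + 1/(n+2), so
  -- `harmonic n` is at most 1 + R; its first term alone gives 1 ≤ 2R. Altogether H + 2 ≤ R + 3 ≤
  -- 7R.
  harmonic-bound : ∀ n {u} → ln[1+ suc n ]≤ u → harmonic n + (1# + 1#) ≤ fromℕ 7 * u
  harmonic-bound n {u} ln≤u = rearrange-≤ (H≤1+R ⊕ 1≤2R ⊕ 1≤2R ⊕ 1≤2R ⊕ R≤u ⊕ R≤u ⊕ R≤u ⊕ R≤u ⊕ R≤u ⊕ R≤u ⊕ R≤u)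
    (solve 3 (λ h r u → :fromℕ 7 :* u :+ (h :+ :1 :+ :1 :+ :1 :+ r :+ r :+ r :+ r :+ r :+ r :+ r)
       := (h :+ (:1 :+ :1)) :+ ((:1 :+ r) :+ (r :+ r) :+ (r :+ r) :+ (r :+ r) :+ u :+ u :+ u :+ u :+ u :+ u :+ u)) refl (harmonic n) R u)
    where
    R = ∑< (suc n) (1/[1+_] ∘ suc)
    R≤u : R ≤ u
    R≤u = begin
      R                           ≈⟨ sum-toℕ (suc n) (1/[1+_] ∘ suc) ⟨
      sum {suc n} (λ j → 1/[1+ suc (toℕ j) ])
        ≡⟨ ≡.cong (λ k → sum {k} (λ j → 1/[1+ suc (toℕ j) ])) (ℕ.*-identityʳ (suc n)) ⟨
      riemannSum (suc n) 1        ≤⟨ ln≤u 1 ⟩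
      u                           ∎
    H≤1+R : harmonic n ≤ 1# + R
    H≤1+R = begin
      harmonic n                             ≤⟨ rearrange-≤ (0≤1/[1+n] n ⊕ 0≤1/[1+n] (suc n))
         (solve 3 (λ h x y → (h :+ x :+ y) :+ (:0 :+ :0) := h :+ (x :+ y)) refl _ _ _) ⟩
      harmonic (suc (suc n))                 ≈⟨ ∑<-head (suc n) 1/[1+_] ⟩
      1/[1+ 0 ] + R                          ≈⟨ +-congʳ 1/1≈1 ⟩
      1# + R                                 ∎
    1≤2R : 1# ≤ R + R
    1≤2R = begin
      1#                                     ≈⟨ inverse-suc 1 ⟨
      fromℕ 2 * 1/[1+ 1 ]                    ≈⟨ solve 1 (λ h → (:1 :+ (:1 :+ :0)) :* h := h :+ h) refl _ ⟩
      1/[1+ 1 ] + 1/[1+ 1 ]                  ≤⟨ half≤R ⊕ half≤R ⟩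
      R + R                                  ∎
      where
      half≤R : 1/[1+ 1 ] ≤ R
      half≤R = begin
        1/[1+ 1 ]           ≈⟨ +-identityʳ _ ⟨
        1/[1+ 1 ] + 0#      ≤⟨ ≤-refl ⊕ ∑<-nonNegative n (λ j → 0≤1/[1+n] (suc (suc j))) ⟩
        1/[1+ 1 ] + ∑< n (λ j → 1/[1+ suc (suc j) ])  ≈⟨ ∑<-head n (1/[1+_] ∘ suc) ⟨
        R                   ∎

  -- Truncation at a threshold.

  ⊓-lipschitz : ∀ {x y} θ → x ≤ y → y ⊓ θ ≤ (x ⊓ θ) + (y - x)
  ⊓-lipschitz {x} {y} θ x≤y with ⊓-sel x θ
  ... | inj₁ eq = begin
    y ⊓ θ              ≤⟨ x⊓y≤x y θ ⟩
    y                  ≈⟨ solve 2 (λ x y → x :+ (y :- x) := y) refl x y ⟨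
    x + (y - x)        ≈⟨ +-congʳ eq ⟨
    (x ⊓ θ) + (y - x)  ∎
  ... | inj₂ eq = begin
    y ⊓ θ              ≤⟨ x⊓y≤y y θ ⟩
    θ                  ≈⟨ +-identityʳ θ ⟨
    θ + 0#             ≤⟨ ≤-reflexive (sym eq) ⊕ x≤y⇒0≤y-x x≤y ⟩
    (x ⊓ θ) + (y - x)  ∎

  ⊓-flat : ∀ {x y} θ → θ ≤ x → y ⊓ θ ≤ x ⊓ θ
  ⊓-flat {x} {y} θ θ≤x = ≤-trans (x⊓y≤y y θ) (⊓-glb θ≤x ≤-refl)

module Analysis {a ℓ₁ ℓ₂} (K : OrderedField a ℓ₁ ℓ₂) (I : Setting) where

  open OrderedField K hiding (zero)
  open FieldProperties K
  open import Relation.Binary.Reasoning.PartialOrder poset hiding (stop)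
  open Setting I
  open Caching K I
  open Marking
  open State

  -- Pages, agents and marks

  𝟙 : Bool → Carrier
  𝟙 b = if b then 1# else 0#

  0≤𝟙 : ∀ b → 0# ≤ 𝟙 b
  0≤𝟙 true  = 0≤1
  0≤𝟙 false = ≤-refl

  ∉⇒lookup : ∀ {n} {S : Subset n} {q} → q ∉ S → lookup S q ≡ false
  ∉⇒lookup {S = S} {q} q∉S with lookup S q in eq
  ... | true  = contradiction (lookup⇒[]= q S eq) q∉S
  ... | false = ≡.refl

  lookup⇒∉ : ∀ {n} {S : Subset n} {q} → lookup S q ≡ false → q ∉ S
  lookup⇒∉ eq q∈S = case ≡.trans (≡.sym eq) ([]=⇒lookup q∈S) of λ ()

  fromℕ-∣∣ : ∀ {n} (S : Subset n) → fromℕ ∣ S ∣ ≈ sum (𝟙 ∘ lookup S)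
  fromℕ-∣∣ []            = refl
  fromℕ-∣∣ (inside ∷ S)  = +-congˡ (fromℕ-∣∣ S)
  fromℕ-∣∣ (outside ∷ S) = trans (fromℕ-∣∣ S) (sym (+-identityˡ _))

  ∣∪⁅⁆∣ : ∀ {n} {S : Subset n} {p} → p ∉ S → ∣ S ∪ ⁅ p ⁆ ∣ ≡ suc ∣ S ∣
  ∣∪⁅⁆∣ {S = inside  ∷ S} {zero}  p∉S = contradiction here p∉S
  ∣∪⁅⁆∣ {S = outside ∷ S} {zero}  p∉S = ≡.cong (λ T → suc ∣ T ∣) (∪-identityʳ S)
  ∣∪⁅⁆∣ {S = inside  ∷ S} {suc p} p∉S = ≡.cong suc (∣∪⁅⁆∣ {S = S} (p∉S ∘ there))
  ∣∪⁅⁆∣ {S = outside ∷ S} {suc p} p∉S = ∣∪⁅⁆∣ {S = S} (p∉S ∘ there)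

  lookup-∪⁅⁆ : ∀ {n} (S : Subset n) {p q} → q ≢ p → lookup (S ∪ ⁅ p ⁆) q ≡ lookup S q
  lookup-∪⁅⁆ S {p} {q} q≢p with q ∈? S
  ... | yes q∈S = ≡.trans ([]=⇒lookup (x∈p∪q⁺ (inj₁ q∈S))) (≡.sym ([]=⇒lookup q∈S))
  ... | no  q∉S = ≡.trans (∉⇒lookup ([ q∉S , q≢p ∘ x∈⁅y⁆⇒x≡y p ]′ ∘ x∈p∪q⁻ S ⁅ p ⁆)) (≡.sym (∉⇒lookup q∉S))

  ∪⁅⁆-absorb : ∀ {n} {S : Subset n} {p} → p ∈ S → S ∪ ⁅ p ⁆ ≡ S
  ∪⁅⁆-absorb {S = S} {p} p∈S = ⊆-antisym
    ([ id , (λ q∈⁅p⁆ → ≡.subst (_∈ S) (≡.sym (x∈⁅y⁆⇒x≡y p q∈⁅p⁆)) p∈S) ]′ ∘ x∈p∪q⁻ S ⁅ p ⁆)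
    (x∈p∪q⁺ ∘ inj₁)

  agentSum : Agent → Alloc → Carrier
  agentSum i f = sumOver (pagesOf i) f

  module _ {i : Agent} where

    owned : ∀ {q} → owner q ≡ i → lookup (pagesOf i) q ≡ true
    owned {q} eq = ≡.trans (lookup∘tabulate _ q) (dec-true (owner q Fin.≟ i) eq)

    disowned : ∀ {q} → owner q ≢ i → lookup (pagesOf i) q ≡ false
    disowned {q} neq = ≡.trans (lookup∘tabulate _ q) (dec-false (owner q Fin.≟ i) neq)

    ∈pagesOf : ∀ {q} → owner q ≡ i → q ∈ pagesOf i
    ∈pagesOf {q} eq = lookup⇒[]= q _ (owned eq)

    pagesOf∋ : ∀ {q} → q ∈ pagesOf i → owner q ≡ i
    pagesOf∋ {q} q∈ with owner q Fin.≟ i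
    ... | yes eq = eq
    ... | no neq = contradiction q∈ (lookup⇒∉ (disowned neq))

    restrict-≤ : ∀ (f g : Alloc) q → (owner q ≡ i → f q ≤ g q) →
      (if lookup (pagesOf i) q then f q else 0#) ≤ (if lookup (pagesOf i) q then g q else 0#)
    restrict-≤ f g q f≤g with owner q Fin.≟ i
    ... | yes eq rewrite owned eq     = f≤g eq
    ... | no neq rewrite disowned neq = ≤-refl

    agentSum-mono : ∀ {f g : Alloc} → (∀ q → owner q ≡ i → f q ≤ g q) → agentSum i f ≤ agentSum i g
    agentSum-mono {f} {g} f≤g = sum-mono λ q → restrict-≤ f g q (f≤g q)

    agentSum-cong : ∀ {f g : Alloc} → (∀ q → owner q ≡ i → f q ≈ g q) → agentSum i f ≈ agentSum i g
    agentSum-cong f≈g = antisym (agentSum-mono λ q eq → ≤-reflexive (f≈g q eq))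
                                (agentSum-mono λ q eq → ≤-reflexive (sym (f≈g q eq)))

    agentSum-mono-at : ∀ {f g : Alloc} {c} p → owner p ≡ i →
      (∀ q → owner q ≡ i → f q ≤ g q) → f p + c ≤ g p → agentSum i f + c ≤ agentSum i g
    agentSum-mono-at {f} {g} p eq f≤g fₚ+c≤gₚ = sum-mono-at p (λ q → restrict-≤ f g q (f≤g q)) at-p
      where
      at-p : (if lookup (pagesOf i) p then _ else 0#) + _ ≤ (if lookup (pagesOf i) p then _ else 0#)
      at-p rewrite owned eq = fₚ+c≤gₚ

    agentSum-tight : ∀ {f g : Alloc} → (∀ q → owner q ≡ i → f q ≤ g q) → agentSum i g ≤ agentSum i f →
      ∀ q → owner q ≡ i → f q ≈ g q
    agentSum-tight {f} {g} f≤g g≤f q eq = ≡.subst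
      (λ b → (if b then f q else 0#) ≈ (if b then g q else 0#)) (owned eq)
      (sum-tight (λ q → restrict-≤ f g q (f≤g q)) g≤f q)

    agentSum-+ : ∀ f g → agentSum i (λ q → f q + g q) ≈ agentSum i f + agentSum i g
    agentSum-+ f g = trans (sum-cong-≋ split) (∑-distrib-+ {∣𝒫∣} _ _)
      where
      split : ∀ q → (if lookup (pagesOf i) q then f q + g q else 0#)
                  ≈ (if lookup (pagesOf i) q then f q else 0#) + (if lookup (pagesOf i) q then g q else 0#)
      split q with lookup (pagesOf i) q
      ... | true  = refl
      ... | false = sym (+-identityʳ 0#)

    agentSum-nonNegative : ∀ {f} → (∀ q → 0# ≤ f q) → 0# ≤ agentSum i f
    agentSum-nonNegative 0≤f = sum-nonNegative nonneg
      where
      nonneg : ∀ q → 0# ≤ (if lookup (pagesOf i) q then _ else 0#)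
      nonneg q with lookup (pagesOf i) q
      ... | true  = 0≤f q
      ... | false = ≤-refl

    agentSum-zero : ∀ {f : Alloc} → (∀ q → owner q ≡ i → f q ≈ 0#) → agentSum i f ≈ 0#
    agentSum-zero {f} f≈0 = trans (sum-cong-≋ vanish) (sum-replicate-zero ∣𝒫∣)
      where
      vanish : ∀ q → (if lookup (pagesOf i) q then f q else 0#) ≈ 0#
      vanish q with owner q Fin.≟ i
      ... | yes eq rewrite owned eq     = f≈0 q eq
      ... | no neq rewrite disowned neq = refl

    agentSum-support : ∀ {f : Alloc} → (∀ q → owner q ≢ i → f q ≈ 0#) → sum f ≈ agentSum i f
    agentSum-support {f} f≈0 = sum-cong-≋ agree
      where
      agree : ∀ q → f q ≈ (if lookup (pagesOf i) q then f q else 0#)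
      agree q with owner q Fin.≟ i
      ... | yes eq rewrite owned eq     = refl
      ... | no neq rewrite disowned neq = f≈0 q neq

  sum-single : ∀ {n} (j : Fin n) x → sum (λ i → if does (j Fin.≟ i) then x else 0#) ≈ x
  sum-single {suc n} zero x = trans (+-congˡ (sum-replicate-zero n)) (+-identityʳ x)
  sum-single {suc n} (suc j) x = trans (+-identityˡ _) (sum-single j x)

  sum-agents : ∀ f → sum (λ i → agentSum i f) ≈ sum f
  sum-agents f = trans (∑-comm λ i q → if lookup (pagesOf i) q then f q else 0#) (sum-cong-≋ λ q → trans
    (sum-cong-≋ {m} λ i → reflexive (≡.cong (λ b → if b then f q else 0#) (lookup∘tabulate (λ p → does (owner p Fin.≟ i)) q)))
    (sum-single (owner q) (f q)))

  count : Subset ∣𝒫∣ → Agent → ℕ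
  count M i = ∣ M ∩ pagesOf i ∣

  fromℕ-count : ∀ M i → fromℕ (count M i) ≈ agentSum i (𝟙 ∘ lookup M)
  fromℕ-count M i = trans (fromℕ-∣∣ (M ∩ pagesOf i)) (sum-cong-≋ agree)
    where
    agree : ∀ q → 𝟙 (lookup (M ∩ pagesOf i) q) ≈ (if lookup (pagesOf i) q then 𝟙 (lookup M q) else 0#)
    agree q rewrite lookup-zipWith _∧_ q M (pagesOf i) with lookup M q | lookup (pagesOf i) q
    ... | true  | true  = refl
    ... | true  | false = refl
    ... | false | true  = refl
    ... | false | false = refl

  count-new : ∀ M {p} → p ∉ M → count (M ∪ ⁅ p ⁆) (owner p) ≡ suc (count M (owner p))
  count-new M {p} p∉M = ≡.trans (≡.cong ∣_∣ split) (∣∪⁅⁆∣ {S = M ∩ pagesOf (owner p)} (p∉M ∘ proj₁ ∘ x∈p∩q⁻ _ _))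
    where
    split : (M ∪ ⁅ p ⁆) ∩ pagesOf (owner p) ≡ (M ∩ pagesOf (owner p)) ∪ ⁅ p ⁆
    split = ≡.trans (∩-distribʳ-∪ (pagesOf (owner p)) M ⁅ p ⁆) (≡.cong ((M ∩ pagesOf (owner p)) ∪_)
      (⊆-antisym (proj₁ ∘ x∈p∩q⁻ _ _)
        (λ q∈⁅p⁆ → x∈p∩q⁺ (q∈⁅p⁆ , ∈pagesOf (≡.cong owner (x∈⁅y⁆⇒x≡y p q∈⁅p⁆))))))

  count-other : ∀ M {p i} → owner p ≢ i → count (M ∪ ⁅ p ⁆) i ≡ count M i
  count-other M {p} {i} neq = ≡.cong ∣_∣ (⊆-antisym
    (λ q∈ → let q∈∪ , q∈P = x∈p∩q⁻ _ _ q∈ in x∈p∩q⁺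
      ([ id , (λ q∈⁅p⁆ → contradiction (≡.trans (≡.cong owner (≡.sym (x∈⁅y⁆⇒x≡y p q∈⁅p⁆))) (pagesOf∋ q∈P)) neq) ]′
        (x∈p∪q⁻ M ⁅ p ⁆ q∈∪) , q∈P))
    (λ q∈ → let q∈M , q∈P = x∈p∩q⁻ _ _ q∈ in x∈p∩q⁺ (x∈p∪q⁺ (inj₁ q∈M) , q∈P)))

  held : Alloc → Agent → Carrier
  held y i = agentSum i λ q → 1# - y q

  sum-held : ∀ y → sum (λ i → held y i) + sum y ≈ fromℕ ∣𝒫∣
  sum-held y = begin-equality
    sum (λ i → held y i) + sum y   ≈⟨ +-congʳ (sum-agents _) ⟩
    sum (λ q → 1# - y q) + sum y   ≈⟨ ∑-distrib-+ _ y ⟨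
    sum (λ q → 1# - y q + y q)     ≈⟨ sum-cong-≋ {∣𝒫∣} (λ q → solve 1 (λ y → (:1 :- y) :+ y := :1) refl (y q)) ⟩
    sum {∣𝒫∣} (λ _ → 1#)                 ≈⟨ sum-const ∣𝒫∣ 1# ⟩
    fromℕ ∣𝒫∣ * 1#                 ≈⟨ *-identityʳ _ ⟩
    fromℕ ∣𝒫∣                      ∎

  target : Carrier
  target = fromℕ ∣𝒫∣ - fromℕ k

  sum-held-excess : ∀ y → sum (λ i → held y i) + sum y ≈ fromℕ k + target
  sum-held-excess y = trans (sum-held y) (solve 2 (λ n k → n := k :+ (n :- k)) refl _ _)

  held-mono : ∀ {y z i} → (∀ q → owner q ≡ i → y q ≤ z q) → held z i ≤ held y i
  held-mono {y} {z} y≤z = agentSum-mono λ q eq → rearrange-≤ (y≤z q eq)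
    (solve 2 (λ y z → (:1 :- y) :+ y := (:1 :- z) :+ z) refl (y q) (z q))

  held-cong : ∀ {y z i} → (∀ q → owner q ≡ i → y q ≈ z q) → held y i ≈ held z i
  held-cong y≈z = agentSum-cong λ q eq → +-congˡ (-‿cong (y≈z q eq))

  -- The change of the total takes place inside `i`. This is how the target for the total turns into
  -- a statement about the holding of one agent.
  held-conserved : ∀ {y z i} → (∀ q → owner q ≢ i → z q ≈ y q) → held y i + sum y ≈ held z i + sum z
  held-conserved {y} {z} {i} z≈y = begin-equality
    held y i + sum y                          ≈⟨ +-congʳ held-split ⟩
    held z i + agentSum i increase + sum y
      ≈⟨ +-congʳ (+-congˡ (agentSum-support λ q neq → trans (+-congʳ (z≈y q neq)) (-‿inverseʳ (y q)))) ⟨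
    held z i + sum increase + sum y           ≈⟨ +-congʳ (+-congˡ (∑-distrib-- z y)) ⟩
    held z i + (sum z - sum y) + sum y
      ≈⟨ solve 3 (λ h s t → h :+ (t :- s) :+ s := h :+ t) refl (held z i) (sum y) (sum z) ⟩
    held z i + sum z                          ∎
    where
    increase : Alloc
    increase q = z q - y q
    held-split : held y i ≈ held z i + agentSum i increase
    held-split = trans
      (agentSum-cong λ q _ → solve 2 (λ y z → :1 :- y := (:1 :- z) :+ (z :- y)) refl (y q) (z q))
      (agentSum-+ _ _)

  count-cong : ∀ M N {i} → (∀ q → owner q ≡ i → lookup M q ≡ lookup N q) → count M i ≡ count N i
  count-cong M N {i} M≡N = ≡.cong ∣_∣ {x = M ∩ pagesOf i} {y = N ∩ pagesOf i}
    (⊆-antisym (shift M N M≡N) (shift N M λ q eq → ≡.sym (M≡N q eq)))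
    where
    shift : ∀ M N → (∀ q → owner q ≡ i → lookup M q ≡ lookup N q) → ∀ {q} → q ∈ M ∩ pagesOf i → q ∈ N ∩ pagesOf i
    shift M N M≡N {q} q∈ = let q∈M , q∈P = x∈p∩q⁻ _ _ q∈ in
      x∈p∩q⁺ (lookup⇒[]= q _ (≡.trans (≡.sym (M≡N q (pagesOf∋ q∈P))) ([]=⇒lookup q∈M)) , q∈P)

  module Marks {M : Subset ∣𝒫∣} {y : Alloc} (y≤1 : ∀ q → y q ≤ 1#) (M⇒0 : ∀ {q} → q ∈ M → y q ≈ 0#) where

    mark≤held : ∀ q → 𝟙 (lookup M q) ≤ 1# - y q
    mark≤held q with q ∈? M
    ... | yes q∈M rewrite []=⇒lookup q∈M = rearrange-≤ (≤-reflexive (M⇒0 q∈M))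
      (solve 1 (λ y → (:1 :- y) :+ y := :1 :+ :0) refl (y q))
    ... | no  q∉M rewrite ∉⇒lookup q∉M = x≤y⇒0≤y-x (y≤1 q)

    count≤held : ∀ i → fromℕ (count M i) ≤ held y i
    count≤held i = ≤-trans (≤-reflexive (fromℕ-count M i)) (agentSum-mono λ q _ → mark≤held q)

    count+unmarked≤held : ∀ {q} → q ∉ M → fromℕ (count M (owner q)) + (1# - y q) ≤ held y (owner q)
    count+unmarked≤held {q} q∉M = ≤-trans (≤-reflexive (+-congʳ (fromℕ-count M (owner q))))
      (agentSum-mono-at q ≡.refl (λ q _ → mark≤held q)
        (≡.subst (λ b → 𝟙 b + (1# - y q) ≤ 1# - y q) (≡.sym (∉⇒lookup q∉M)) (≤-reflexive (+-identityˡ _))))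

    held≤count : ∀ {i} → (∀ q → owner q ≡ i → q ∉ M → 1# ≤ y q) → (∀ q → 0# ≤ y q) → held y i ≤ fromℕ (count M i)
    held≤count {i} 1≤y 0≤y = ≤-trans (agentSum-mono held≤mark) (≤-reflexive (sym (fromℕ-count M i)))
      where
      held≤mark : ∀ q → owner q ≡ i → 1# - y q ≤ 𝟙 (lookup M q)
      held≤mark q eq with q ∈? M
      ... | yes q∈M rewrite []=⇒lookup q∈M = rearrange-≤ (0≤y q)
        (solve 1 (λ y → :1 :+ :0 := (:1 :- y) :+ y) refl (y q))
      ... | no  q∉M rewrite ∉⇒lookup q∉M = rearrange-≤ (1≤y q eq q∉M)
        (solve 1 (λ y → :0 :+ :1 := (:1 :- y) :+ y) refl (y q))

    -- The marked pages already account for all of `held y i`, and `mark≤held` holds page by page,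
    -- so `agentSum-tight` leaves nothing for an unmarked page.
    count-tight : ∀ {i} → held y i ≤ fromℕ (count M i) → ∀ q → owner q ≡ i → q ∉ M → y q ≈ 1#
    count-tight {i} held≤ q eq q∉M = begin-equality
      y q                ≈⟨ solve 1 (λ y → y := :1 :- (:1 :- y)) refl (y q) ⟩
      1# - (1# - y q)    ≈⟨ +-congˡ (-‿cong (sym at-q)) ⟩
      1# - 0#            ≈⟨ solve 0 (:1 :- :0 := :1) refl ⟩
      1#                 ∎
      where
      at-q : 0# ≈ 1# - y q
      at-q = ≡.subst (λ b → 𝟙 b ≈ 1# - y q) (∉⇒lookup q∉M)
        (agentSum-tight (λ q _ → mark≤held q) (≤-trans held≤ (≤-reflexive (fromℕ-count M i))) q eq)

  -- The eviction process

  nonTight-anti : ∀ {y z i} → (∀ q → y q ≤ z q) → NonTight z i → NonTight y i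
  nonTight-anti {y} {z} {i} y≤z (k≤ , k≉) = ≰⇒> λ held≤k →
    k≉ (antisym k≤ (≤-trans (held-mono {y} {z} λ q _ → y≤z q) held≤k))

  nonTight-cong : ∀ {y z i} → held y i ≈ held z i → NonTight y i → NonTight z i
  nonTight-cong eq = λ (k≤ , k≉) → ≤-trans k≤ (≤-reflexive eq) , λ k≈ → k≉ (trans k≈ (sym eq))

  <-below : ∀ {x y z} → x ≤ y → y < z → x < z
  <-below x≤y y<z = ≰⇒> λ z≤x → <⇒≱ y<z (≤-trans z≤x x≤y)

  abstract
    Unmarked? : ∀ s q → Dec (Unmarked s q)
    Unmarked? s q = q ∈? snapshot s ×-dec ¬? (q ∈? marked s)

    NonTight? : ∀ y i → Dec (NonTight y i)
    NonTight? y i = _ <? _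

  record Rise {ℓ} (Active : Alloc → Page → Set ℓ) (y : Alloc) (δ : Carrier) (y′ : Alloc) : Set (a ⊔ ℓ₁ ⊔ ℓ₂ ⊔ ℓ) where
    field
      positive : 0# < δ
      raised   : Raised (Active y) δ y y′
      steady   : ∀ ε w → 0# ≤ ε → ε < δ → Raised (Active y) ε y w → ∀ q → Active w q ⇔ Active y q
      capped   : sum y′ ≤ target

  flow-induction : ∀ {ℓ ℓ′} {Active : Alloc → Page → Set ℓ} (P : Alloc → Set ℓ′) →
    (∀ {y δ y′} → Rise Active y δ y′ → P y → P y′) →
    ∀ {y z} → Flow Active y z → P y → P z × sum z ≈ target
  flow-induction P step (stop full)                                 Py = Py , full
  flow-induction P step (rise δ positive raised steady capped flow) Py =
    flow-induction P step flow (step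
      (record { positive = positive ; raised = raised ; steady = steady ; capped = capped }) Py)

  module _ {ℓ} {S : Page → Set ℓ} (S? : ∀ q → Dec (S q)) where

    -- Produces the allocations at intermediate moments of a piece, to which the `steady` clause is
    -- applied.
    raise : Carrier → Alloc → Alloc
    raise δ y q = if does (S? q) then y q + δ else y q

    raise-raised : ∀ δ y → Raised S δ y (raise δ y)
    raise-raised δ y q with S? q
    ... | yes Sq = (λ _ → refl) , λ ¬Sq → contradiction Sq ¬Sq
    ... | no ¬Sq = (λ Sq → contradiction Sq ¬Sq) , λ _ → refl

    -- The number of rising pages of `i`, hence the speed at which its holding falls.
    rate : Agent → Carrier
    rate i = agentSum i λ q → 𝟙 (does (S? q))

    rate-positive : ∀ {q} → S q → 0# < rate (owner q)
    rate-positive {q} Sq = ≰⇒> λ rate≤0 → <⇒≱ 0<1 (begin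
      1#                                        ≈⟨ +-identityˡ 1# ⟨
      0# + 1#                                   ≈⟨ +-congʳ (agentSum-zero {owner q} {λ _ → 0#} λ _ _ → refl) ⟨
      agentSum (owner q) (λ _ → 0#) + 1#
        ≤⟨ agentSum-mono-at q ≡.refl (λ q _ → 0≤𝟙 (does (S? q)))
             (≤-reflexive (trans (+-identityˡ 1#) (reflexive (≡.cong 𝟙 (≡.sym (dec-true (S? q) Sq)))))) ⟩
      rate (owner q)                            ≤⟨ rate≤0 ⟩
      0#                                        ∎)

    private
      raised-value : ∀ {δ y z} → Raised S δ y z → ∀ q → z q ≈ y q + 𝟙 (does (S? q)) * δ
      raised-value {δ} {y} {z} raised q with S? q
      ... | yes Sq = trans (proj₁ (raised q) Sq) (+-congˡ (sym (*-identityˡ δ)))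
      ... | no ¬Sq = trans (proj₂ (raised q) ¬Sq) (solve 2 (λ y δ → y := y :+ :0 :* δ) refl (y q) δ)

    held-raised : ∀ {δ y z} → Raised S δ y z → ∀ i → held z i + rate i * δ ≈ held y i
    held-raised {δ} {y} {z} raised i = begin-equality
      held z i + rate i * δ
        ≈⟨ +-congˡ (trans (*-comm _ δ) (trans (*-distribˡ-sum {∣𝒫∣} δ _) (sum-cong-≋ inside-if))) ⟩
      held z i + agentSum i (λ q → δ * 𝟙 (does (S? q)))
        ≈⟨ agentSum-+ (λ q → 1# - z q) _ ⟨
      agentSum i (λ q → (1# - z q) + δ * 𝟙 (does (S? q)))
        ≈⟨ agentSum-cong (λ q _ → trans (+-congʳ (+-congˡ (-‿cong (raised-value raised q))))
             (solve 3 (λ y b δ → (:1 :- (y :+ b :* δ)) :+ δ :* b := :1 :- y) refl (y q) (𝟙 (does (S? q))) δ)) ⟩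
      held y i ∎
      where
      inside-if : ∀ q → δ * (if lookup (pagesOf i) q then 𝟙 (does (S? q)) else 0#)
                      ≈ (if lookup (pagesOf i) q then δ * 𝟙 (does (S? q)) else 0#)
      inside-if q with lookup (pagesOf i) q
      ... | true  = refl
      ... | false = zeroʳ δ

    totalRate : Carrier
    totalRate = sum λ q → 𝟙 (does (S? q))

    totalRate-positive : ∀ {q} → S q → 0# < totalRate
    totalRate-positive {q} Sq = ≰⇒> λ rate≤0 → <⇒≱ 0<1 (begin
      1#                          ≈⟨ +-identityˡ 1# ⟨
      0# + 1#                     ≈⟨ +-congʳ (sum-replicate-zero ∣𝒫∣) ⟨
      sum {∣𝒫∣} (λ _ → 0#) + 1#
        ≤⟨ sum-mono-at q (λ q → 0≤𝟙 (does (S? q)))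
             (≤-reflexive (trans (+-identityˡ 1#) (reflexive (≡.cong 𝟙 (≡.sym (dec-true (S? q) Sq)))))) ⟩
      totalRate                   ≤⟨ rate≤0 ⟩
      0#                          ∎)

    sum-raised : ∀ {δ y z} → Raised S δ y z → sum z ≈ sum y + totalRate * δ
    sum-raised {δ} {y} {z} raised = begin-equality
      sum z                                         ≈⟨ sum-cong-≋ (raised-value raised) ⟩
      sum (λ q → y q + 𝟙 (does (S? q)) * δ)         ≈⟨ ∑-distrib-+ y _ ⟩
      sum y + sum (λ q → 𝟙 (does (S? q)) * δ)       ≈⟨ +-congˡ (sum-cong-≋ {∣𝒫∣} λ q → *-comm (𝟙 (does (S? q))) δ) ⟩
      sum y + sum (λ q → δ * 𝟙 (does (S? q)))       ≈⟨ +-congˡ (*-distribˡ-sum {∣𝒫∣} δ _) ⟨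
      sum y + δ * totalRate                         ≈⟨ +-congˡ (*-comm δ _) ⟩
      sum y + totalRate * δ                         ∎

    raised-mono : ∀ {δ y z} → 0# ≤ δ → Raised S δ y z → ∀ q → y q ≤ z q
    raised-mono {δ} {y} 0≤δ raised q = ≤-trans (≤-reflexive (sym (+-identityʳ (y q))))
      (≤-trans (≤-refl ⊕ *-nonNegative (0≤𝟙 (does (S? q))) 0≤δ) (≤-reflexive (sym (raised-value raised q))))

    raised-mono₂ : ∀ {δ ε y z w} → ε ≤ δ → Raised S ε y w → Raised S δ y z → ∀ q → w q ≤ z q
    raised-mono₂ {δ} {ε} {y} {z} {w} ε≤δ raised-ε raised-δ q = begin
      w q                             ≈⟨ raised-value raised-ε q ⟩
      y q + 𝟙 (does (S? q)) * ε       ≤⟨ ≤-refl ⊕ *-monoʳ-≤ (0≤𝟙 (does (S? q))) ε≤δ ⟩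
      y q + 𝟙 (does (S? q)) * δ       ≈⟨ raised-value raised-δ q ⟨
      z q                             ∎

  Uniform : State → Alloc → Set _
  Uniform s y = ∀ {q q′} → Unmarked s q → Unmarked s q′ → owner q ≡ owner q′ → y q ≈ y q′

  -- The common core of the two eviction processes. `Eligible` is separate from `Active` because
  -- being among the lowest pages is not antitone in `y`: a page may become lowest only later.
  -- Eligibility is antitone, so pages that are ineligible at the start never move.
  record FlowRule {ℓ} (s : State) (Active : Alloc → Page → Set ℓ) : Set (a ⊔ ℓ ⊔ Level.suc (ℓ₁ ⊔ ℓ₂)) where
    field
      active?        : ∀ y q → Dec (Active y q)
      Eligible       : Alloc → Page → Set (ℓ₁ ⊔ ℓ₂)
      eligible       : ∀ {y q} → Active y q → Eligible y q
      eligible-anti  : ∀ {y z q} → (∀ q → y q ≤ z q) → Eligible z q → Eligible y q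
      eligible-<1    : ∀ {y q} → Eligible y q → y q < 1#
      active-uniform : ∀ {y q q′} → Active y q → Unmarked s q′ → owner q ≡ owner q′ → y q ≈ y q′ → Active y q′

    module _ {y δ y′} (r : Rise Active y δ y′) where
      open Rise r

      rise-mono : ∀ q → y q ≤ y′ q
      rise-mono = raised-mono (active? y) (<⇒≤ positive) raised

      -- If `q` overshot 1, it would reach 1 at the moment `1# - y q`, before the piece ends. By
      -- steadiness it would still be active there, but active pages are below 1.
      rise-≤1 : (∀ q → y q ≤ 1#) → ∀ q → y′ q ≤ 1#
      rise-≤1 y≤1 q with active? y q
      ... | no inactive = ≤-trans (≤-reflexive (proj₂ (raised q) inactive)) (y≤1 q)
      ... | yes active  = ≤-stable λ y′≰1 →
        let w         = raise (active? y) (1# - y q) y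
            w-raised  = raise-raised (active? y) (1# - y q) y
            1-y<δ     = rearrange-< (≰⇒> y′≰1) (trans
              (solve 2 (λ y δ → δ :+ :1 := (:1 :- y) :+ (y :+ δ)) refl (y q) δ)
              (+-congˡ (sym (proj₁ (raised q) active))))
            w-active  = Equivalence.from (steady _ w (x≤y⇒0≤y-x (y≤1 q)) 1-y<δ w-raised q) active
        in <⇒≱ (eligible-<1 (eligible w-active)) (≤-reflexive (sym (trans (proj₁ (w-raised q) active)
             (solve 1 (λ y → y :+ (:1 :- y) := :1) refl (y q)))))

      rise-uniform : Uniform s y → Uniform s y′
      rise-uniform uniform {q} {q′} Uq Uq′ eq with active? y q | active? y q′
      ... | yes A | yes A′ = trans (proj₁ (raised q) A) (trans (+-congʳ (uniform Uq Uq′ eq)) (sym (proj₁ (raised q′) A′)))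
      ... | no ¬A | no ¬A′ = trans (proj₂ (raised q) ¬A) (trans (uniform Uq Uq′ eq) (sym (proj₂ (raised q′) ¬A′)))
      ... | yes A | no ¬A′ = contradiction (active-uniform A Uq′ eq (uniform Uq Uq′ eq)) ¬A′
      ... | no ¬A | yes A′ = contradiction (active-uniform A′ Uq (≡.sym eq) (uniform Uq′ Uq (≡.sym eq))) ¬A

    record Risen (y₁ y : Alloc) : Set (a ⊔ ℓ₁ ⊔ ℓ₂) where
      field
        grows   : ∀ q → y₁ q ≤ y q
        at-most : ∀ q → y q ≤ 1#
        uniform : Uniform s y
        fixed   : ∀ q → ¬ Eligible y₁ q → y q ≈ y₁ q

    risen-start : ∀ {y} → (∀ q → y q ≤ 1#) → Uniform s y → Risen y y
    risen-start y≤1 uniform = record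
      { grows = λ _ → ≤-refl ; at-most = y≤1 ; uniform = uniform ; fixed = λ _ _ → refl }

    risen-step : ∀ {y₁ y δ y′} → Rise Active y δ y′ → Risen y₁ y → Risen y₁ y′
    risen-step {y₁} {y} r R = record
      { grows   = λ q → ≤-trans (grows q) (rise-mono r q)
      ; at-most = rise-≤1 r at-most
      ; uniform = rise-uniform r uniform
      ; fixed   = λ q ineligible → trans
          (proj₂ (Rise.raised r q) λ active → ineligible (eligible-anti grows (eligible active)))
          (fixed q ineligible)
      }
      where open Risen R

  abstract
    ownUnmarked? : ∀ s i y q → Dec (OwnUnmarked s i y q)
    ownUnmarked? s i y q = Unmarked? s q ×-dec owner q Fin.≟ i ×-dec (y q <? 1#)

    Available? : ∀ s y q → Dec (Available s y q)
    Available? s y q = Unmarked? s q ×-dec (y q <? 1#) ×-dec NonTight? y (owner q)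

    lowestAvailable? : ∀ s y q → Dec (LowestAvailable s y q)
    lowestAvailable? s y q = Available? s y q ×-dec Fin.all? λ q′ → Available? s y q′ →-dec (y q ≤? y q′)

  OwnUnmarked-rule : ∀ s i → FlowRule s (OwnUnmarked s i)
  OwnUnmarked-rule s i = record
    { active?           = ownUnmarked? s i
    ; Eligible          = OwnUnmarked s i
    ; eligible          = id
    ; eligible-anti     = λ y≤z (U , own , z<1) → U , own , <-below (y≤z _) z<1
    ; eligible-<1       = proj₂ ∘ proj₂
    ; active-uniform    = λ (U , own , y<1) U′ eq y≈ → U′ , ≡.trans (≡.sym eq) own , <-below (≤-reflexive (sym y≈)) y<1
    }

  available-anti : ∀ {s y z q} → (∀ q → y q ≤ z q) → Available s z q → Available s y q
  available-anti y≤z (U , z<1 , nonTight) = U , <-below (y≤z _) z<1 , nonTight-anti y≤z nonTight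

  LowestAvailable-rule : ∀ s → FlowRule s (LowestAvailable s)
  LowestAvailable-rule s = record
    { active?           = lowestAvailable? s
    ; Eligible          = Available s
    ; eligible          = proj₁
    ; eligible-anti     = available-anti {s}
    ; eligible-<1       = proj₁ ∘ proj₂
    ; active-uniform    = λ { {y} ((U , y<1 , nonTight) , lowest) U′ eq y≈ →
        (U′ , <-below (≤-reflexive (sym y≈)) y<1 , ≡.subst (NonTight y) eq nonTight)
        , λ q av → ≤-trans (≤-reflexive (sym y≈)) (lowest q av) }
    }

  module SharedFlow (s : State) (F : Agent → Bool) (i : Agent) where
    open FlowRule (LowestAvailable-rule s)

    -- A non-tight agent sits on the common water level, which no unmarked page with `F` false
    -- exceeds. An agent that became tight dropped out and may have been left below it.
    TopLevelOf : Alloc → Agent → Set _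
    TopLevelOf y j = ∀ {q q′} → Unmarked s q → Unmarked s q′ → F (owner q) ≡ false → F j ≡ false →
      owner q′ ≡ j → NonTight y j → y q ≤ y q′

    -- While i has not caught up with the other agents, it is i's own pages that make
    -- room for the request; should the flow stop before, i ends up tight.
    record Levels (y₁ y : Alloc) : Set (a ⊔ ℓ₁ ⊔ ℓ₂) where
      field
        risen    : Risen y₁ y
        reserved : ∀ j → fromℕ (reserve j) ≤ held y j
        others   : ∀ {j} → j ≢ i → TopLevelOf y j
        own      : held y i + sum y ≈ fromℕ (reserve i) + target ⊎ TopLevelOf y i

    module _ {y δ y′} (y≤1 : ∀ q → y q ≤ 1#) (r : Rise (LowestAvailable s) y δ y′) where
      open Rise r

      -- The only critical case is an active `q` passing an inactive `q′`. At the moment when both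
      -- are level, `q` is still lowest by steadiness, so `q′` is lowest as well and would have to
      -- be active.
      rise-order : ∀ {q q′} → Unmarked s q′ → NonTight y′ (owner q′) → y q ≤ y q′ → y′ q ≤ y′ q′
      rise-order {q} {q′} U′ nonTight′ y≤ with active? y q | active? y q′
      ... | no ¬A | _      = ≤-trans (≤-reflexive (proj₂ (raised q) ¬A)) (≤-trans y≤ (rise-mono r q′))
      ... | yes A | yes A′ = ≤-trans (≤-reflexive (proj₁ (raised q) A))
                               (≤-trans (y≤ ⊕ ≤-refl) (≤-reflexive (sym (proj₁ (raised q′) A′))))
      ... | yes A | no ¬A′ = ≤-trans (≤-stable not-past) (rise-mono r q′)
        where
        not-past : ¬ ¬ y′ q ≤ y q′
        not-past y′≰ with y q′ <? 1#
        ... | no y≮1  = y′≰ (≤-trans (rise-≤1 r y≤1 q) (≮⇒≥ y≮1))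
        ... | yes y<1 = ¬A′ (Equivalence.to (steady ε w 0≤ε ε<δ w-raised q′) lowest′)
          where
          ε = y q′ - y q
          0≤ε : 0# ≤ ε
          0≤ε = x≤y⇒0≤y-x y≤
          ε<δ : ε < δ
          ε<δ = rearrange-< (≰⇒> y′≰) (trans
            (solve 3 (λ y y′ δ → δ :+ y′ := (y′ :- y) :+ (y :+ δ)) refl (y q) (y q′) δ)
            (+-congˡ (sym (proj₁ (raised q) A))))
          w = raise (active? y) ε y
          w-raised = raise-raised (active? y) ε y
          w-active : LowestAvailable s w q
          w-active = Equivalence.from (steady ε w 0≤ε ε<δ w-raised q) A
          w-level : w q ≈ w q′
          w-level = trans (proj₁ (w-raised q) A) (trans
            (solve 2 (λ y y′ → y :+ (y′ :- y) := y′) refl (y q) (y q′)) (sym (proj₂ (w-raised q′) ¬A′)))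
          lowest′ : LowestAvailable s w q′
          lowest′ = (U′ , <-below (≤-reflexive (proj₂ (w-raised q′) ¬A′)) y<1
                        , nonTight-anti (raised-mono₂ (active? y) (<⇒≤ ε<δ) w-raised raised) nonTight′)
            , λ p av → ≤-trans (≤-reflexive (sym w-level)) (proj₂ w-active p av)

      -- An overshoot is refuted as in `rise-≤1`: the slack of `j` divided by its rate is a moment
      -- inside the piece at which `j` is exactly tight, although one of its pages is still active.
      rise-reserved : (∀ j → fromℕ (reserve j) ≤ held y j) → ∀ j → fromℕ (reserve j) ≤ held y′ j
      rise-reserved reserved j with Fin.any? (λ q → active? y q ×-dec owner q Fin.≟ j)
      ... | no none = ≤-trans (reserved j) (≤-reflexive (held-cong {y} {y′} λ q eq → sym (proj₂ (raised q) λ A → none (q , A , eq))))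
      ... | yes (q , A , ≡.refl) = ≤-stable λ k≰held →
        let n         = rate (active? y) j
            0<n       = rate-positive (active? y) A
            n≉0       = proj₂ 0<n ∘ sym
            slack     = held y j - fromℕ (reserve j)
            ε         = n ⁻¹ * slack
            nε        = trans (sym (*-assoc _ _ _)) (trans (*-congʳ (⁻¹-inverseʳ n≉0)) (*-identityˡ slack))
            0≤ε       = *-nonNegative (0≤⁻¹ 0<n) (x≤y⇒0≤y-x (reserved j))
            slack<nδ  = rearrange-< (≰⇒> k≰held) (trans
              (solve 3 (λ nδ h k → nδ :+ h := ((h :+ nδ) :- k) :+ k) refl (n * δ) (held y′ j) (fromℕ (reserve j)))
              (+-congʳ (+-congʳ (held-raised (active? y) raised j))))
            ε<δ       = ≰⇒> λ δ≤ε → <⇒≱ slack<nδ (≤-trans (*-monoʳ-≤ (<⇒≤ 0<n) δ≤ε) (≤-reflexive nε))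
            w         = raise (active? y) ε y
            w-raised  = raise-raised (active? y) ε y
            w-active  = Equivalence.from (steady ε w 0≤ε ε<δ w-raised q) A
            w-held    = begin-equality
              held w j                          ≈⟨ solve 2 (λ h e → h := (h :+ e) :- e) refl (held w j) (n * ε) ⟩
              (held w j + n * ε) - n * ε        ≈⟨ +-cong (held-raised (active? y) w-raised j) (-‿cong nε) ⟩
              held y j - slack                  ≈⟨ solve 2 (λ h k → h :- (h :- k) := k) refl (held y j) (fromℕ (reserve j)) ⟩
              fromℕ (reserve j)                 ∎
        in proj₂ (proj₂ (proj₂ (proj₁ w-active))) (sym w-held)

      -- If only pages of `i` rise, `held-conserved` keeps the equation. If a page of another agent
      -- rises, it is lowest and at the same time on the top level of the other agents, so the pages
      -- of `i` have caught up.
      rise-own : (∀ {q} → Available s y q → F (owner q) ≡ false) → (∀ {j} → j ≢ i → TopLevelOf y j) →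
        held y i + sum y ≈ fromℕ (reserve i) + target →
        held y′ i + sum y′ ≈ fromℕ (reserve i) + target ⊎ TopLevelOf y i
      rise-own available-F others pending with Fin.any? (λ q → active? y q ×-dec ¬? (owner q Fin.≟ i))
      ... | yes (q₀ , A₀@((U₀ , _ , nonTight₀) , lowest₀) , other) = inj₂ λ { {q} {q′} U U′ Fq Fi ≡.refl nonTight →
          ≤-trans (others other U U₀ Fq (available-F (proj₁ A₀)) ≡.refl nonTight₀) (q₀-below U′ nonTight) }
        where
        q₀-below : ∀ {q′} → Unmarked s q′ → NonTight y (owner q′) → y q₀ ≤ y q′
        q₀-below {q′} U′ nonTight with y q′ <? 1#
        ... | yes y<1 = lowest₀ q′ (U′ , y<1 , nonTight)
        ... | no y≮1  = ≤-trans (y≤1 q₀) (≮⇒≥ y≮1)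
      ... | no none = inj₁ (trans (sym (held-conserved λ q neq → proj₂ (raised q) λ A → none (q , A , neq))) pending)

    levels-step : ∀ {y₁ y δ y′} → (∀ {q} → Available s y₁ q → F (owner q) ≡ false) →
      Rise (LowestAvailable s) y δ y′ → Levels y₁ y → Levels y₁ y′
    levels-step {y₁} {y} {δ} {y′} available-F r L = record
      { risen    = risen-step r risen
      ; reserved = rise-reserved at-most r reserved
      ; others   = λ neq → top-step (others neq)
      ; own      = [ (λ pending → [ inj₁ , inj₂ ∘ top-step ]′
                       (rise-own at-most r (available-F ∘ available-anti {s} grows) others pending))
                   , inj₂ ∘ top-step ]′ own
      }
      where
      open Levels L
      open Risen risen
      top-step : ∀ {j} → TopLevelOf y j → TopLevelOf y′ j
      top-step top U U′ Fq Fj ≡.refl nonTight′ =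
        rise-order at-most r U′ nonTight′ (top U U′ Fq Fj ≡.refl (nonTight-anti (rise-mono r) nonTight′))

    levels-flow : ∀ {y₁ z} → (∀ {q} → Available s y₁ q → F (owner q) ≡ false) →
      Levels y₁ y₁ → Flow (LowestAvailable s) y₁ z →
      Risen y₁ z × (∀ j → fromℕ (reserve j) ≤ held z j) × (∀ j → TopLevelOf z j) × sum z ≈ target
    levels-flow {y₁} {z} available-F start flow = risen , reserved , top , full
      where
      result = flow-induction (Levels y₁) (levels-step available-F) flow start
      full = proj₂ result
      open Levels (proj₁ result)
      top : ∀ j → TopLevelOf z j
      top j with j Fin.≟ i
      ... | no neq     = others neq
      ... | yes ≡.refl with own
      ...   | inj₂ top     = top
      ...   | inj₁ pending = λ _ _ _ _ _ nonTight → ⊥-elim (proj₂ nonTight (begin-equality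
        fromℕ (reserve i)                   ≈⟨ solve 2 (λ k t → k := (k :+ t) :- t) refl _ target ⟩
        fromℕ (reserve i) + target - target ≈⟨ +-cong (sym pending) (-‿cong (sym full)) ⟩
        held z i + sum z - sum z            ≈⟨ solve 2 (λ h s → (h :+ s) :- s := h) refl (held z i) (sum z) ⟩
        held z i                            ∎))

  -- Invariants of the algorithm

  -- F lists the agents that were isolated when the current global phase began.
  record Invariant (s : State) (F : Agent → Bool) : Set (a ⊔ ℓ₁ ⊔ ℓ₂) where
    field
      nonNegative : ∀ q → 0# ≤ y s q
      at-most-one : ∀ q → y s q ≤ 1#
      full        : sum (y s) ≈ target
      reserved    : ∀ i → fromℕ (reserve i) ≤ held (y s) i
      marked⇒0    : ∀ {q} → q ∈ marked s → y s q ≈ 0#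
      outside⇒1   : ∀ {q} → q ∉ snapshot s → q ∉ marked s → y s q ≈ 1#
      isolated⇒   : ∀ {i} → i ∈ isolated s →
                    F i ≡ true × marks s i ℕ.< reserve i × held (y s) i ≈ fromℕ (reserve i)
      released⇒   : ∀ {i} → F i ≡ true → i ∉ isolated s →
                    reserve i ℕ.≤ marks s i × (∀ q → owner q ≡ i → q ∉ marked s → y s q ≈ 1#)
      uniform     : Uniform s (y s)
      topLevel    : ∀ {q q′} → Unmarked s q → Unmarked s q′ → F (owner q) ≡ false → F (owner q′) ≡ false →
                    NonTight (y s) (owner q′) → y s q ≤ y s q′

  ∈∪⁅⁆ : ∀ {n} {S : Subset n} {p} → p ∈ S ∪ ⁅ p ⁆
  ∈∪⁅⁆ = x∈p∪q⁺ (inj₂ (x∈⁅x⁆ _))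

  ∉∪⁅⁆ : ∀ {n} {S : Subset n} {p q} → q ∉ S ∪ ⁅ p ⁆ → q ∉ S × q ≢ p
  ∉∪⁅⁆ q∉ = (λ q∈S → q∉ (x∈p∪q⁺ (inj₁ q∈S))) , λ { ≡.refl → q∉ ∈∪⁅⁆ }

  ∉-remove : ∀ {n} (S : Subset n) x → x ∉ S Subset.- x
  ∉-remove (_ ∷ S) zero    ()
  ∉-remove (_ ∷ S) (suc x) (there x∈) = ∉-remove S x x∈

  module _ {n} {S : Subset n} {i : Fin n} {A : Set} where

    ∈-removeIf : (A? : Dec A) → ∀ {j} → j ∈ (if does A? then S Subset.- i else S) → j ∈ S × (j ≡ i → ¬ A)
    ∈-removeIf (no ¬A) j∈ = j∈ , λ _ → ¬A
    ∈-removeIf (yes _) j∈ = p─q⊆p _ _ j∈ , λ { ≡.refl → contradiction j∈ (∉-remove S i) }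

    ∉-removeIf : (A? : Dec A) → ∀ {j} → j ∈ S → j ∉ (if does A? then S Subset.- i else S) → j ≡ i × A
    ∉-removeIf (no ¬A) j∈ j∉ = contradiction j∈ j∉
    ∉-removeIf (yes A) {j} j∈ j∉ with j Fin.≟ i
    ... | yes eq = eq , A
    ... | no neq = contradiction (x∈p∧x≢y⇒x∈p-y j∈ neq) j∉

  unmark-mark : ∀ {s p q} → Unmarked (mark p s) q → Unmarked s q × q ≢ p
  unmark-mark (q∈S , q∉M′) = (q∈S , proj₁ (∉∪⁅⁆ q∉M′)) , proj₂ (∉∪⁅⁆ q∉M′)

  marks-mono : ∀ s p i → marks s i ℕ.≤ marks (mark p s) i
  marks-mono s p i with owner p Fin.≟ i | p ∈? marked s
  ... | no neq     | _       = ℕ.≤-reflexive (≡.sym (count-other (marked s) neq))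
  ... | yes ≡.refl | no p∉M  = ℕ.≤-trans (ℕ.n≤1+n _) (ℕ.≤-reflexive (≡.sym (count-new (marked s) p∉M)))
  ... | yes ≡.refl | yes p∈M = ℕ.≤-reflexive (≡.cong (λ M → count M i) (≡.sym (∪⁅⁆-absorb p∈M)))

  module AfterMark {s F} (inv : Invariant s F) (p : Page) where
    open Invariant inv

    private
      i = owner p
      s′ = mark p s

    isolated-mark : ∀ {j} → j ∈ isolated s′ → j ∈ isolated s × (j ≡ i → marks s′ j ≢ reserve j)
    isolated-mark j∈ = let j∈S , neq = ∈-removeIf (marks s′ i ℕ.≟ reserve i) j∈ in j∈S , λ { ≡.refl → neq ≡.refl }

    released-mark : ∀ {j} → j ∈ isolated s → j ∉ isolated s′ → j ≡ i × marks s′ j ≡ reserve j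
    released-mark j∈ j∉ with ∉-removeIf (marks s′ i ℕ.≟ reserve i) j∈ j∉
    ... | ≡.refl , eq = ≡.refl , eq

    -- The part shared by hits and both kinds of misses; `z` is the allocation after the request.
    -- The exact holding is required of agents isolated before the request, which includes the one
    -- that the new mark releases.
    invariant-mark : ∀ {z} →
      (∀ q → z q ≤ 1#) →
      sum z ≈ target →
      (∀ j → fromℕ (reserve j) ≤ held z j) →
      (∀ {q} → q ∈ marked s′ → z q ≈ 0#) →
      (∀ q → q ∉ marked s′ → y s q ≤ z q) →
      (∀ {j} → j ∈ isolated s → held z j ≈ fromℕ (reserve j)) →
      Uniform s′ z →
      (∀ {q q′} → Unmarked s′ q → Unmarked s′ q′ → F (owner q) ≡ false → F (owner q′) ≡ false →
        NonTight z (owner q′) → z q ≤ z q′) →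
      Invariant (record s′ { y = z }) F
    invariant-mark {z} z≤1 full′ reserved′ marked⇒0′ grows isolated-held uniform′ topLevel′ = record
      { nonNegative = nonneg
      ; at-most-one = z≤1
      ; full        = full′
      ; reserved    = reserved′
      ; marked⇒0    = marked⇒0′
      ; outside⇒1   = λ q∉S q∉M′ → stays-1 q∉M′ (outside⇒1 q∉S (proj₁ (∉∪⁅⁆ q∉M′)))
      ; isolated⇒   = isolated⇒′
      ; released⇒   = released⇒′
      ; uniform     = uniform′
      ; topLevel    = topLevel′
      }
      where
      nonneg : ∀ q → 0# ≤ z q
      nonneg q with q ∈? marked s′
      ... | yes q∈M′ = ≤-reflexive (sym (marked⇒0′ q∈M′))
      ... | no  q∉M′ = ≤-trans (nonNegative q) (grows q q∉M′)
      stays-1 : ∀ {q} → q ∉ marked s′ → y s q ≈ 1# → z q ≈ 1#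
      stays-1 {q} q∉M′ y≈1 = antisym (z≤1 q) (≤-trans (≤-reflexive (sym y≈1)) (grows q q∉M′))
      isolated⇒′ : ∀ {j} → j ∈ isolated s′ → F j ≡ true × marks s′ j ℕ.< reserve j × held z j ≈ fromℕ (reserve j)
      isolated⇒′ {j} j∈′ = proj₁ old , below , isolated-held j∈
        where
        j∈  = proj₁ (isolated-mark j∈′)
        old = isolated⇒ j∈
        below : marks s′ j ℕ.< reserve j
        below with i Fin.≟ j | p ∈? marked s
        ... | no neq     | _       = ≡.subst (ℕ._< reserve j) (≡.sym (count-other (marked s) neq)) (proj₁ (proj₂ old))
        ... | yes ≡.refl | yes p∈M = ≡.subst (ℕ._< reserve j) (≡.cong (λ M → count M j) (≡.sym (∪⁅⁆-absorb p∈M))) (proj₁ (proj₂ old))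
        -- The new count is at most the reserve; equality would have released the agent.
        ... | yes ≡.refl | no p∉M  = ℕ.≤∧≢⇒< (≡.subst (ℕ._≤ reserve j) (≡.sym (count-new (marked s) p∉M)) (proj₁ (proj₂ old)))
                                       (proj₂ (isolated-mark j∈′) ≡.refl)
      released⇒′ : ∀ {j} → F j ≡ true → j ∉ isolated s′ →
        reserve j ℕ.≤ marks s′ j × (∀ q → owner q ≡ j → q ∉ marked s′ → z q ≈ 1#)
      released⇒′ {j} Fj j∉′ with j ∈? isolated s
      ... | no j∉ = ℕ.≤-trans (proj₁ (released⇒ Fj j∉)) (marks-mono s p j)
                  , λ q eq q∉M′ → stays-1 q∉M′ (proj₂ (released⇒ Fj j∉) q eq (proj₁ (∉∪⁅⁆ q∉M′)))
      -- At its release the agent holds exactly its reserve and has just as many marked pages, so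
      -- its unmarked pages are entirely out of the cache.
      ... | yes j∈ = ℕ.≤-reflexive (≡.sym count≡) , Marks.count-tight z≤1 marked⇒0′
                       (≤-reflexive (trans (isolated-held j∈) (reflexive (≡.cong fromℕ (≡.sym count≡)))))
        where count≡ = proj₂ (released-mark j∈ j∉′)

    invariant-hit : y s p ≈ 0# → Invariant s′ F
    invariant-hit y≈0 = invariant-mark at-most-one full reserved
      (λ q∈ → [ marked⇒0 , (λ q∈⁅p⁆ → trans (reflexive (≡.cong (y s) (x∈⁅y⁆⇒x≡y p q∈⁅p⁆))) y≈0) ]′ (x∈p∪q⁻ (marked s) ⁅ p ⁆ q∈))
      (λ _ _ → ≤-refl) (proj₂ ∘ proj₂ ∘ isolated⇒)
      (λ U U′ → uniform (proj₁ (unmark-mark {s} U)) (proj₁ (unmark-mark {s} U′)))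
      (λ U U′ → topLevel (proj₁ (unmark-mark {s} U)) (proj₁ (unmark-mark {s} U′)))

  -- Misses: the invariant across a fetch and the evictions that follow.

  module AfterFetch {s F} (inv : Invariant s F) (p : Page) (miss : ¬ y s p ≈ 0#) where
    open Invariant inv
    open AfterMark inv p

    i  = owner p
    s₁ = fetch p s
    y₁ = y s₁

    unmarked-p : p ∉ marked s
    unmarked-p = miss ∘ marked⇒0

    y₁-p : y₁ p ≡ 0#
    y₁-p = updateAt-updates p (y s)

    y₁-other : ∀ {q} → q ≢ p → y₁ q ≡ y s q
    y₁-other {q} q≢p = updateAt-minimal q p (y s) q≢p

    y₁≤y : ∀ q → y₁ q ≤ y s q
    y₁≤y q with q Fin.≟ p
    ... | yes ≡.refl = ≤-trans (≤-reflexive (reflexive y₁-p)) (nonNegative q)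
    ... | no q≢p     = ≤-reflexive (reflexive (y₁-other q≢p))

    0≤y₁ : ∀ q → 0# ≤ y₁ q
    0≤y₁ q with q Fin.≟ p
    ... | yes ≡.refl = ≤-reflexive (reflexive (≡.sym y₁-p))
    ... | no q≢p     = ≤-trans (nonNegative q) (≤-reflexive (reflexive (≡.sym (y₁-other q≢p))))

    y₁≤1 : ∀ q → y₁ q ≤ 1#
    y₁≤1 q = ≤-trans (y₁≤y q) (at-most-one q)

    unmarked₁ : ∀ {q} → Unmarked s₁ q → Unmarked s q × y₁ q ≡ y s q
    unmarked₁ U = let U′ , q≢p = unmark-mark {s} U in U′ , y₁-other q≢p

    held₁-other : ∀ {j} → j ≢ i → held y₁ j ≈ held (y s) j
    held₁-other neq = held-cong λ q eq → reflexive (y₁-other λ { ≡.refl → neq (≡.sym eq) })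

    held₁-own : held (y s) i + sum (y s) ≈ held y₁ i + sum y₁
    held₁-own = held-conserved λ q neq → reflexive (y₁-other λ { ≡.refl → neq ≡.refl })

    sum₁ : sum (y s) ≈ sum y₁ + y s p
    sum₁ = trans (sym (+-identityʳ _)) (trans (+-congˡ (reflexive (≡.sym y₁-p)))
      (sum-update p λ q q≢p → reflexive (≡.sym (y₁-other q≢p))))

    sum₁≤target : sum y₁ ≤ target
    sum₁≤target = ≤-trans (sum-mono y₁≤y) (≤-reflexive full)

    uniform₁ : Uniform s₁ y₁
    uniform₁ U U′ eq = let V , e = unmarked₁ U ; V′ , e′ = unmarked₁ U′ in
      trans (reflexive e) (trans (uniform V V′ eq) (reflexive (≡.sym e′)))

    -- What the rest of the analysis uses of an eviction process, whichever kind it is; `Eligible`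
    -- refers to the moment right after the fetch.
    record Refilling (Eligible : Page → Set (ℓ₁ ⊔ ℓ₂)) (z : Alloc) : Set (a ⊔ ℓ₁ ⊔ ℓ₂) where
      field
        grows    : ∀ q → y₁ q ≤ z q
        at-most  : ∀ q → z q ≤ 1#
        fixed    : ∀ q → ¬ Eligible q → z q ≈ y₁ q
        eligible : ∀ {q} → Eligible q → Unmarked s₁ q

      nonNegative′ : ∀ q → 0# ≤ z q
      nonNegative′ q = ≤-trans (0≤y₁ q) (grows q)

      marked⇒0′ : ∀ {q} → q ∈ marked s₁ → z q ≈ 0#
      marked⇒0′ {q} q∈ = trans (fixed q λ E → proj₂ (eligible E) q∈)
        ([ (λ q∈M → trans (reflexive (y₁-other λ { ≡.refl → unmarked-p q∈M })) (marked⇒0 q∈M))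
         , (λ q∈⁅p⁆ → reflexive (≡.trans (≡.cong y₁ (x∈⁅y⁆⇒x≡y p q∈⁅p⁆)) y₁-p)) ]′ (x∈p∪q⁻ (marked s) ⁅ p ⁆ q∈))

      grows′ : ∀ q → q ∉ marked s₁ → y s q ≤ z q
      grows′ q q∉ = ≤-trans (≤-reflexive (reflexive (≡.sym (y₁-other (proj₂ (∉∪⁅⁆ q∉)))))) (grows q)

      outside≥1 : ∀ {q} → q ∉ snapshot s → q ∉ marked s₁ → 1# ≤ z q
      outside≥1 q∉S q∉M′ = ≤-trans (≤-reflexive (sym (outside⇒1 q∉S (proj₁ (∉∪⁅⁆ q∉M′))))) (grows′ _ q∉M′)

    own-refilling : ∀ {z} → FlowRule.Risen (OwnUnmarked-rule s₁ i) y₁ z → Refilling (OwnUnmarked s₁ i y₁) z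
    own-refilling R = record { grows = R.grows ; at-most = R.at-most ; fixed = R.fixed ; eligible = proj₁ }
      where module R = FlowRule.Risen R

    own-fixed : ∀ {z} → FlowRule.Risen (OwnUnmarked-rule s₁ i) y₁ z → ∀ q → owner q ≢ i → z q ≈ y s q
    own-fixed R q neq = trans (FlowRule.Risen.fixed R q (neq ∘ proj₁ ∘ proj₂))
      (reflexive (y₁-other λ { ≡.refl → neq ≡.refl }))

    shared-refilling : ∀ {z} → FlowRule.Risen (LowestAvailable-rule s₁) y₁ z → Refilling (Available s₁ y₁) z
    shared-refilling R = record { grows = R.grows ; at-most = R.at-most ; fixed = R.fixed ; eligible = proj₁ }
      where module R = FlowRule.Risen R

    module Isolated (i∈ : i ∈ isolated s) {z} (flow : Flow (OwnUnmarked s₁ i) y₁ z) where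
      open FlowRule (OwnUnmarked-rule s₁ i) using (Risen; risen-start; risen-step)

      private
        result = flow-induction (Risen y₁) risen-step flow (risen-start y₁≤1 uniform₁)
        module R = Risen (proj₁ result)

      filled : sum z ≈ target
      filled = proj₂ result

      refilling : Refilling (OwnUnmarked s₁ i y₁) z
      refilling = own-refilling (proj₁ result)

      open Refilling refilling using (marked⇒0′; grows′)

      fixed′ : ∀ q → owner q ≢ i → z q ≈ y s q
      fixed′ = own-fixed (proj₁ result)

      -- Only pages of `i` move and the total returns to its old value: an isolated agent pays for
      -- the request out of its own holding.
      held-same : ∀ j → held z j ≈ held (y s) j
      held-same j with j Fin.≟ i
      ... | no neq     = held-cong λ q eq → fixed′ q (neq ∘ ≡.trans (≡.sym eq))
      ... | yes ≡.refl = begin-equality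
        held z i                              ≈⟨ solve 2 (λ h s → h := (h :+ s) :- s) refl (held z i) (sum z) ⟩
        held z i + sum z - sum z              ≈⟨ +-cong (sym (held-conserved fixed′)) (-‿cong (trans (proj₂ result) (sym full))) ⟩
        held (y s) i + sum (y s) - sum (y s)  ≈⟨ solve 2 (λ h s → (h :+ s) :- s := h) refl (held (y s) i) (sum (y s)) ⟩
        held (y s) i                          ∎

      invariant-isolated : Invariant (record s₁ { y = z }) F
      invariant-isolated = invariant-mark R.at-most (proj₂ result)
        (λ j → ≤-trans (reserved j) (≤-reflexive (sym (held-same j))))
        marked⇒0′ grows′
        (λ {j} j∈ → trans (held-same j) (proj₂ (proj₂ (isolated⇒ j∈))))
        R.uniform
        λ {q} {q′} U U′ Fq Fq′ nonTight → ≤-trans (≤-reflexive (fixed′ q (not-own Fq)))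
          (≤-trans (topLevel (proj₁ (unmarked₁ U)) (proj₁ (unmarked₁ U′)) Fq Fq′
                     (nonTight-cong {z} {y s} (held-same (owner q′)) nonTight))
                   (≤-reflexive (sym (fixed′ q′ (not-own Fq′)))))
        where
        not-own : ∀ {q} → F (owner q) ≡ false → owner q ≢ i
        not-own Fq eq = case ≡.trans (≡.sym Fq) (≡.trans (≡.cong F eq) (proj₁ (isolated⇒ i∈))) of λ ()

    module Shared (i∉ : i ∉ isolated s) where

      -- An agent with `F` true is of no use for shared evictions. While isolated it is tight, and
      -- the fetch does not change that because `i` is not isolated; once released it has no
      -- unmarked page below level 1.
      available-F : ∀ {q} → Available s₁ y₁ q → F (owner q) ≡ false
      available-F {q} (U , y<1 , nonTight) with F (owner q) in Fq
      ... | false = ≡.refl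
      ... | true with owner q ∈? isolated s
      ...   | yes j∈ = ⊥-elim (proj₂ nonTight (sym (trans
                         (held₁-other λ eq → i∉ (≡.subst (_∈ isolated s) eq j∈)) (proj₂ (proj₂ (isolated⇒ j∈))))))
      ...   | no j∉  = ⊥-elim (proj₂ y<1 (trans (reflexive (proj₂ (unmarked₁ U)))
                         (proj₂ (released⇒ Fq j∉) q ≡.refl (proj₂ (proj₁ (unmarked₁ U))))))

      open SharedFlow s₁ F i
      open FlowRule (LowestAvailable-rule s₁) using (Risen; risen-start)

      reserved₁ : ∀ j → fromℕ (reserve j) ≤ held y₁ j
      reserved₁ j = ≤-trans (reserved j) (held-mono {y₁} {y s} λ q _ → y₁≤y q)

      top₁ : ∀ {j} → (NonTight y₁ j → NonTight (y s) j) → TopLevelOf y₁ j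
      top₁ nonTight⇒ U U′ Fq Fj ≡.refl nonTight = let V , e = unmarked₁ U ; V′ , e′ = unmarked₁ U′ in
        ≤-trans (≤-reflexive (reflexive e))
          (≤-trans (topLevel V V′ Fq Fj (nonTight⇒ nonTight)) (≤-reflexive (reflexive (≡.sym e′))))

      levels₁ : Levels y₁ y₁
      levels₁ = record
        { risen    = risen-start y₁≤1 uniform₁
        ; reserved = reserved₁
        ; others   = λ neq → top₁ (nonTight-cong {y₁} {y s} (held₁-other neq))
        ; own      = own
        }
        where
        own : held y₁ i + sum y₁ ≈ fromℕ (reserve i) + target ⊎ TopLevelOf y₁ i
        -- A tight `i` may have unmarked pages below the common level, and the fetch makes it
        -- non-tight. It therefore starts with the conservation equation instead of the top level.
        own with NonTight? (y s) i
        ... | yes nonTight = inj₂ (top₁ (const nonTight))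
        ... | no tight     = inj₁ (trans (sym held₁-own) (+-cong (antisym (≮⇒≥ tight) (reserved i)) full))

      module _ {z} (flow : Flow (LowestAvailable s₁) y₁ z) where

        private
          result    = levels-flow available-F levels₁ flow
          reserved′ = proj₁ (proj₂ result)
          top       = proj₁ (proj₂ (proj₂ result))
          module R  = Risen (proj₁ result)

        filled : sum z ≈ target
        filled = proj₂ (proj₂ (proj₂ result))

        refilling : Refilling (Available s₁ y₁) z
        refilling = shared-refilling (proj₁ result)

        open Refilling refilling using (marked⇒0′; grows′)

        invariant-shared : Invariant (record s₁ { y = z }) F
        invariant-shared = invariant-mark R.at-most filled reserved′ marked⇒0′ grows′
          (λ {j} j∈ → trans (held-cong λ q eq → fixed-isolated j∈ q eq) (proj₂ (proj₂ (isolated⇒ j∈))))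
          R.uniform
          λ {q} {q′} U U′ Fq Fq′ → top (owner q′) U U′ Fq Fq′ ≡.refl
          where
          fixed-isolated : ∀ {j} → j ∈ isolated s → ∀ q → owner q ≡ j → z q ≈ y s q
          fixed-isolated j∈ q ≡.refl = trans
            (R.fixed q λ av → case ≡.trans (≡.sym (available-F av)) (proj₁ (isolated⇒ j∈)) of λ ())
            (reflexive (y₁-other λ { ≡.refl → i∉ j∈ }))

  -- The end of a phase

  sum-held≈k : ∀ {y} → sum y ≈ target → sum (λ i → held y i) ≈ fromℕ k
  sum-held≈k {y} full = begin-equality
    h                ≈⟨ solve 2 (λ h s → h := (h :+ s) :- s) refl h (sum y) ⟩
    h + sum y - sum y          ≈⟨ +-cong (sum-held-excess y) (-‿cong full) ⟩
    fromℕ k + target - target  ≈⟨ solve 2 (λ k t → (k :+ t) :- t := k) refl (fromℕ k) target ⟩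
    fromℕ k                    ∎
    where h = sum (λ i → held y i)

  fromℕ-sumℕ : ∀ {n} (f : Fin n → ℕ) → fromℕ (sumℕ f) ≈ sum (fromℕ ∘ f)
  fromℕ-sumℕ {zero}  f = refl
  fromℕ-sumℕ {suc n} f = trans (fromℕ-+ (f zero) _) (+-congˡ (fromℕ-sumℕ (f ∘ suc)))

  count-positive : ∀ M i → 0 ℕ.< count M i → ∃[ q ] q ∈ M × owner q ≡ i
  count-positive M i 0<count with nonempty? (M ∩ pagesOf i)
  ... | yes (q , q∈) = q , proj₁ (x∈p∩q⁻ _ _ q∈) , pagesOf∋ (proj₂ (x∈p∩q⁻ M (pagesOf i) q∈))
  ... | no empty     = contradiction (≡.trans (≡.cong ∣_∣ (Empty-unique empty)) (∣⊥∣≡0 ∣𝒫∣)) (ℕ.>⇒≢ 0<count)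

  module Exhausted {s F} (inv : Invariant s F) {i} (stuck : ¬ CanEvict s i) where
    open Invariant inv
    open Marks {marked s} at-most-one marked⇒0

    spent : ∀ q → (owner q ≡ i ⊎ NonTight (y s) (owner q)) → q ∉ marked s → 1# ≤ y s q
    spent q free q∉M with q ∈? snapshot s
    ... | no q∉S  = ≤-reflexive (sym (outside⇒1 q∉S q∉M))
    ... | yes q∈S = ≮⇒≥ λ y<1 → stuck (q , (q∈S , q∉M) , y<1 , free)

    -- A tight agent holds its reserve. A non-tight one has nothing left to evict, so all it holds
    -- is marked. This is all that the later analysis of a phase's end uses about the holdings.
    held≤max : ∀ j → held (y s) j ≤ fromℕ (marks s j ℕ.⊔ reserve j)
    held≤max j with NonTight? (y s) j
    ... | no tight      = ≤-trans (≮⇒≥ tight) (fromℕ-mono (ℕ.m≤n⊔m (marks s j) _))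
    ... | yes nonTight  = ≤-trans
      (held≤count (λ { q ≡.refl → spent q (inj₂ nonTight) }) nonNegative)
      (fromℕ-mono (ℕ.m≤m⊔n (marks s j) _))

    -- The requesting agent counts as non-tight in `CanEvict`, so everything it holds is marked, and
    -- it holds at least its reserve. Hence it restarts and is not isolated.
    own-marked : reserve i ℕ.≤ marks s i
    own-marked = fromℕ-cancel-≤ (≤-trans (reserved i) (held≤count (λ q eq → spent q (inj₁ eq)) nonNegative))

  module EndPhase {s F} (inv : Invariant s F)
    (held≤max : ∀ j → held (y s) j ≤ fromℕ (marks s j ℕ.⊔ reserve j)) where

    open Invariant inv
    open Marks {marked s} at-most-one marked⇒0

    s′ : State
    s′ = endPhase s

    stays : ∀ j → Dec (marks s j ℕ.< reserve j)
    stays j = marks s j ℕ.<? reserve j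

    F′ : Agent → Bool
    F′ j = does (stays j)

    module _ {q : Page} where

      stay-marked : marks s (owner q) ℕ.< reserve (owner q) → lookup (marked s′) q ≡ lookup (marked s) q
      stay-marked lt = ≡.trans (lookup∘tabulate _ q)
        (≡.cong (λ b → if b then lookup (marked s) q else false) (dec-true (stays (owner q)) lt))

      stay-snapshot : marks s (owner q) ℕ.< reserve (owner q) → lookup (snapshot s′) q ≡ lookup (snapshot s) q
      stay-snapshot lt = ≡.trans (lookup∘tabulate _ q)
        (≡.cong (λ b → if b then lookup (snapshot s) q else (lookup (marked s) q ∧ does (y s q ≟ 0#))) (dec-true (stays (owner q)) lt))

      move-marked : reserve (owner q) ℕ.≤ marks s (owner q) → lookup (marked s′) q ≡ false
      move-marked ge = ≡.trans (lookup∘tabulate _ q)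
        (≡.cong (λ b → if b then lookup (marked s) q else false) (dec-false (stays (owner q)) (ℕ.≤⇒≯ ge)))

      move-snapshot : reserve (owner q) ℕ.≤ marks s (owner q) → lookup (snapshot s′) q ≡ lookup (marked s) q
      move-snapshot ge = ≡.trans (lookup∘tabulate _ q) (≡.trans
        (≡.cong (λ b → if b then lookup (snapshot s) q else (lookup (marked s) q ∧ does (y s q ≟ 0#))) (dec-false (stays (owner q)) (ℕ.≤⇒≯ ge)))
        integral)
        where
        integral : lookup (marked s) q ∧ does (y s q ≟ 0#) ≡ lookup (marked s) q
        integral with q ∈? marked s
        ... | yes q∈M rewrite []=⇒lookup q∈M = dec-true (y s q ≟ 0#) (marked⇒0 q∈M)
        ... | no  q∉M rewrite ∉⇒lookup q∉M   = ≡.refl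

    marks-stay : ∀ {j} → marks s j ℕ.< reserve j → marks s′ j ≡ marks s j
    marks-stay lt = count-cong (marked s′) (marked s) λ { q ≡.refl → stay-marked lt }

    ∈-via : ∀ {n} {S T : Subset n} {q} → lookup S q ≡ lookup T q → q ∈ S → q ∈ T
    ∈-via {T = T} {q} eq q∈S = lookup⇒[]= q T (≡.trans (≡.sym eq) ([]=⇒lookup q∈S))

    moved-tight : ∀ {j} → reserve j ℕ.≤ marks s j → ∀ q → owner q ≡ j → q ∉ marked s → y s q ≈ 1#
    moved-tight {j} ge = count-tight (≤-trans (held≤max j) (≤-reflexive (reflexive (≡.cong fromℕ (ℕ.m≥n⇒m⊔n≡m ge)))))

    moved-unmarked : ∀ {q} → reserve (owner q) ℕ.≤ marks s (owner q) → Unmarked s′ q → y s q ≈ 0#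
    moved-unmarked ge (q∈S′ , _) = marked⇒0 (∈-via (move-snapshot ge) q∈S′)

    stay-unmarked : ∀ {q} → marks s (owner q) ℕ.< reserve (owner q) → Unmarked s′ q → Unmarked s q
    stay-unmarked lt (q∈S′ , q∉M′) = ∈-via (stay-snapshot lt) q∈S′ , q∉M′ ∘ ∈-via (≡.sym (stay-marked lt))

    ∈-F′ : ∀ {j} → F′ j ≡ true → marks s j ℕ.< reserve j
    ∈-F′ {j} F′j = ℕ.≰⇒> λ ge → case ≡.trans (≡.sym F′j) (dec-false (stays j) (ℕ.≤⇒≯ ge)) of λ ()

    ∉-F′ : ∀ {j} → F′ j ≡ false → reserve j ℕ.≤ marks s j
    ∉-F′ {j} F′j = ℕ.≮⇒≥ λ lt → case ≡.trans (≡.sym F′j) (dec-true (stays j) lt) of λ ()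

    isolated-F′ : ∀ {j} → j ∈ isolated s′ → F′ j ≡ true
    isolated-F′ {j} j∈ = ≡.trans (≡.sym (lookup∘tabulate F′ j)) ([]=⇒lookup j∈)

    F′-isolated : ∀ {j} → F′ j ≡ true → j ∈ isolated s′
    F′-isolated {j} F′j = lookup⇒[]= j _ (≡.trans (lookup∘tabulate F′ j) F′j)

    invariant-endPhase : Invariant s′ F′
    invariant-endPhase = record
      { nonNegative = nonNegative
      ; at-most-one = at-most-one
      ; full        = full
      ; reserved    = reserved
      ; marked⇒0    = marked⇒0′
      ; outside⇒1   = outside⇒1′
      ; isolated⇒   = λ {j} j∈ → let F′j = isolated-F′ j∈ ; lt = ∈-F′ F′j in
          F′j , ≡.subst (ℕ._< reserve j) (≡.sym (marks-stay lt)) lt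
          , antisym (≤-trans (held≤max j) (≤-reflexive (reflexive (≡.cong fromℕ (ℕ.m≤n⇒m⊔n≡n (ℕ.<⇒≤ lt)))))) (reserved j)
      ; released⇒   = λ F′j j∉ → contradiction (F′-isolated F′j) j∉
      ; uniform     = uniform′
      -- Unmarked pages of restarted agents are their formerly marked pages, all at level 0.
      ; topLevel    = λ U _ F′q _ _ → ≤-trans (≤-reflexive (moved-unmarked (∉-F′ F′q) U)) (nonNegative _)
      }
      where
      marked⇒0′ : ∀ {q} → q ∈ marked s′ → y s q ≈ 0#
      marked⇒0′ {q} q∈ with ℕ.<-≤-connex (marks s (owner q)) (reserve (owner q))
      ... | inj₁ lt = marked⇒0 (∈-via (stay-marked lt) q∈)
      ... | inj₂ ge = contradiction q∈ (lookup⇒∉ (move-marked ge))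
      outside⇒1′ : ∀ {q} → q ∉ snapshot s′ → q ∉ marked s′ → y s q ≈ 1#
      outside⇒1′ {q} q∉S′ q∉M′ with ℕ.<-≤-connex (marks s (owner q)) (reserve (owner q))
      ... | inj₁ lt = outside⇒1 (q∉S′ ∘ ∈-via (≡.sym (stay-snapshot lt))) (q∉M′ ∘ ∈-via (≡.sym (stay-marked lt)))
      ... | inj₂ ge = moved-tight ge q ≡.refl (q∉S′ ∘ ∈-via (≡.sym (move-snapshot ge)))
      uniform′ : Uniform s′ (y s)
      uniform′ {q} {q′} U U′ eq with ℕ.<-≤-connex (marks s (owner q)) (reserve (owner q))
      ... | inj₁ lt = uniform (stay-unmarked lt U)
                        (stay-unmarked (≡.subst (λ j → marks s j ℕ.< reserve j) eq lt) U′) eq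
      ... | inj₂ ge = trans (moved-unmarked ge U)
                        (sym (moved-unmarked (≡.subst (λ j → reserve j ℕ.≤ marks s j) eq ge) U′))

    some-nonTight : ∃[ j ] NonTight (y s) j
    some-nonTight with Fin.any? (NonTight? (y s))
    ... | yes found = found
    ... | no all-tight = contradiction (begin
      fromℕ k                      ≈⟨ sum-held≈k full ⟨
      sum (λ j → held (y s) j)     ≤⟨ sum-mono (λ j → ≮⇒≥ λ nonTight → all-tight (j , nonTight)) ⟩
      sum (fromℕ ∘ reserve)        ≈⟨ fromℕ-sumℕ reserve ⟨
      fromℕ (sumℕ reserve)         ∎) (<⇒≱ (fromℕ-mono-< Σreserve<k))

    -- Since the reserves sum to less than `k`, some agent is non-tight. It holds more than its
    -- reserve but at most the larger of reserve and marks, so it has more marks than its reserve: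
    -- it restarts with evictable pages at level 0. A request thus ends at most one phase.
    canEvict : ∀ i → CanEvict s′ i
    canEvict i = let j , nonTight = some-nonTight
                     more         = reserve<marks nonTight
                     q , q∈M , eq = count-positive (marked s) j (ℕ.≤-<-trans ℕ.z≤n more)
                     ge           = ≡.subst (λ j → reserve j ℕ.≤ marks s j) (≡.sym eq) (ℕ.<⇒≤ more)
                 in q , (∈-via (≡.sym (move-snapshot ge)) q∈M , lookup⇒∉ (move-marked ge))
                      , <-below (≤-reflexive (marked⇒0 q∈M)) 0<1
                      , inj₂ (≡.subst (NonTight (y s)) (≡.sym eq) nonTight)
      where
      reserve<marks : ∀ {j} → NonTight (y s) j → reserve j ℕ.< marks s j
      reserve<marks {j} nonTight = ℕ.≰⇒> λ le → <⇒≱ nonTight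
        (≤-trans (held≤max j) (≤-reflexive (reflexive (≡.cong fromℕ (ℕ.m≤n⇒m⊔n≡n le)))))

  module NewPhase {s F} (inv : Invariant s F) {p} (miss : ¬ y s p ≈ 0#) (stuck : ¬ CanEvict s (owner p)) where
    open Exhausted inv stuck public
    open EndPhase inv held≤max public

    private
      p∉M = miss ∘ Invariant.marked⇒0 inv

    shared-next : owner p ∉ isolated s′
    shared-next i∈ = ℕ.<⇒≱ (∈-F′ (isolated-F′ i∈)) own-marked

    -- A missed page was unmarked, and the new snapshot of its restarting owner consists of the old
    -- marks. So the request that opens a phase is charged.
    clean-next : p ∉ marked s′ × p ∉ snapshot s′
    clean-next = lookup⇒∉ (move-marked own-marked) , p∉M ∘ ∈-via (move-snapshot own-marked)

  -- Existence of the eviction process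

  collect : ∀ {n ℓ} {P : Fin n → Set ℓ} → (∀ q → Dec (P q)) → Subset n
  collect P? = tabulate λ q → does (P? q)

  module _ {n ℓ} {P : Fin n → Set ℓ} (P? : ∀ q → Dec (P q)) where

    ∈-collect : ∀ {q} → P q → q ∈ collect P?
    ∈-collect {q} Pq = lookup⇒[]= q _ (≡.trans (lookup∘tabulate _ q) (dec-true (P? q) Pq))

    collect-∋ : ∀ {q} → q ∈ collect P? → P q
    collect-∋ {q} q∈ with P? q in eq
    ... | yes Pq = Pq
    ... | no ¬Pq = contradiction q∈ (lookup⇒∉ (≡.trans (lookup∘tabulate _ q) (≡.cong does eq)))

  argmin : ∀ {n ℓ} {P : Fin n → Set ℓ} → (∀ q → Dec (P q)) → (f : Fin n → Carrier) → ∃ P →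
    ∃[ q ] P q × (∀ r → P r → f q ≤ f r)
  argmin {suc n} {P = P} P? f found with Fin.any? (P? ∘ suc) | P? zero
  ... | no none | no ¬P₀ = contradiction found λ { (zero , P₀) → ¬P₀ P₀ ; (suc q , Pq) → none (q , Pq) }
  ... | no none | yes P₀ = zero , P₀ , λ { zero _ → ≤-refl ; (suc q) Pq → contradiction (q , Pq) none }
  ... | yes found′ | no ¬P₀ = let q , Pq , least = argmin (P? ∘ suc) (f ∘ suc) found′ in
    suc q , Pq , λ { zero P₀ → contradiction P₀ ¬P₀ ; (suc r) Pr → least r Pr }
  ... | yes found′ | yes P₀ with argmin (P? ∘ suc) (f ∘ suc) found′
  ...   | q , Pq , least with total (f zero) (f (suc q))
  ...     | inj₁ f₀≤ = zero , P₀ , λ { zero _ → ≤-refl ; (suc r) Pr → ≤-trans f₀≤ (least r Pr) }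
  ...     | inj₂ ≤f₀ = suc q , Pq , λ { zero _ → ≤f₀ ; (suc r) Pr → least r Pr }

  -- Not a phase of the marking algorithm but a stretch of the continuous process with a constant
  -- set of rising pages. The measure `μ` drops at its end, which bounds the number of stretches.
  record Phase {ℓ} (Active : Alloc → Page → Set ℓ) (μ : Alloc → ℕ) (y : Alloc) : Set (a ⊔ ℓ₁ ⊔ ℓ₂ ⊔ ℓ) where
    field
      someActive : ∃ (Active y)
      lifetime   : Carrier
      positive   : 0# < lifetime
      steady     : ∀ ε w → 0# ≤ ε → ε < lifetime → Raised (Active y) ε y w → ∀ q → Active w q ⇔ Active y q
      descends   : ∀ {y′} → Raised (Active y) lifetime y y′ → μ y′ ℕ.< μ y

  module Filling {ℓ} {s Active} (rule : FlowRule {ℓ} s Active) (y₁ : Alloc) (μ : Alloc → ℕ)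
    (next : ∀ {y} → FlowRule.Risen rule y₁ y → sum y < target → Phase Active μ y) where
    open FlowRule rule

    -- Either the stretch is lived to its end and `μ` drops, or the target is reached earlier and
    -- the flow stops there.
    fill : ∀ n {y} → μ y ℕ.≤ n → Risen y₁ y → sum y ≤ target → ∃ (Flow Active y)
    fill n {y} μ≤n R y≤target with sum y ≟ target
    ... | yes full = y , stop full
    ... | no ¬full = continue n μ≤n
      where
      open Phase (next R (y≤target , ¬full))
      N = totalRate (active? y)
      0<N = totalRate-positive (active? y) (proj₂ someActive)
      missing = target - sum y
      -- The time in which the total, growing at rate `N`, reaches the target.
      enough = N ⁻¹ * missing
      N*enough : N * enough ≈ missing
      N*enough = trans (sym (*-assoc _ _ _)) (trans (*-congʳ (⁻¹-inverseʳ (proj₂ 0<N ∘ sym))) (*-identityˡ missing))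

      rise-by : ∀ δ → 0# < δ → δ ≤ lifetime → δ ≤ enough → Rise Active y δ (raise (active? y) δ y)
      rise-by δ 0<δ δ≤life δ≤enough = record
        { positive = 0<δ
        ; raised   = raise-raised (active? y) δ y
        ; steady   = λ ε w 0≤ε ε<δ → steady ε w 0≤ε (≰⇒> λ life≤ε → <⇒≱ ε<δ (≤-trans δ≤life life≤ε))
        ; capped   = begin
            sum (raise (active? y) δ y)  ≈⟨ sum-raised (active? y) (raise-raised (active? y) δ y) ⟩
            sum y + N * δ                ≤⟨ ≤-refl ⊕ *-monoʳ-≤ (<⇒≤ 0<N) δ≤enough ⟩
            sum y + N * enough           ≈⟨ +-congˡ N*enough ⟩
            sum y + (target - sum y)     ≈⟨ solve 2 (λ s t → s :+ (t :- s) := t) refl (sum y) target ⟩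
            target                       ∎
        }

      prepend : ∀ {δ y′} → Rise Active y δ y′ → ∃ (Flow Active y′) → ∃ (Flow Active y)
      prepend r (z , flow) = let open Rise r renaming (positive to 0<δ; steady to constant) in
        z , rise _ 0<δ raised constant capped flow

      continue : ∀ n → μ y ℕ.≤ n → ∃ (Flow Active y)
      continue n μ≤n with lifetime ≤? enough
      continue zero μ≤0 | yes _ =
        contradiction (descends (raise-raised (active? y) lifetime y)) (ℕ.≤⇒≯ (ℕ.≤-trans μ≤0 ℕ.z≤n))
      continue (suc n) μ≤n | yes life≤enough = prepend r (fill n
        (ℕ.≤-pred (ℕ.≤-trans (descends (Rise.raised r)) μ≤n)) (risen-step r R) (Rise.capped r))
        where r = rise-by lifetime positive ≤-refl life≤enough
      continue n μ≤n | no life≰enough = prepend r (_ , stop (begin-equality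
          sum (raise (active? y) enough y)  ≈⟨ sum-raised (active? y) (Rise.raised r) ⟩
          sum y + N * enough                ≈⟨ +-congˡ N*enough ⟩
          sum y + (target - sum y)          ≈⟨ solve 2 (λ s t → s :+ (t :- s) := t) refl (sum y) target ⟩
          target                            ∎))
        where r = rise-by enough (*-positive (0<⁻¹ 0<N) (x<y⇒0<y-x (y≤target , ¬full))) (<⇒≤ (≰⇒> life≰enough)) ≤-refl

  module _ {s F} (inv : Invariant s F) (p : Page) (miss : ¬ y s p ≈ 0#) where
    open Invariant inv
    open AfterFetch inv p miss

    module OwnPhase (i∈ : i ∈ isolated s) where
      open FlowRule (OwnUnmarked-rule s₁ i)

      count₁≤reserve : count (marked s₁) i ℕ.≤ reserve i
      count₁≤reserve = ≡.subst (ℕ._≤ reserve i) (≡.sym (count-new (marked s) unmarked-p)) (proj₁ (proj₂ (isolated⇒ i∈)))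

      module _ {y} (R : Risen y₁ y) (y<target : sum y < target) where
        open Risen R
        open Refilling (own-refilling R) using (marked⇒0′; nonNegative′; outside≥1)
        open Marks {marked s₁} at-most marked⇒0′

        -- Otherwise `i` holds only marked pages. Even with the new one these are at most its
        -- reserve, while its holding plus the total is still reserve plus target; so the total
        -- would have reached the target.
        someActive : ∃ (OwnUnmarked s₁ i y)
        someActive with Fin.any? (active? y)
        ... | yes found = found
        ... | no none   = contradiction excess (<⇒≱ y<target)
          where
          saturated : ∀ q → owner q ≡ i → q ∉ marked s₁ → 1# ≤ y q
          saturated q own q∉M with q ∈? snapshot s
          ... | no q∉S  = outside≥1 q∉S q∉M
          ... | yes q∈S = ≮⇒≥ λ y<1 → none (q , (q∈S , q∉M) , own , y<1)
          excess : target ≤ sum y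
          excess = rearrange-≤ (held≤count saturated nonNegative′ ⊕ fromℕ-mono count₁≤reserve) (begin-equality
            sum y + (held y i + c)            ≈⟨ solve 3 (λ s h c → s :+ (h :+ c) := (h :+ s) :+ c) refl (sum y) (held y i) c ⟩
            (held y i + sum y) + c            ≈⟨ +-congʳ (held-conserved (own-fixed R)) ⟨
            (held (State.y s) i + sum (State.y s)) + c
              ≈⟨ +-congʳ (+-cong (proj₂ (proj₂ (isolated⇒ i∈))) full) ⟩
            (fromℕ (reserve i) + target) + c  ≈⟨ solve 3 (λ k t c → (k :+ t) :+ c := t :+ (c :+ k)) refl (fromℕ (reserve i)) target c ⟩
            target + (c + fromℕ (reserve i))  ∎)
            where c = fromℕ (count (marked s₁) i)

        private
          q₀ = proj₁ someActive
          A₀ = proj₂ someActive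
          same : ∀ {q} → OwnUnmarked s₁ i y q → y q ≈ y q₀
          same (U , own , _) = Risen.uniform R U (proj₁ A₀) (≡.trans own (≡.sym (proj₁ (proj₂ A₀))))

        phase : Phase (OwnUnmarked s₁ i) (λ y → ∣ collect (active? y) ∣) y
        phase = record
          { someActive = someActive
          -- By uniformity all rising pages have one level, so they all reach 1 at this moment.
          ; lifetime   = 1# - y q₀
          ; positive   = x<y⇒0<y-x (proj₂ (proj₂ A₀))
          ; steady     = λ ε w 0≤ε ε<life w-raised q → mk⇔
              (eligible-anti (raised-mono (active? y) 0≤ε w-raised))
              λ A@(U , own , _) → U , own , rearrange-< ε<life (trans
                (solve 2 (λ e z → :1 :+ e := (z :+ e) :+ (:1 :- z)) refl ε (y q₀))
                (+-congʳ (sym (trans (proj₁ (w-raised q) A) (+-congʳ (same A))))))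
          ; descends   = λ {y′} raised →
              let anti : ∀ {q} → OwnUnmarked s₁ i y′ q → OwnUnmarked s₁ i y q
                  anti = eligible-anti (raised-mono (active? y) (<⇒≤ (x<y⇒0<y-x (proj₂ (proj₂ A₀)))) raised)
              in p⊂q⇒∣p∣<∣q∣ {p = collect (active? y′)} {q = collect (active? y)}
                ( (λ {q} q∈ → ∈-collect (active? y) (anti (collect-∋ (active? y′) q∈)))
                , q₀ , ∈-collect (active? y) A₀
                , λ q₀∈ → proj₂ (proj₂ (proj₂ (collect-∋ (active? y′) q₀∈)))
                    (trans (proj₁ (raised q₀) A₀) (solve 1 (λ z → z :+ (:1 :- z) := :1) refl (y q₀))))
          }

      isolated-flow : ∃ (Flow (OwnUnmarked s₁ i) y₁)
      isolated-flow = Filling.fill (OwnUnmarked-rule s₁ i) y₁ (λ y → ∣ collect (active? y) ∣) phase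
        _ ℕ.≤-refl (risen-start y₁≤1 uniform₁) sum₁≤target

    claim : Agent → ℕ
    claim j = marks s j ℕ.⊔ reserve j

    claim₁ : Agent → ℕ
    claim₁ j = marks s₁ j ℕ.⊔ reserve j

    private
      module M = Marks {marked s} at-most-one marked⇒0

    claim≤held : ∀ j → fromℕ (claim j) ≤ held (y s) j
    claim≤held j with ℕ.⊔-sel (marks s j) (reserve j)
    ... | inj₁ eq rewrite eq = M.count≤held j
    ... | inj₂ eq rewrite eq = reserved j

    claim₁-other : ∀ {j} → j ≢ i → claim₁ j ≡ claim j
    claim₁-other {j} neq = ≡.cong (ℕ._⊔ reserve j) (count-other (marked s) (neq ∘ ≡.sym))

    marks₁-own : marks s₁ i ≡ suc (marks s i)
    marks₁-own = count-new (marked s) unmarked-p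

    -- The marks and reserves of all agents fit into the cache together.  When a non-tight
    -- agent can evict, they leave a unit of room, because these numbers are integers.
    claims-fit : CanEvict s i → sum (fromℕ ∘ claim₁) ≤ fromℕ k
    claims-fit (q , (q∈S , q∉M) , y<1 , free) with NonTight? (y s) (owner q)
    ... | yes nonTight = begin
      sum (fromℕ ∘ claim₁)           ≤⟨ rearrange-≤ (≤-reflexive (sum-update {g = fromℕ ∘ claim} i λ j neq → reflexive (≡.cong fromℕ (claim₁-other neq))) ⊕ claim₁-own)
         (solve 4 (λ A a B b → (:1 :+ B) :+ ((A :+ b) :+ a) := A :+ ((B :+ a) :+ (:1 :+ b))) refl (sum (fromℕ ∘ claim₁)) (fromℕ (claim₁ i)) (sum (fromℕ ∘ claim)) (fromℕ (claim i))) ⟩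
      1# + sum (fromℕ ∘ claim)       ≈⟨ +-congˡ (fromℕ-sumℕ claim) ⟨
      fromℕ (suc (sumℕ claim))       ≤⟨ fromℕ-mono (fromℕ-cancel-< {sumℕ claim} {k} claims<k) ⟩
      fromℕ k                        ∎
      where
      j = owner q
      claim<held : fromℕ (claim j) < held (y s) j
      -- Non-tightness beats the reserve, and the part of the unmarked `q` still in the cache beats
      -- the marks. The claims then sum to less than `k`, hence to at most `k` minus one.
      claim<held with ℕ.⊔-sel (marks s j) (reserve j)
      ... | inj₂ eq rewrite eq = nonTight
      ... | inj₁ eq rewrite eq = ≰⇒> λ held≤ → <⇒≱ y<1 (rearrange-≤ (M.count+unmarked≤held q∉M ⊕ held≤)
        (solve 3 (λ c h y → y :+ ((c :+ (:1 :- y)) :+ h) := :1 :+ (h :+ c)) refl (fromℕ (marks s j)) (held (y s) j) (y s q)))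
      claims<k : fromℕ (sumℕ claim) < fromℕ k
      claims<k = ≰⇒> λ k≤ → <⇒≱ claim<held (rearrange-≤
        (sum-mono-at {f = fromℕ ∘ claim} {g = held (y s)} {c = held (y s) j - fromℕ (claim j)} j claim≤held
          (≤-reflexive (solve 2 (λ c h → c :+ (h :- c) := h) refl (fromℕ (claim j)) (held (y s) j)))
         ⊕ (≤-trans (≤-trans (≤-reflexive (sum-held≈k full)) k≤) (≤-reflexive (fromℕ-sumℕ claim))))
        (solve 4 (λ c h s t → c :+ ((s :+ (h :- c)) :+ t) := h :+ (t :+ s)) refl (fromℕ (claim j)) (held (y s) j) (sum (fromℕ ∘ claim)) (sum (held (y s)))))
      claim₁-own : fromℕ (claim₁ i) ≤ 1# + fromℕ (claim i)
      claim₁-own = fromℕ-mono {n = suc (claim i)} (≡.subst (ℕ._≤ suc (claim i)) (≡.cong (ℕ._⊔ reserve i) (≡.sym marks₁-own))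
        (ℕ.⊔-lub (ℕ.s≤s (ℕ.m≤m⊔n (marks s i) _)) (ℕ.≤-trans (ℕ.m≤n⊔m (marks s i) _) (ℕ.n≤1+n _))))
    ... | no tight = begin
      sum (fromℕ ∘ claim₁)         ≤⟨ sum-mono claim₁≤held ⟩
      sum (held (y s))             ≈⟨ sum-held≈k full ⟩
      fromℕ k                      ∎
      where
      own : owner q ≡ i
      own = [ id , (λ nonTight → contradiction nonTight tight) ]′ free
      -- The tight `i` still holds part of the unmarked `q`, so its marks fall short of its reserve
      -- and the new mark does not raise its claim.
      below : marks s i ℕ.< reserve i
      below = fromℕ-cancel-< (≡.subst (λ j → fromℕ (marks s j) < fromℕ (reserve j)) own
        (≰⇒> λ reserve≤ → <⇒≱ y<1 (rearrange-≤ (M.count+unmarked≤held q∉M ⊕ ≮⇒≥ tight ⊕ reserve≤)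
          (solve 4 (λ c h y r → y :+ ((c :+ (:1 :- y)) :+ h :+ r) := :1 :+ (h :+ r :+ c)) refl
            (fromℕ (marks s (owner q))) (held (y s) (owner q)) (y s q) (fromℕ (reserve (owner q)))))))
      claim₁≤held : ∀ j → fromℕ (claim₁ j) ≤ held (y s) j
      claim₁≤held j with j Fin.≟ i
      ... | no neq     = ≤-trans (≤-reflexive (reflexive (≡.cong fromℕ (claim₁-other neq)))) (claim≤held j)
      ... | yes ≡.refl = ≤-trans (≤-reflexive (reflexive (≡.cong fromℕ
        (ℕ.m≤n⇒m⊔n≡n (≡.subst (ℕ._≤ reserve i) (≡.sym marks₁-own) below))))) (reserved i)

    module SharedPhase (can : CanEvict s i) where
      open FlowRule (LowestAvailable-rule s₁)

      Waiting : Alloc → Page → Set (ℓ₁ ⊔ ℓ₂)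
      Waiting y q = Available s₁ y q × ¬ LowestAvailable s₁ y q

      waiting? : ∀ y q → Dec (Waiting y q)
      waiting? y q = Available? s₁ y q ×-dec ¬? (active? y q)

      -- Each event lowers one of the two counts and raises neither: a page becomes full or its
      -- owner tight and it is no longer available, or a waiting page is reached by the rising ones.
      -- Pages that have joined these never wait again.
      μ : Alloc → ℕ
      μ y = ∣ collect (Available? s₁ y) ∣ ℕ.+ ∣ collect (waiting? y) ∣

      module _ {y} (R : Risen y₁ y) (y<target : sum y < target) where
        open Risen R using (at-most)
        open Refilling (shared-refilling R) using (marked⇒0′; nonNegative′; outside≥1)
        open Marks {marked s₁} at-most marked⇒0′

        -- If nothing were available, every agent would hold at most its claim. By `claims-fit` the
        -- claims sum to at most `k`, so the total would already be at the target.
        someAvailable : ∃ (Available s₁ y)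
        someAvailable with Fin.any? (Available? s₁ y)
        ... | yes found = found
        ... | no none   = contradiction excess (<⇒≱ y<target)
          where
          held≤claim₁ : ∀ j → held y j ≤ fromℕ (claim₁ j)
          held≤claim₁ j with NonTight? y j
          ... | no tight     = ≤-trans (≮⇒≥ tight) (fromℕ-mono (ℕ.m≤n⊔m (marks s₁ j) _))
          ... | yes nonTight = ≤-trans (held≤count saturated nonNegative′) (fromℕ-mono (ℕ.m≤m⊔n (marks s₁ j) _))
            where
            saturated : ∀ q → owner q ≡ j → q ∉ marked s₁ → 1# ≤ y q
            saturated q ≡.refl q∉M with q ∈? snapshot s
            ... | no q∉S  = outside≥1 q∉S q∉M
            ... | yes q∈S = ≮⇒≥ λ y<1 → none (q , (q∈S , q∉M) , y<1 , nonTight)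
          excess : target ≤ sum y
          excess = rearrange-≤ (≤-trans (sum-mono held≤claim₁) (claims-fit can)) (begin-equality
            sum y + sum (held y)    ≈⟨ +-comm _ _ ⟩
            sum (held y) + sum y    ≈⟨ sum-held-excess y ⟩
            fromℕ k + target        ≈⟨ +-comm _ _ ⟩
            target + fromℕ k        ∎)

        someActive : ∃ (LowestAvailable s₁ y)
        someActive = argmin (Available? s₁ y) y someAvailable

        private
          q₀ = proj₁ someActive
          A₀ = proj₂ someActive
          level : Carrier
          level = y q₀

        active-level : ∀ {q} → LowestAvailable s₁ y q → y q ≈ level
        active-level (av , lowest) = antisym (lowest q₀ (proj₁ A₀)) (proj₂ A₀ _ av)

        waiting-above : ∀ {q} → Waiting y q → level < y q
        waiting-above {q} (av , ¬lowest) = proj₂ A₀ q av , λ level≈ → ¬lowest (av , λ r av′ →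
          ≤-trans (≤-reflexive (sym level≈)) (proj₂ A₀ r av′))

        private
          N : Agent → Carrier
          N = rate (active? y)

          slack : Agent → Carrier
          slack j = held y j - fromℕ (reserve j)

        -- How long q can rise before it is full or its owner becomes tight, respectively
        -- how long the active pages need to reach q.
        life : Page → Carrier
        life q with active? y q
        ... | yes _ = (1# - y q) ⊓ (N (owner q) ⁻¹ * slack (owner q))
        ... | no  _ = y q - level

        life-waiting : ∀ {q} → ¬ LowestAvailable s₁ y q → life q ≈ y q - level
        life-waiting {q} ¬A with active? y q
        ... | yes A = contradiction A ¬A
        ... | no _  = refl

        life-active : ∀ {q} → LowestAvailable s₁ y q →
          life q ≈ 1# - y q ⊎ life q ≈ N (owner q) ⁻¹ * slack (owner q)
        life-active {q} A with active? y q
        ... | yes _ = ⊓-sel _ _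
        ... | no ¬A = contradiction A ¬A

        life≤⊓ : ∀ {q} → LowestAvailable s₁ y q → life q ≤ (1# - y q) ⊓ (N (owner q) ⁻¹ * slack (owner q))
        life≤⊓ {q} A with active? y q
        ... | yes _ = ≤-refl
        ... | no ¬A = contradiction A ¬A

        life-positive : ∀ {q} → Available s₁ y q → 0# < life q
        life-positive {q} av@(U , y<1 , nonTight) = decide (active? y q)
          where
          decide : Dec (LowestAvailable s₁ y q) → 0# < life q
          decide (no ¬A) = <-respʳ (sym (life-waiting ¬A)) (x<y⇒0<y-x (waiting-above (av , ¬A)))
          decide (yes A) with life-active A
          ... | inj₁ eq = <-respʳ (sym eq) (x<y⇒0<y-x y<1)
          ... | inj₂ eq = <-respʳ (sym eq) (*-positive (0<⁻¹ (rate-positive (active? y) A)) (x<y⇒0<y-x nonTight))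

        private
          first = argmin (Available? s₁ y) life someAvailable
          q* = proj₁ first
          av* = proj₁ (proj₂ first)
          λ* = life q*

          life≤waiting : ∀ {q} → Waiting y q → λ* ≤ y q - level
          life≤waiting {q} (av , ¬A) = ≤-trans (proj₂ (proj₂ first) q av) (≤-reflexive (life-waiting ¬A))

          life≤full : ∀ {q} → LowestAvailable s₁ y q → λ* ≤ 1# - y q
          life≤full {q} A = ≤-trans (proj₂ (proj₂ first) q (proj₁ A)) (≤-trans (life≤⊓ A) (x⊓y≤x _ _))

          life≤tight : ∀ {q} → LowestAvailable s₁ y q → λ* ≤ N (owner q) ⁻¹ * slack (owner q)
          life≤tight {q} A = ≤-trans (proj₂ (proj₂ first) q (proj₁ A)) (≤-trans (life≤⊓ A) (x⊓y≤y _ _))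

          N*slack : ∀ {q} → LowestAvailable s₁ y q → N (owner q) * (N (owner q) ⁻¹ * slack (owner q)) ≈ slack (owner q)
          N*slack A = trans (sym (*-assoc _ _ _))
            (trans (*-congʳ (⁻¹-inverseʳ (proj₂ (rate-positive (active? y) A) ∘ sym))) (*-identityˡ _))

        module _ {ε w} (0≤ε : 0# ≤ ε) (ε<life : ε < λ*) (raised : Raised (LowestAvailable s₁ y) ε y w) where

          stays-nonTight : ∀ {q} → Available s₁ y q → NonTight w (owner q)
          stays-nonTight {q} (_ , _ , nonTight) with Fin.any? (λ r → active? y r ×-dec owner r Fin.≟ owner q)
          ... | no none = nonTight-cong {y} {w} (held-cong λ r eq → sym (proj₂ (raised r) λ A → none (r , A , eq))) nonTight
          ... | yes (r , A , eq) = ≡.subst (NonTight w) eq (≰⇒> λ held≤ → <⇒≱ ε<life (≤-trans (life≤tight A)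
              (≤-stable λ life≰ε → <⇒≱ (≰⇒> life≰ε) (cancel A held≤))))
            where
            cancel : ∀ {r} → LowestAvailable s₁ y r → held w (owner r) ≤ fromℕ (reserve (owner r)) →
              N (owner r) ⁻¹ * slack (owner r) ≤ ε
            cancel {r} A held≤ = begin
              N (owner r) ⁻¹ * slack (owner r)
                ≤⟨ *-monoʳ-≤ (0≤⁻¹ (rate-positive (active? y) A)) (rearrange-≤ held≤ (trans
                     (solve 3 (λ e h k → e :+ h := ((h :+ e) :- k) :+ k) refl (N (owner r) * ε) (held w (owner r)) (fromℕ (reserve (owner r))))
                     (+-congʳ (+-congʳ (held-raised (active? y) raised (owner r)))))) ⟩
              N (owner r) ⁻¹ * (N (owner r) * ε)
                ≈⟨ trans (sym (*-assoc _ _ _)) (*-congʳ (trans (*-comm _ _) (⁻¹-inverseʳ (proj₂ (rate-positive (active? y) A) ∘ sym)))) ⟩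
              1# * ε                     ≈⟨ *-identityˡ ε ⟩
              ε                          ∎

          raised-level : ∀ {q} → LowestAvailable s₁ y q → w q ≈ level + ε
          raised-level {q} A = trans (proj₁ (raised q) A) (+-congʳ (active-level A))

          below-waiting : ∀ {q} → Waiting y q → level + ε < w q
          below-waiting {q} W = ≰⇒> λ w≤ → <⇒≱ ε<life (≤-trans (life≤waiting W) (rearrange-≤ w≤ (trans
            (+-congˡ (proj₂ (raised q) (proj₂ W)))
            (solve 3 (λ l e y → e :+ y := (y :- l) :+ (l :+ e)) refl level ε (y q)))))

          available-stays : ∀ {q} → Available s₁ y q → Available s₁ w q
          available-stays {q} av@(U , y<1 , _) = U , w<1 , stays-nonTight av
            where
            w<1 : w q < 1#
            w<1 with active? y q
            ... | no ¬A = <-below (≤-reflexive (proj₂ (raised q) ¬A)) y<1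
            ... | yes A = ≰⇒> λ 1≤w → <⇒≱ ε<life (≤-trans (life≤full A)
              (rearrange-≤ (≤-trans 1≤w (≤-reflexive (proj₁ (raised q) A)))
                (solve 2 (λ e y → e :+ :1 := (:1 :- y) :+ (y :+ e)) refl ε (y q))))

          steady : ∀ q → LowestAvailable s₁ w q ⇔ LowestAvailable s₁ y q
          steady q = mk⇔ to from
            where
            to : LowestAvailable s₁ w q → LowestAvailable s₁ y q
            to (av , lowest) with active? y q
            ... | yes A = A
            ... | no ¬A = contradiction
              (≤-trans (lowest q₀ (available-stays (proj₁ A₀))) (≤-reflexive (raised-level A₀)))
              (<⇒≱ (below-waiting (available-anti {s₁} (raised-mono (active? y) 0≤ε raised) av , ¬A)))
            from : LowestAvailable s₁ y q → LowestAvailable s₁ w q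
            from A = available-stays (proj₁ A) , λ r av → ≤-trans (≤-reflexive (raised-level A)) (lowest r av)
              where
              lowest : ∀ r → Available s₁ w r → level + ε ≤ w r
              lowest r av with active? y r
              ... | yes A = ≤-reflexive (sym (raised-level A))
              ... | no ¬A = <⇒≤ (below-waiting (available-anti {s₁} (raised-mono (active? y) 0≤ε raised) av , ¬A))

        module _ {y′} (raised : Raised (LowestAvailable s₁ y) λ* y y′) where

          private
            0≤λ* = <⇒≤ (life-positive av*)

          anti : ∀ {q} → Available s₁ y′ q → Available s₁ y q
          anti = available-anti {s₁} (raised-mono (active? y) 0≤λ* raised)

          final-level : ∀ {q} → LowestAvailable s₁ y q → y′ q ≈ level + λ*
          final-level {q} A = trans (proj₁ (raised q) A) (+-congʳ (active-level A))

          final-lowest : ∀ {q} → Available s₁ y′ q → y′ q ≈ level + λ* → LowestAvailable s₁ y′ q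
          final-lowest av eq = av , λ r av′ → ≤-trans (≤-reflexive eq) (lowest r av′)
            where
            lowest : ∀ r → Available s₁ y′ r → level + λ* ≤ y′ r
            lowest r av′ with active? y r
            ... | yes A = ≤-reflexive (sym (final-level A))
            ... | no ¬A = begin
              level + λ*             ≤⟨ ≤-refl ⊕ life≤waiting (anti av′ , ¬A) ⟩
              level + (y r - level)  ≈⟨ solve 2 (λ l y → l :+ (y :- l) := y) refl level (y r) ⟩
              y r                    ≈⟨ proj₂ (raised r) ¬A ⟨
              y′ r                   ∎

          waiting-anti : ∀ {q} → Waiting y′ q → Waiting y q
          waiting-anti (av , ¬lowest) = anti av , λ A → ¬lowest (final-lowest av (final-level A))

          -- The page `q*` attains the least `life`, so the event at the end of the stretch is its
          -- own: it is reached, becomes full, or sees its owner become tight.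
          leaves : Dec (LowestAvailable s₁ y q*) → ¬ Available s₁ y′ q* ⊎ (Waiting y q* × ¬ Waiting y′ q*)
          leaves (no ¬A) = inj₂ ((av* , ¬A) , λ (av , ¬lowest) → ¬lowest (final-lowest av (begin-equality
            y′ q*                    ≈⟨ proj₂ (raised q*) ¬A ⟩
            y q*                     ≈⟨ solve 2 (λ l y → l :+ (y :- l) := y) refl level (y q*) ⟨
            level + (y q* - level)   ≈⟨ +-congˡ (life-waiting ¬A) ⟨
            level + λ*               ∎)))
          leaves (yes A) with life-active A
          ... | inj₁ eq = inj₁ λ (_ , y′<1 , _) → proj₂ y′<1 (trans (proj₁ (raised q*) A)
                  (trans (+-congˡ eq) (solve 1 (λ z → z :+ (:1 :- z) := :1) refl (y q*))))
          ... | inj₂ eq = inj₁ λ (_ , _ , nonTight) → proj₂ nonTight (sym (begin-equality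
            held y′ j                        ≈⟨ solve 2 (λ h e → h := (h :+ e) :- e) refl (held y′ j) (N j * λ*) ⟩
            (held y′ j + N j * λ*) - N j * λ*  ≈⟨ +-cong (held-raised (active? y) raised j) (-‿cong (trans (*-congˡ eq) (N*slack A))) ⟩
            held y j - slack j               ≈⟨ solve 2 (λ h k → h :- (h :- k) := k) refl (held y j) (fromℕ (reserve j)) ⟩
            fromℕ (reserve j)                ∎))
            where j = owner q*

          descends : μ y′ ℕ.< μ y
          descends = [ (λ gone → ℕ.+-mono-<-≤ (p⊂q⇒∣p∣<∣q∣ (available-⊆ , q* , ∈-collect (Available? s₁ y) av*
                                   , gone ∘ collect-∋ (Available? s₁ y′))) (p⊆q⇒∣p∣≤∣q∣ waiting-⊆))
                     , (λ (W , ¬W′) → ℕ.+-mono-≤-< (p⊆q⇒∣p∣≤∣q∣ available-⊆)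
                          (p⊂q⇒∣p∣<∣q∣ (waiting-⊆ , q* , ∈-collect (waiting? y) W , ¬W′ ∘ collect-∋ (waiting? y′)))) ]′ (leaves (active? y q*))
            where
            available-⊆ : collect (Available? s₁ y′) ⊆ collect (Available? s₁ y)
            available-⊆ q∈ = ∈-collect (Available? s₁ y) (anti (collect-∋ (Available? s₁ y′) q∈))
            waiting-⊆ : collect (waiting? y′) ⊆ collect (waiting? y)
            waiting-⊆ q∈ = ∈-collect (waiting? y) (waiting-anti (collect-∋ (waiting? y′) q∈))

        phase : Phase (LowestAvailable s₁) μ y
        phase = record
          { someActive = someActive
          ; lifetime   = λ*
          ; positive   = life-positive av*
          ; steady     = λ _ _ 0≤ε ε<life raised → steady 0≤ε ε<life raised
          ; descends   = descends
          }

      shared-flow : ∃ (Flow (LowestAvailable s₁) y₁)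
      shared-flow = Filling.fill (LowestAvailable-rule s₁) y₁ μ phase
        _ ℕ.≤-refl (risen-start y₁≤1 uniform₁) sum₁≤target

  CanEvict? : ∀ s i → Dec (CanEvict s i)
  CanEvict? s i with Fin.any? (λ q → Unmarked? s q ×-dec (y s q <? 1#) ×-dec
                        (owner q Fin.≟ i ⊎-dec NonTight? (y s) (owner q)))
  ... | yes can = yes can
  ... | no cant = no cant

  progress : ∀ {s F} → Invariant s F → ∀ p → ∃ (Step s p)
  progress {s} inv p with y s p ≟ 0#
  ... | yes y≈0 = _ , hit y≈0
  ... | no miss with owner p ∈? isolated s
  ...   | yes i∈ = _ , isolatedMiss miss i∈ (proj₂ (OwnPhase.isolated-flow inv p miss i∈))
  ...   | no i∉ with CanEvict? s (owner p)
  ...     | yes can  = _ , sharedMiss miss i∉ can (proj₂ (SharedPhase.shared-flow inv p miss can))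
  ...     | no stuck = _ , newPhase miss i∉ stuck (sharedMiss miss shared-next (canEvict (owner p))
                         (proj₂ (SharedPhase.shared-flow invariant-endPhase p miss (canEvict (owner p)))))
    where open NewPhase inv miss stuck

  -- The potential of a solution

  -- Under the invariant, having `F` true and at least as many marks as the reserve means precisely
  -- that the agent was isolated at the start of the global phase and has been released since.
  charged : (M S : Subset ∣𝒫∣) (F : Agent → Bool) → Page → Bool
  charged M S F p = not (lookup M p) ∧
    (not (lookup S p) ∨ (F (owner p) ∧ does (reserve (owner p) ℕ.≤? count M (owner p))))

  -- For a page with portion x in the solution.  The summand 2 x turns the cost of evictions
  -- into the cost of fetches.  On an unmarked page, x is reserved once for a charge on a new
  -- page (inS false) and once for a charge on a page of a formerly isolated agent (inF).
  -- On a marked page, the missing portion 1 - x is reserved once for the end of the phase,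
  -- and a second time if its owner may still be isolated then (inF false).
  weight : (inF inM inS : Bool) → Carrier → Carrier
  weight inF true  inS x = if inF then 1# + x else 1# + 1#
  weight inF false inS x = x + x + (if inS then 0# else x) + (if inF then x else 0#)

  -- At the end of a phase an isolated agent counts with its reserve in the capacity inequality, but
  -- when it becomes isolated its weights cover only its marks. The difference is taken from its
  -- allowance, which drops from the reserve to the marks and regains one unit with each new mark.
  allowance : Bool → (k m : ℕ) → ℕ
  allowance inF k m = if inF then k ℕ.⊓ m else k

  Ψ : (M S : Subset ∣𝒫∣) (F : Agent → Bool) → Alloc → Carrier
  Ψ M S F x = sum (λ q → weight (F (owner q)) (lookup M q) (lookup S q) (x q))
            + sum (λ i → fromℕ (allowance (F i) (reserve i) (count M i)))

  weight-mono : ∀ inF inM inS {x x′} → x′ ≤ x → weight inF inM inS x′ ≤ weight inF inM inS x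
  weight-mono true  true  inS   x′≤x = ≤-refl ⊕ x′≤x
  weight-mono false true  inS   x′≤x = ≤-refl
  weight-mono true  false true  x′≤x = x′≤x ⊕ x′≤x ⊕ ≤-refl ⊕ x′≤x
  weight-mono true  false false x′≤x = x′≤x ⊕ x′≤x ⊕ x′≤x ⊕ x′≤x
  weight-mono false false true  x′≤x = x′≤x ⊕ x′≤x ⊕ ≤-refl ⊕ ≤-refl
  weight-mono false false false x′≤x = x′≤x ⊕ x′≤x ⊕ x′≤x ⊕ ≤-refl

  weight-nonNegative : ∀ inF inM inS {x} → 0# ≤ x → 0# ≤ weight inF inM inS x
  weight-nonNegative true  true  inS   0≤x = +-nonNegative 0≤1 0≤x
  weight-nonNegative false true  inS   0≤x = +-nonNegative 0≤1 0≤1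
  weight-nonNegative true  false true  0≤x = +-nonNegative (+-nonNegative (+-nonNegative 0≤x 0≤x) ≤-refl) 0≤x
  weight-nonNegative true  false false 0≤x = +-nonNegative (+-nonNegative (+-nonNegative 0≤x 0≤x) 0≤x) 0≤x
  weight-nonNegative false false true  0≤x = +-nonNegative (+-nonNegative (+-nonNegative 0≤x 0≤x) ≤-refl) ≤-refl
  weight-nonNegative false false false 0≤x = +-nonNegative (+-nonNegative (+-nonNegative 0≤x 0≤x) 0≤x) ≤-refl

  Ψ-nonNegative : ∀ M S F {x} → (∀ q → 0# ≤ x q) → 0# ≤ Ψ M S F x
  Ψ-nonNegative M S F 0≤x = +-nonNegative
    (sum-nonNegative λ q → weight-nonNegative (F (owner q)) (lookup M q) (lookup S q) (0≤x q))
    (sum-nonNegative λ i → 0≤fromℕ (allowance (F i) (reserve i) (count M i)))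

  4# : Carrier
  4# = fromℕ 4

  weight-marked : ∀ inF inS {x x′} → x ≤ 1# → x′ ≈ 1# →
    weight inF true inS x′ ≤ weight inF true inS x + 4# * (1# - x)
  weight-marked true inS {x} {x′} x≤1 x′≈1 = rearrange-≤ (≤-reflexive x′≈1 ⊕ x≤1 ⊕ x≤1 ⊕ x≤1)
    (solve 2 (λ x x′ → ((:1 :+ x) :+ :fromℕ 4 :* (:1 :- x)) :+ (x′ :+ x :+ x :+ x) := (:1 :+ x′) :+ (:1 :+ :1 :+ :1 :+ :1)) refl x x′)
  weight-marked false inS {x} x≤1 x′≈1 = rearrange-≤ (x≤1 ⊕ x≤1 ⊕ x≤1 ⊕ x≤1)
    (solve 1 (λ x → ((:1 :+ :1) :+ :fromℕ 4 :* (:1 :- x)) :+ (x :+ x :+ x :+ x) := (:1 :+ :1) :+ (:1 :+ :1 :+ :1 :+ :1)) refl x)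

  -- The cost 1 - x, four times, covers the growth of the weight to 2, the growth of the
  -- owner's allowance, and the charge.
  weight-fresh : ∀ inF inS {k m} {x x′} → x ≤ 1# → x′ ≈ 1# → (k≤?m : Dec (k ℕ.≤ m)) →
    𝟙 (not inS ∨ (inF ∧ does k≤?m)) + weight inF true inS x′ + fromℕ (allowance inF k (suc m))
      ≤ weight inF false inS x + fromℕ (allowance inF k m) + 4# * (1# - x)
  weight-fresh false true {k} {m} {x} {x′} x≤1 x′≈1 _ = rearrange-≤ (x≤1 ⊕ x≤1)
    (solve 2 (λ x k → ((x :+ x :+ :0 :+ :0) :+ k :+ :fromℕ 4 :* (:1 :- x)) :+ (x :+ x)
       := (:0 :+ (:1 :+ :1) :+ k) :+ (:1 :+ :1)) refl x (fromℕ k))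
  weight-fresh false false {k} {m} {x} {x′} x≤1 x′≈1 _ = rearrange-≤ x≤1
    (solve 2 (λ x k → ((x :+ x :+ x :+ :0) :+ k :+ :fromℕ 4 :* (:1 :- x)) :+ x
       := (:1 :+ (:1 :+ :1) :+ k) :+ :1) refl x (fromℕ k))
  weight-fresh true true {k} {m} {x} {x′} x≤1 x′≈1 (yes k≤m)
    rewrite ℕ.m≤n⇒m⊓n≡m k≤m | ℕ.m≤n⇒m⊓n≡m (ℕ.m≤n⇒m≤1+n k≤m) = rearrange-≤ (≤-reflexive x′≈1 ⊕ x≤1)
    (solve 3 (λ x x′ k → ((x :+ x :+ :0 :+ x) :+ k :+ :fromℕ 4 :* (:1 :- x)) :+ (x′ :+ x)
       := (:1 :+ (:1 :+ x′) :+ k) :+ (:1 :+ :1)) refl x x′ (fromℕ k))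
  weight-fresh true false {k} {m} {x} {x′} x≤1 x′≈1 (yes k≤m)
    rewrite ℕ.m≤n⇒m⊓n≡m k≤m | ℕ.m≤n⇒m⊓n≡m (ℕ.m≤n⇒m≤1+n k≤m) = rearrange-≤ (≤-reflexive x′≈1 ⊕ 0≤1)
    (solve 3 (λ x x′ k → ((x :+ x :+ x :+ x) :+ k :+ :fromℕ 4 :* (:1 :- x)) :+ (x′ :+ :0)
       := (:1 :+ (:1 :+ x′) :+ k) :+ (:1 :+ :1)) refl x x′ (fromℕ k))
  weight-fresh true true {k} {m} {x} {x′} x≤1 x′≈1 (no k≰m)
    rewrite ℕ.m≥n⇒m⊓n≡n (ℕ.≰⇒> k≰m) | ℕ.m≥n⇒m⊓n≡n (ℕ.<⇒≤ (ℕ.≰⇒> k≰m)) = rearrange-≤ (≤-reflexive x′≈1 ⊕ x≤1)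
    (solve 3 (λ x x′ m → ((x :+ x :+ :0 :+ x) :+ m :+ :fromℕ 4 :* (:1 :- x)) :+ (x′ :+ x)
       := (:0 :+ (:1 :+ x′) :+ (:1 :+ m)) :+ (:1 :+ :1)) refl x x′ (fromℕ m))
  weight-fresh true false {k} {m} {x} {x′} x≤1 x′≈1 (no k≰m)
    rewrite ℕ.m≥n⇒m⊓n≡n (ℕ.≰⇒> k≰m) | ℕ.m≥n⇒m⊓n≡n (ℕ.<⇒≤ (ℕ.≰⇒> k≰m)) = rearrange-≤ (≤-reflexive x′≈1)
    (solve 3 (λ x x′ m → ((x :+ x :+ x :+ x) :+ m :+ :fromℕ 4 :* (:1 :- x)) :+ x′
       := (:1 :+ (:1 :+ x′) :+ (:1 :+ m)) :+ :1) refl x x′ (fromℕ m))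

  lookup-new : ∀ (M : Subset ∣𝒫∣) p → lookup (M ∪ ⁅ p ⁆) p ≡ true
  lookup-new M p = []=⇒lookup (∈∪⁅⁆ {S = M})

  local-step : ∀ M S F p {x x′} → Feasible x → Serves x p x′ →
    𝟙 (charged M S F p)
      + weight (F (owner p)) (lookup (M ∪ ⁅ p ⁆) p) (lookup S p) (x′ p)
      + fromℕ (allowance (F (owner p)) (reserve (owner p)) (count (M ∪ ⁅ p ⁆) (owner p)))
    ≤ weight (F (owner p)) (lookup M p) (lookup S p) (x p)
      + fromℕ (allowance (F (owner p)) (reserve (owner p)) (count M (owner p)))
      + 4# * (1# - x p)
  local-step M S F p {x} {x′} feasible serves rewrite lookup-new M p with p ∈? M
  ... | yes p∈M rewrite ∪⁅⁆-absorb p∈M | []=⇒lookup p∈M = rearrange-≤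
    (weight-marked (F (owner p)) (lookup S p) (Feasible.at-most-one feasible p) (Serves.requested serves))
    (solve 4 (λ w′ w f r → (w :+ r :+ f) :+ w′ := (:0 :+ w′ :+ r) :+ (w :+ f)) refl
      (weight (F (owner p)) true (lookup S p) (x′ p)) (weight (F (owner p)) true (lookup S p) (x p))
      (4# * (1# - x p)) (fromℕ (allowance (F (owner p)) (reserve (owner p)) (count M (owner p)))))
  ... | no p∉M rewrite count-new M p∉M | ∉⇒lookup p∉M =
    weight-fresh (F (owner p)) (lookup S p) (Feasible.at-most-one feasible p) (Serves.requested serves)
      (reserve (owner p) ℕ.≤? count M (owner p))

  -- By `no-prefetch` the weights of the other pages can only fall, so everything is decided at `p`
  -- and its owner.
  Ψ-step : ∀ M S F p {x x′} → Feasible x → Serves x p x′ →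
    𝟙 (charged M S F p) + Ψ (M ∪ ⁅ p ⁆) S F x′ ≤ Ψ M S F x + 4# * (1# - x p)
  Ψ-step M S F p {x} {x′} feasible serves = rearrange-≤
    (sum-exchange {f = w′} {g = w} p others ⊕ ≤-reflexive (sum-update {f = r′} {g = r} (owner p) other-agents)
      ⊕ local-step M S F p feasible serves)
    (solve 10 (λ c f ∑w ∑w′ ∑r ∑r′ w w′ r r′ →
        (∑w :+ ∑r :+ f) :+ ((∑w′ :+ w) :+ (∑r′ :+ r) :+ (c :+ w′ :+ r′))
        := (c :+ (∑w′ :+ ∑r′)) :+ ((∑w :+ w′) :+ (∑r :+ r′) :+ (w :+ r :+ f))) refl
      (𝟙 (charged M S F p)) (4# * (1# - x p)) (sum w) (sum w′) (sum r) (sum r′) (w p) (w′ p) (r (owner p)) (r′ (owner p)))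
    where
    w w′ : Page → Carrier
    w  q = weight (F (owner q)) (lookup M q) (lookup S q) (x q)
    w′ q = weight (F (owner q)) (lookup (M ∪ ⁅ p ⁆) q) (lookup S q) (x′ q)
    r r′ : Agent → Carrier
    r  i = fromℕ (allowance (F i) (reserve i) (count M i))
    r′ i = fromℕ (allowance (F i) (reserve i) (count (M ∪ ⁅ p ⁆) i))
    others : ∀ q → q ≢ p → w′ q ≤ w q
    others q q≢p rewrite lookup-∪⁅⁆ M q≢p =
      weight-mono (F (owner q)) (lookup M q) (lookup S q) (Serves.no-prefetch serves q q≢p)
    other-agents : ∀ i → i ≢ owner p → r′ i ≈ r i
    other-agents i neq rewrite count-other M {p} {i} (neq ∘ ≡.sym) = refl

  -- The restart of an agent, whose new snapshot is its old set of marks. A marked page spends the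
  -- reserved portion 1 - x; an unmarked page uses x to reserve for a charge as a new page.
  weight-moved : ∀ inF inM inS {x} → 0# ≤ x → x ≤ 1# →
    weight false false inM x + 𝟙 inM ≤ weight inF inM inS x + x
  weight-moved true  true  inS {x} 0≤x x≤1 = ≤-reflexive
    (solve 1 (λ x → (x :+ x :+ :0 :+ :0) :+ :1 := (:1 :+ x) :+ x) refl x)
  weight-moved false true  inS {x} 0≤x x≤1 = rearrange-≤ x≤1
    (solve 1 (λ x → ((:1 :+ :1) :+ x) :+ x := ((x :+ x :+ :0 :+ :0) :+ :1) :+ :1) refl x)
  weight-moved true  false true {x} 0≤x x≤1 = rearrange-≤ 0≤x
    (solve 1 (λ x → ((x :+ x :+ :0 :+ x) :+ x) :+ :0 := ((x :+ x :+ x :+ :0) :+ :0) :+ x) refl x)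
  weight-moved true  false false {x} 0≤x x≤1 = rearrange-≤ (0≤x ⊕ 0≤x)
    (solve 1 (λ x → ((x :+ x :+ x :+ x) :+ x) :+ (:0 :+ :0) := ((x :+ x :+ x :+ :0) :+ :0) :+ (x :+ x)) refl x)
  weight-moved false false true {x} 0≤x x≤1 = ≤-reflexive
    (solve 1 (λ x → ((x :+ x :+ x :+ :0) :+ :0) := ((x :+ x :+ :0 :+ :0) :+ x)) refl x)
  weight-moved false false false {x} 0≤x x≤1 = rearrange-≤ 0≤x
    (solve 1 (λ x → ((x :+ x :+ x :+ :0) :+ x) :+ :0 := ((x :+ x :+ x :+ :0) :+ :0) :+ x) refl x)

  -- An agent becoming isolated. A marked page spends one of its two reserved portions 1 - x and
  -- keeps the other for its later restart; an unmarked page uses x to reserve for a charge after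
  -- the release.
  weight-isolated : ∀ inM inS {x} → x ≤ 1# → weight true inM inS x + 𝟙 inM ≤ weight false inM inS x + x
  weight-isolated true inS {x} x≤1 = ≤-reflexive
    (solve 1 (λ x → (:1 :+ x) :+ :1 := (:1 :+ :1) :+ x) refl x)
  weight-isolated false inS {x} x≤1 = ≤-reflexive
    (solve 2 (λ x b → (x :+ x :+ b :+ x) :+ :0 := (x :+ x :+ b :+ :0) :+ x) refl x (if inS then 0# else x))

  module _ {s F} (inv : Invariant s F)
    (held≤max : ∀ j → held (y s) j ≤ fromℕ (marks s j ℕ.⊔ reserve j)) where
    open EndPhase inv held≤max
    open Invariant inv

    -- Isolated agents keep their reserve in every solution, so that what the other agents
    -- can hold is at most the number of their marked pages.
    Ψ-endPhase : ∀ {x} → Feasible x → Ψ (marked s′) (snapshot s′) F′ x ≤ Ψ (marked s) (snapshot s) F x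
    Ψ-endPhase {x} feasible = rearrange-≤ (summed ⊕ sum-x≤k ⊕ ≤-reflexive (sym (sum-held≈k full)) ⊕ sum-mono held≤max)
      (solve 8 (λ w′ w r′ r h x k m →
          (w :+ r) :+ ((w′ :+ r′ :+ m) :+ x :+ k :+ h) := (w′ :+ r′) :+ ((w :+ r :+ x) :+ k :+ h :+ m)) refl
        (sum w′) (sum w) (sum r′) (sum r) (sum (held (y s))) (sum x) (fromℕ k) (sum ceiling))
      where
      open Feasible feasible using (reserves) renaming (nonNegative to 0≤x; at-most-one to x≤1; capacity to sum-x≤k)
      w w′ : Page → Carrier
      w  q = weight (F (owner q)) (lookup (marked s) q) (lookup (snapshot s) q) (x q)
      w′ q = weight (F′ (owner q)) (lookup (marked s′) q) (lookup (snapshot s′) q) (x q)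
      r r′ ceiling : Agent → Carrier
      r  j = fromℕ (allowance (F j) (reserve j) (count (marked s) j))
      r′ j = fromℕ (allowance (F′ j) (reserve j) (count (marked s′) j))
      ceiling j = fromℕ (marks s j ℕ.⊔ reserve j)

      per-page : ∀ {j} → (∀ q → owner q ≡ j → w′ q + 𝟙 (lookup (marked s) q) ≤ w q + x q) →
        agentSum j w′ + fromℕ (marks s j) ≤ agentSum j w + agentSum j x
      per-page {j} bound = begin
        agentSum j w′ + fromℕ (marks s j)                      ≈⟨ +-congˡ (fromℕ-count (marked s) j) ⟩
        agentSum j w′ + agentSum j (𝟙 ∘ lookup (marked s))     ≈⟨ agentSum-+ w′ _ ⟨
        agentSum j (λ q → w′ q + 𝟙 (lookup (marked s) q))      ≤⟨ agentSum-mono bound ⟩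
        agentSum j (λ q → w q + x q)                           ≈⟨ agentSum-+ w x ⟩
        agentSum j w + agentSum j x                            ∎

      per-agent : ∀ j → agentSum j w′ + r′ j + ceiling j ≤ agentSum j w + r j + agentSum j x
      per-agent j with ℕ.<-≤-connex (marks s j) (reserve j)
      ... | inj₂ ge = rearrange-≤ (per-page moved ⊕ ≤-reflexive r′≈k ⊕ ≤-reflexive ceiling≈m ⊕ ≤-reflexive (sym r≈k))
          (solve 8 (λ w′ w r′ r c x k m → (w :+ r :+ x) :+ ((w′ :+ m) :+ r′ :+ c :+ k) := (w′ :+ r′ :+ c) :+ ((w :+ x) :+ k :+ m :+ r)) refl
            (agentSum j w′) (agentSum j w) (r′ j) (r j) (ceiling j) (agentSum j x) (fromℕ (reserve j)) (fromℕ (marks s j)))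
        where
        F′j : F′ j ≡ false
        F′j = dec-false (stays j) (ℕ.≤⇒≯ ge)
        r′≈k : r′ j ≈ fromℕ (reserve j)
        r′≈k = reflexive (≡.cong (λ b → fromℕ (allowance b (reserve j) (count (marked s′) j))) F′j)
        r≈k : r j ≈ fromℕ (reserve j)
        r≈k with F j
        ... | true  = reflexive (≡.cong fromℕ (ℕ.m≤n⇒m⊓n≡m ge))
        ... | false = refl
        ceiling≈m : ceiling j ≈ fromℕ (marks s j)
        ceiling≈m = reflexive (≡.cong fromℕ (ℕ.m≥n⇒m⊔n≡m ge))
        moved : ∀ q → owner q ≡ j → w′ q + 𝟙 (lookup (marked s) q) ≤ w q + x q
        moved q ≡.refl rewrite move-marked {q} ge | move-snapshot {q} ge =
          ≤-trans (≤-reflexive (+-congʳ (reflexive (≡.cong (λ b → weight b false (lookup (marked s) q) (x q)) F′j))))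
            (weight-moved (F (owner q)) (lookup (marked s) q) (lookup (snapshot s) q) (0≤x q) (x≤1 q))
      ... | inj₁ lt = by-origin (F j) ≡.refl
        where
        F′j : F′ j ≡ true
        F′j = dec-true (stays j) lt
        r′≈m : r′ j ≈ fromℕ (marks s j)
        r′≈m = trans (reflexive (≡.cong₂ (λ b c → fromℕ (allowance b (reserve j) c)) F′j (marks-stay lt)))
                     (reflexive (≡.cong fromℕ (ℕ.m≥n⇒m⊓n≡n (ℕ.<⇒≤ lt))))
        ceiling≈k : ceiling j ≈ fromℕ (reserve j)
        ceiling≈k = reflexive (≡.cong fromℕ (ℕ.m≤n⇒m⊔n≡n (ℕ.<⇒≤ lt)))
        w′-stay : ∀ q → owner q ≡ j → w′ q ≡ weight true (lookup (marked s) q) (lookup (snapshot s) q) (x q)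
        w′-stay q ≡.refl rewrite stay-marked {q} lt | stay-snapshot {q} lt =
          ≡.cong (λ b → weight b (lookup (marked s) q) (lookup (snapshot s) q) (x q)) F′j
        by-origin : ∀ b → F j ≡ b → agentSum j w′ + r′ j + ceiling j ≤ agentSum j w + r j + agentSum j x
        by-origin false Fj = rearrange-≤ (per-page newly ⊕ ≤-reflexive r′≈m ⊕ ≤-reflexive ceiling≈k ⊕ ≤-reflexive (sym r≈k))
            (solve 8 (λ w′ w r′ r c x k m → (w :+ r :+ x) :+ ((w′ :+ m) :+ r′ :+ c :+ k) := (w′ :+ r′ :+ c) :+ ((w :+ x) :+ m :+ k :+ r)) refl
              (agentSum j w′) (agentSum j w) (r′ j) (r j) (ceiling j) (agentSum j x) (fromℕ (reserve j)) (fromℕ (marks s j)))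
          where
          r≈k : r j ≈ fromℕ (reserve j)
          r≈k = reflexive (≡.cong (λ b → fromℕ (allowance b (reserve j) (count (marked s) j))) Fj)
          newly : ∀ q → owner q ≡ j → w′ q + 𝟙 (lookup (marked s) q) ≤ w q + x q
          newly q eq = begin
            w′ q + 𝟙 inM                  ≡⟨ ≡.cong (_+ 𝟙 inM) (w′-stay q eq) ⟩
            weight true inM inS (x q) + 𝟙 inM   ≤⟨ weight-isolated inM inS (x≤1 q) ⟩
            weight false inM inS (x q) + x q    ≡⟨ ≡.cong (λ b → weight b inM inS (x q) + x q) (≡.trans (≡.cong F eq) Fj) ⟨
            w q + x q                     ∎
            where inM = lookup (marked s) q ; inS = lookup (snapshot s) q
        by-origin true Fj = +-mono₃ (agentSum-cong same)
          (trans r′≈m (trans (reflexive (≡.cong fromℕ (≡.sym (ℕ.m≥n⇒m⊓n≡n (ℕ.<⇒≤ lt)))))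
            (reflexive (≡.cong (λ b → fromℕ (allowance b (reserve j) (count (marked s) j))) (≡.sym Fj)))))
          (≤-trans (≤-reflexive ceiling≈k) (reserves j))
          where
          +-mono₃ : ∀ {a b c d e f} → a ≈ b → c ≈ d → e ≤ f → a + c + e ≤ b + d + f
          +-mono₃ a≈b c≈d e≤f = ≤-reflexive a≈b ⊕ ≤-reflexive c≈d ⊕ e≤f
          same : ∀ q → owner q ≡ j → w′ q ≈ w q
          same q eq = reflexive (≡.trans (w′-stay q eq)
            (≡.cong (λ b → weight b (lookup (marked s) q) (lookup (snapshot s) q) (x q)) (≡.sym (≡.trans (≡.cong F eq) Fj))))

      summed : sum w′ + sum r′ + sum ceiling ≤ sum w + sum r + sum x
      summed = begin
        sum w′ + sum r′ + sum ceiling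
          ≈⟨ split w′ r′ ceiling (sum-agents w′) refl ⟨
        sum (λ j → agentSum j w′ + r′ j + ceiling j)
          ≤⟨ sum-mono per-agent ⟩
        sum (λ j → agentSum j w + r j + agentSum j x)
          ≈⟨ split w r (λ j → agentSum j x) (sum-agents w) (sum-agents x) ⟩
        sum w + sum r + sum x ∎
        where
        split : ∀ (f : Page → Carrier) (g h : Agent → Carrier) {u v} → sum (λ j → agentSum j f) ≈ u → sum h ≈ v →
          sum (λ j → agentSum j f + g j + h j) ≈ u + sum g + v
        split f g h eq eq′ = trans (∑-distrib-+ (λ j → agentSum j f + g j) h)
          (+-cong (trans (∑-distrib-+ (λ j → agentSum j f) g) (+-congʳ eq)) eq′)

  -- Without marks a page weighs at most 3x, in sum at most 3k, and the allowances are the reserves,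
  -- in sum at most k.
  Ψ-initial : ∀ S {x} → Feasible x → Ψ ⊥ S (λ _ → false) x ≤ 4# * fromℕ k
  Ψ-initial S {x} feasible = rearrange-≤ (sum-mono w≤ ⊕ sum-x≤k ⊕ sum-x≤k ⊕ sum-x≤k ⊕ ≤-reflexive (sym (fromℕ-sumℕ reserve)) ⊕ fromℕ-mono (ℕ.<⇒≤ Σreserve<k) ⊕ ≤-reflexive (sum-3 x))
    (solve 6 (λ w r x k r′ x₃ → :fromℕ 4 :* k :+ (w :+ x :+ x :+ x :+ r :+ r′ :+ x₃) := (w :+ r) :+ (x₃ :+ k :+ k :+ k :+ r′ :+ k :+ (x :+ x :+ x))) refl
      (sum w) (sum (fromℕ ∘ reserve)) (sum x) (fromℕ k) (fromℕ (sumℕ reserve)) (sum (λ q → x q + x q + x q)))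
    where
    open Feasible feasible using () renaming (nonNegative to 0≤x; capacity to sum-x≤k)
    w : Page → Carrier
    w q = weight false (lookup ⊥ q) (lookup S q) (x q)
    w≤ : ∀ q → w q ≤ x q + x q + x q
    w≤ q rewrite ∉⇒lookup {S = ⊥} {q} ∉⊥ with lookup S q
    ... | true  = ≤-trans (≤-reflexive (+-identityʳ _)) (≤-refl ⊕ 0≤x q)
    ... | false = ≤-reflexive (+-identityʳ _)
    sum-3 : ∀ {n} (f : Fin n → Carrier) → sum (λ q → f q + f q + f q) ≈ sum f + sum f + sum f
    sum-3 f = trans (∑-distrib-+ (λ q → f q + f q) f) (+-congʳ (∑-distrib-+ f f))

  -- The potential of the algorithm

  n₀ : ℕ
  n₀ = ℕ.pred k

  k≡1+n₀ : k ≡ suc n₀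
  k≡1+n₀ = ≡.sym (ℕ.suc-pred k {{ℕ.>-nonZero (ℕ.≤-<-trans ℕ.z≤n Σreserve<k)}})

  H : Carrier
  H = harmonic n₀

  capped : Bool → Carrier → Carrier → Carrier
  capped b y θ = if b then y ⊓ θ else 0#

  capped-nonNegative : ∀ b {y θ} → 0# ≤ y → 0# ≤ θ → 0# ≤ capped b y θ
  capped-nonNegative true  0≤y 0≤θ = ⊓-glb 0≤y 0≤θ
  capped-nonNegative false 0≤y 0≤θ = ≤-refl

  capped-mono : ∀ b {y z θ} → y ≤ z → capped b y θ ≤ capped b z θ
  capped-mono true  y≤z = ⊓-mono-≤ y≤z ≤-refl
  capped-mono false y≤z = ≤-refl

  capped-lipschitz : ∀ b {y z} θ → y ≤ z → capped b z θ ≤ capped b y θ + (z - y)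
  capped-lipschitz true  θ y≤z = ⊓-lipschitz θ y≤z
  capped-lipschitz false θ y≤z = ≤-trans (x≤y⇒0≤y-x y≤z) (≤-reflexive (sym (+-identityˡ _)))

  evictable : (M S : Subset ∣𝒫∣) → Page → Bool
  evictable M S q = lookup S q ∧ not (lookup M q)

  G : (M S : Subset ∣𝒫∣) → Alloc → Carrier → Carrier
  G M S y θ = sum λ q → capped (evictable M S q) (y q) θ

  G-nonNegative : ∀ M S {y θ} → (∀ q → 0# ≤ y q) → 0# ≤ θ → 0# ≤ G M S y θ
  G-nonNegative M S 0≤y 0≤θ = sum-nonNegative λ q → capped-nonNegative (evictable M S q) (0≤y q) 0≤θ

  G-raise : ∀ M S {y z} θ → (∀ q → y q ≤ z q) → G M S z θ ≤ G M S y θ + (sum z - sum y)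
  G-raise M S {y} {z} θ y≤z = begin
    G M S z θ
      ≤⟨ sum-mono (λ q → capped-lipschitz (evictable M S q) θ (y≤z q)) ⟩
    sum (λ q → capped (evictable M S q) (y q) θ + (z q - y q))
      ≈⟨ ∑-distrib-+ (λ q → capped (evictable M S q) (y q) θ) (λ q → z q - y q) ⟩
    G M S y θ + sum (λ q → z q - y q)
      ≈⟨ +-congˡ (∑-distrib-- z y) ⟩
    G M S y θ + (sum z - sum y) ∎

  G-flat : ∀ M S {y z} θ → (∀ q → z q ≈ y q ⊎ θ ≤ y q) → G M S z θ ≤ G M S y θ
  G-flat M S {y} {z} θ flat = sum-mono λ q → [ (λ z≈y → capped-mono (evictable M S q) (≤-reflexive z≈y))
                                             , flat-at (evictable M S q) ]′ (flat q)
    where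
    flat-at : ∀ b {y z} → θ ≤ y → capped b z θ ≤ capped b y θ
    flat-at true  θ≤y = ⊓-flat θ θ≤y
    flat-at false θ≤y = ≤-refl

  G-mark : ∀ M S {p y y₁ θ} → (∀ q → 0# ≤ y q) → 0# ≤ θ → (∀ q → q ≢ p → y₁ q ≤ y q) →
    G (M ∪ ⁅ p ⁆) S y₁ θ ≤ G M S y θ
  G-mark M S {p} {y} {y₁} {θ} 0≤y 0≤θ y₁≤y = sum-mono pointwise
    where
    pointwise : ∀ q → capped (evictable (M ∪ ⁅ p ⁆) S q) (y₁ q) θ ≤ capped (evictable M S q) (y q) θ
    pointwise q with q Fin.≟ p
    ... | no q≢p rewrite lookup-∪⁅⁆ M q≢p = capped-mono (evictable M S q) (y₁≤y q q≢p)
    ... | yes ≡.refl rewrite lookup-new M p with lookup S p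
    ...   | true  = capped-nonNegative (not (lookup M p)) (0≤y p) 0≤θ
    ...   | false = ≤-refl

  G-mark-stale : ∀ M S {p y y₁ θ} → p ∈ S → p ∉ M → (∀ q → q ≢ p → y₁ q ≤ y q) →
    G (M ∪ ⁅ p ⁆) S y₁ θ + (y p ⊓ θ) ≤ G M S y θ
  G-mark-stale M S {p} {y} {y₁} {θ} p∈S p∉M y₁≤y = rearrange-≤
    (sum-exchange {f = f} {g = g} p others ⊕ ≤-reflexive f-p ⊕ ≤-reflexive (sym g-p))
    (solve 5 (λ F G′ fp gp m → G′ :+ ((F :+ gp) :+ fp :+ m) := (F :+ m) :+ ((G′ :+ fp) :+ :0 :+ gp)) refl
      (sum f) (sum g) (f p) (g p) (y p ⊓ θ))
    where
    f g : Page → Carrier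
    f q = capped (evictable (M ∪ ⁅ p ⁆) S q) (y₁ q) θ
    g q = capped (evictable M S q) (y q) θ
    f-p : f p ≈ 0#
    f-p rewrite lookup-new M p with lookup S p
    ... | true  = refl
    ... | false = refl
    g-p : g p ≈ y p ⊓ θ
    g-p rewrite []=⇒lookup p∈S | ∉⇒lookup p∉M = refl
    others : ∀ q → q ≢ p → f q ≤ g q
    others q q≢p rewrite lookup-∪⁅⁆ M q≢p = capped-mono (evictable M S q) (y₁≤y q q≢p)

  -- At the threshold θ = 1/(j+2), the weight 1/(j+1) is the layer's thickness divided by θ.
  ∑G : (M S : Subset ∣𝒫∣) → Alloc → Carrier
  ∑G M S y = ∑< n₀ λ j → 1/[1+ j ] * G M S y 1/[1+ suc j ]

  markedTotal : Subset ∣𝒫∣ → Carrier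
  markedTotal M = sum (𝟙 ∘ lookup M)

  -- The second summand accounts for requests to pages with y ≤ 1/k.
  A : (M S : Subset ∣𝒫∣) → Alloc → Carrier
  A M S y = ∑G M S y + (1# - 1/[1+ n₀ ] * markedTotal M)

  ∑G-mono : ∀ M S M′ S′ {y y′} → (∀ θ → 0# ≤ θ → G M′ S′ y′ θ ≤ G M S y θ) → ∑G M′ S′ y′ ≤ ∑G M S y
  ∑G-mono M S M′ S′ G≤ = ∑<-mono n₀ λ j → *-monoʳ-≤ (0≤1/[1+n] j) (G≤ 1/[1+ suc j ] (0≤1/[1+n] (suc j)))

  markedTotal-mono : ∀ M p → markedTotal M ≤ markedTotal (M ∪ ⁅ p ⁆)
  markedTotal-mono M p = sum-mono pointwise
    where
    pointwise : ∀ q → 𝟙 (lookup M q) ≤ 𝟙 (lookup (M ∪ ⁅ p ⁆) q)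
    pointwise q with q Fin.≟ p
    ... | no q≢p rewrite lookup-∪⁅⁆ M q≢p = ≤-refl
    ... | yes ≡.refl rewrite lookup-new M p with lookup M p
    ...   | true  = ≤-refl
    ...   | false = 0≤1

  markedTotal-new : ∀ {M p} → p ∉ M → markedTotal (M ∪ ⁅ p ⁆) ≈ 1# + markedTotal M
  markedTotal-new {M} {p} p∉M = trans (sym (fromℕ-∣∣ (M ∪ ⁅ p ⁆)))
    (trans (reflexive (≡.cong fromℕ (∣∪⁅⁆∣ {S = M} p∉M))) (+-congˡ (fromℕ-∣∣ M)))

  -- Marked pages lie entirely in a cache of size `k`, and `1/[1+ n₀ ]` is 1/k.
  0≤1-marked : ∀ {s F} → Invariant s F → 0# ≤ 1# - 1/[1+ n₀ ] * markedTotal (marked s)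
  0≤1-marked {s} inv = x≤y⇒0≤y-x (begin
    1/[1+ n₀ ] * markedTotal (marked s)    ≤⟨ *-monoʳ-≤ (0≤1/[1+n] n₀) (sum-mono (Marks.mark≤held at-most-one marked⇒0)) ⟩
    1/[1+ n₀ ] * sum (λ q → 1# - y s q)    ≈⟨ *-congˡ (trans (sym (sum-agents _)) (sum-held≈k full)) ⟩
    1/[1+ n₀ ] * fromℕ k                   ≈⟨ trans (*-comm _ _) (*-congʳ (reflexive (≡.cong fromℕ k≡1+n₀))) ⟩
    fromℕ (suc n₀) * 1/[1+ n₀ ]            ≈⟨ inverse-suc n₀ ⟩
    1#                                     ∎)
    where open Invariant inv

  A-nonNegative : ∀ {s F} → Invariant s F → 0# ≤ A (marked s) (snapshot s) (y s)
  A-nonNegative {s} inv = +-nonNegative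
    (∑<-nonNegative n₀ λ j → *-nonNegative (0≤1/[1+n] j) (G-nonNegative (marked s) (snapshot s) nonNegative (0≤1/[1+n] (suc j))))
    (0≤1-marked inv)
    where open Invariant inv

  A-mark : ∀ M S {p y} → (∀ q → 0# ≤ y q) → A (M ∪ ⁅ p ⁆) S y ≤ A M S y
  A-mark M S {p} {y} 0≤y = ∑G-mono M S (M ∪ ⁅ p ⁆) S (λ θ 0≤θ → G-mark M S 0≤y 0≤θ λ _ _ → ≤-refl)
    ⊕ rearrange-≤ (*-monoʳ-≤ (0≤1/[1+n] n₀) (markedTotal-mono M p))
        (solve 2 (λ a b → (:1 :- a) :+ a := (:1 :- b) :+ b) refl (1/[1+ n₀ ] * markedTotal M) (1/[1+ n₀ ] * markedTotal (M ∪ ⁅ p ⁆)))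

  module _ {s F} (inv : Invariant s F) (held≤max : ∀ j → held (y s) j ≤ fromℕ (marks s j ℕ.⊔ reserve j)) where
    open EndPhase inv held≤max
    open Invariant inv

    -- The capped sums do not grow: restarted agents contribute pages at level 0 only, the others
    -- keep theirs. The increase by at most 1 is the refresh of the summand for the marks, which
    -- lies between 0 and 1.
    A-endPhase : A (marked s′) (snapshot s′) (y s) ≤ A (marked s) (snapshot s) (y s) + 1#
    A-endPhase = rearrange-≤ (∑G-mono (marked s) (snapshot s) (marked s′) (snapshot s′) G≤ ⊕ 0≤T′ ⊕ 0≤T)
      (solve 4 (λ g g′ t t′ → ((g :+ (:1 :- t)) :+ :1) :+ (g′ :+ :0 :+ :0) := (g′ :+ (:1 :- t′)) :+ (g :+ t′ :+ (:1 :- t))) refl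
        (∑G (marked s) (snapshot s) (y s)) (∑G (marked s′) (snapshot s′) (y s))
        (1/[1+ n₀ ] * markedTotal (marked s)) (1/[1+ n₀ ] * markedTotal (marked s′)))
      where
      0≤T′ : 0# ≤ 1/[1+ n₀ ] * markedTotal (marked s′)
      0≤T′ = *-nonNegative (0≤1/[1+n] n₀) (sum-nonNegative λ q → 0≤𝟙 (lookup (marked s′) q))
      0≤T : 0# ≤ 1# - 1/[1+ n₀ ] * markedTotal (marked s)
      0≤T = 0≤1-marked inv
      G≤ : ∀ θ → 0# ≤ θ → G (marked s′) (snapshot s′) (y s) θ ≤ G (marked s) (snapshot s) (y s) θ
      G≤ θ 0≤θ = sum-mono pointwise
        where
        pointwise : ∀ q → capped (evictable (marked s′) (snapshot s′) q) (y s q) θ ≤ capped (evictable (marked s) (snapshot s) q) (y s q) θ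
        pointwise q with ℕ.<-≤-connex (marks s (owner q)) (reserve (owner q))
        ... | inj₁ lt rewrite stay-marked {q} lt | stay-snapshot {q} lt = ≤-refl
        ... | inj₂ ge rewrite move-marked {q} ge | move-snapshot {q} ge with q ∈? marked s
        ...   | no q∉M rewrite ∉⇒lookup q∉M = capped-nonNegative (lookup (snapshot s) q ∧ true) (nonNegative q) 0≤θ
        ...   | yes q∈M = ≤-trans (emptied (lookup (marked s) q ∧ true)) (capped-nonNegative (evictable (marked s) (snapshot s) q) (nonNegative q) 0≤θ)
          where
          emptied : ∀ b → capped b (y s q) θ ≤ 0#
          emptied true  = ≤-trans (x⊓y≤x _ θ) (≤-reflexive (marked⇒0 q∈M))
          emptied false = ≤-refl

  -- The competitive ratio

  module MissBound {s F} (inv : Invariant s F) (p : Page) (miss : ¬ y s p ≈ 0#)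
    {z} (y₁≤z : ∀ q → y (fetch p s) q ≤ z q) (filled : sum z ≈ target) where
    open Invariant inv
    open AfterFetch inv p miss

    private
      M = marked s
      S = snapshot s
      η = y s p

    filling : sum z - sum y₁ ≈ η
    filling = begin-equality
      sum z - sum y₁               ≈⟨ +-congʳ (trans filled (trans (sym full) sum₁)) ⟩
      sum y₁ + η - sum y₁          ≈⟨ solve 2 (λ s e → (s :+ e) :- s := e) refl (sum y₁) η ⟩
      η                            ∎

    G-raise′ : ∀ θ → G (M ∪ ⁅ p ⁆) S z θ ≤ G (M ∪ ⁅ p ⁆) S y₁ θ + η
    G-raise′ θ = ≤-trans (G-raise (M ∪ ⁅ p ⁆) S θ y₁≤z) (≤-reflexive (+-congˡ filling))

    -- Each capped sum grows by at most the total rise, which is η ≤ 1, and the weights 1/(j+1) add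
    -- up to `H`. The further 1 is for η itself.
    A-charged : η + A (M ∪ ⁅ p ⁆) S z ≤ A M S (y s) + (H + 1#)
    A-charged = rearrange-≤ (∑G≤ ⊕ at-most-one p ⊕ *-monoʳ-≤ (0≤1/[1+n] n₀) (markedTotal-mono M p))
      (solve 6 (λ e g g′ h t t′ → ((g :+ (:1 :- t)) :+ (h :+ :1)) :+ (g′ :+ e :+ t) := (e :+ (g′ :+ (:1 :- t′))) :+ ((g :+ h) :+ :1 :+ t′)) refl
        η (∑G M S (y s)) (∑G (M ∪ ⁅ p ⁆) S z) H (1/[1+ n₀ ] * markedTotal M) (1/[1+ n₀ ] * markedTotal (M ∪ ⁅ p ⁆)))
      where
      ∑G≤ : ∑G (M ∪ ⁅ p ⁆) S z ≤ ∑G M S (y s) + H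
      ∑G≤ = ≤-trans (∑<-mono n₀ λ j → begin
          1/[1+ j ] * G (M ∪ ⁅ p ⁆) S z 1/[1+ suc j ]
            ≤⟨ *-monoʳ-≤ (0≤1/[1+n] j) (≤-trans (G-raise′ _)
                 (G-mark M S nonNegative (0≤1/[1+n] (suc j)) (λ q _ → y₁≤y q) ⊕ at-most-one p)) ⟩
          1/[1+ j ] * (G M S (y s) 1/[1+ suc j ] + 1#)
            ≈⟨ trans (distribˡ _ _ _) (+-congˡ (*-identityʳ _)) ⟩
          1/[1+ j ] * G M S (y s) 1/[1+ suc j ] + 1/[1+ j ] ∎)
        (≤-reflexive (∑<-+ n₀ _ 1/[1+_]))

    -- The raised pages were at level η or higher, so below that level only p's own
    -- contribution changes: it vanishes.
    A-stale : p ∈ S → (∀ q → z q ≈ y₁ q ⊎ η ≤ y₁ q) → η + A (M ∪ ⁅ p ⁆) S z ≤ A M S (y s)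
    A-stale p∈S above = rearrange-≤ (∑G≤ ⊕ layer-cake n₀ (at-most-one p) ⊕ ≤-reflexive (sym total-step))
      (solve 7 (λ e g g′ l t t′ n → (g :+ (:1 :- t)) :+ ((g′ :+ l) :+ e :+ (n :+ t))
          := (e :+ (g′ :+ (:1 :- t′))) :+ (g :+ (n :+ l) :+ t′)) refl
        η (∑G M S (y s)) (∑G (M ∪ ⁅ p ⁆) S z) (∑< n₀ λ j → 1/[1+ j ] * layer η j)
        (1/[1+ n₀ ] * markedTotal M) (1/[1+ n₀ ] * markedTotal (M ∪ ⁅ p ⁆)) 1/[1+ n₀ ])
      where
      -- The new mark releases 1/k, which is the part of η that `layer-cake` leaves below the lowest
      -- threshold.
      total-step : 1/[1+ n₀ ] * markedTotal (M ∪ ⁅ p ⁆) ≈ 1/[1+ n₀ ] + 1/[1+ n₀ ] * markedTotal M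
      total-step = trans (*-congˡ (markedTotal-new unmarked-p)) (trans (distribˡ _ _ _) (+-congʳ (*-identityʳ _)))

      G-layer : ∀ j → G (M ∪ ⁅ p ⁆) S z 1/[1+ suc j ] + layer η j ≤ G M S (y s) 1/[1+ suc j ]
      G-layer j with 1/[1+ suc j ] ≤? η
      ... | yes θ≤η = ≤-trans (G-flat (M ∪ ⁅ p ⁆) S θ (λ q → [ inj₁ , inj₂ ∘ ≤-trans θ≤η ]′ (above q)) ⊕ ⊓-glb θ≤η ≤-refl)
          (G-mark-stale M S p∈S unmarked-p λ q _ → y₁≤y q)
        where θ = 1/[1+ suc j ]
      -- Here the evictions may add η to the capped sum, but `p` has just left it with all of η,
      -- since η is below the threshold.
      ... | no θ≰η = rearrange-≤ (G-raise′ θ ⊕ G-mark-stale M S p∈S unmarked-p (λ q _ → y₁≤y q) ⊕ ⊓-glb ≤-refl (<⇒≤ (≰⇒> θ≰η)))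
          (solve 5 (λ g g₁ g′ e m → g :+ (g′ :+ (g₁ :+ m) :+ e) := (g′ :+ :0) :+ ((g₁ :+ e) :+ g :+ m)) refl
            (G M S (y s) θ) (G (M ∪ ⁅ p ⁆) S y₁ θ) (G (M ∪ ⁅ p ⁆) S z θ) η (η ⊓ θ))
        where θ = 1/[1+ suc j ]

      ∑G≤ : ∑G (M ∪ ⁅ p ⁆) S z + ∑< n₀ (λ j → 1/[1+ j ] * layer η j) ≤ ∑G M S (y s)
      ∑G≤ = ≤-trans (≤-reflexive (sym (∑<-+ n₀ _ _))) (∑<-mono n₀ λ j →
        ≤-trans (≤-reflexive (sym (distribˡ _ _ _))) (*-monoʳ-≤ (0≤1/[1+n] j) (G-layer j)))

  0≤H+1 : 0# ≤ H + 1#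
  0≤H+1 = +-nonNegative (∑<-nonNegative n₀ 0≤1/[1+n]) 0≤1

  charged-clean : ∀ M S F {p} → lookup M p ≡ false → lookup S p ≡ false → charged M S F p ≡ true
  charged-clean M S F p∉M p∉S rewrite p∉M | p∉S = ≡.refl

  charge-cases : ∀ inM inS late → inM ≡ false → not inM ∧ (not inS ∨ late) ≡ false → inS ≡ true × late ≡ false
  charge-cases false true late _ eq = ≡.refl , eq

  Serving : State → Page → State → Set _
  Serving s p s′ = y s′ p ≈ 0# × (∀ q → q ≢ p → y s q ≤ y s′ q)

  -- The bookkeeping of one request once a possible end of phase has been dealt with, so `F` is
  -- fixed. It mentions no solution.
  record Accounted (s : State) (F : Agent → Bool) (p : Page) (s′ : State) : Set (a ⊔ ℓ₁ ⊔ ℓ₂) where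
    field
      marked′   : marked s′ ≡ marked s ∪ ⁅ p ⁆
      snapshot′ : snapshot s′ ≡ snapshot s
      invariant : Invariant s′ F
      serving   : Serving s p s′
      bound     : y s p + A (marked s′) (snapshot s′) (y s′)
                    ≤ A (marked s) (snapshot s) (y s) + (H + 1#) * 𝟙 (charged (marked s) (snapshot s) F p)

  module _ {s F} (inv : Invariant s F) (p : Page) where
    open Invariant inv

    private
      c = charged (marked s) (snapshot s) F p

    accounted-hit : y s p ≈ 0# → Accounted s F p (mark p s)
    accounted-hit y≈0 = record
      { marked′   = ≡.refl
      ; snapshot′ = ≡.refl
      ; invariant = AfterMark.invariant-hit inv p y≈0
      ; serving   = y≈0 , λ _ _ → ≤-refl
      ; bound     = rearrange-≤ (A-mark (marked s) (snapshot s) nonNegative ⊕ ≤-reflexive y≈0 ⊕ *-nonNegative 0≤H+1 (0≤𝟙 c))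
          (solve 4 (λ a a′ e x → (a :+ x) :+ (a′ :+ e :+ :0) := (e :+ a′) :+ (a :+ :0 :+ x)) refl
            (A (marked s) (snapshot s) (y s)) (A (marked s ∪ ⁅ p ⁆) (snapshot s) (y s)) (y s p) ((H + 1#) * 𝟙 c))
      }

    module _ (miss : ¬ y s p ≈ 0#) where
      open AfterFetch inv p miss

      private
        uncharged : c ≡ false → p ∈ snapshot s × ¬ (F i ≡ true × reserve i ℕ.≤ marks s i)
        uncharged c≡f = lookup⇒[]= p _ (proj₁ cases) , λ (Fi , le) →
          case ≡.trans (≡.sym (proj₂ cases)) (≡.cong₂ _∧_ Fi (dec-true (reserve i ℕ.≤? marks s i) le)) of λ ()
          where
          cases = charge-cases (lookup (marked s) p) (lookup (snapshot s) p) (F i ∧ does (reserve i ℕ.≤? marks s i)) (∉⇒lookup unmarked-p) c≡f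

        miss-bound : ∀ {z} → (∀ q → y₁ q ≤ z q) → sum z ≈ target →
          (c ≡ false → ∀ q → z q ≈ y₁ q ⊎ y s p ≤ y₁ q) →
          y s p + A (marked s ∪ ⁅ p ⁆) (snapshot s) z ≤ A (marked s) (snapshot s) (y s) + (H + 1#) * 𝟙 c
        miss-bound {z} y₁≤z filled above = by-charge c ≡.refl
          where
          open MissBound inv p miss y₁≤z filled
          by-charge : ∀ b → c ≡ b → y s p + A (marked s ∪ ⁅ p ⁆) (snapshot s) z ≤ A (marked s) (snapshot s) (y s) + (H + 1#) * 𝟙 c
          by-charge true  c≡t = ≤-trans A-charged (≤-reflexive (+-congˡ (sym
            (trans (*-congˡ (reflexive (≡.cong 𝟙 c≡t))) (*-identityʳ _)))))
          by-charge false c≡f = ≤-trans (A-stale (proj₁ (uncharged c≡f)) (above c≡f))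
            (≤-trans (≤-reflexive (sym (+-identityʳ _))) (≤-refl ⊕ *-nonNegative 0≤H+1 (0≤𝟙 c)))

        same-level : c ≡ false → ∀ {q} → Unmarked s₁ q → owner q ≡ i → y s p ≤ y₁ q
        same-level c≡f U eq = let V , e = unmarked₁ U in
          ≤-reflexive (trans (uniform (proj₁ (uncharged c≡f) , unmarked-p) V (≡.sym eq)) (reflexive (≡.sym e)))

        p-marked : p ∈ marked s₁
        p-marked = ∈∪⁅⁆ {S = marked s}

        serving-miss : ∀ {Eligible z} → Refilling Eligible z → Serving s p (record s₁ { y = z })
        serving-miss R = R.marked⇒0′ p-marked , λ q q≢p →
          ≤-trans (≤-reflexive (reflexive (≡.sym (y₁-other q≢p)))) (R.grows q)
          where module R = Refilling R

      accounted-isolated : i ∈ isolated s → ∀ {z} → Flow (OwnUnmarked s₁ i) y₁ z → Accounted s F p (record s₁ { y = z })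
      accounted-isolated i∈ {z} flow = record
        { marked′   = ≡.refl
        ; snapshot′ = ≡.refl
        ; invariant = invariant-isolated
        ; serving   = serving-miss refilling
        ; bound     = miss-bound (Refilling.grows refilling) filled above
        }
        where
        open Isolated i∈ flow
        above : c ≡ false → ∀ q → z q ≈ y₁ q ⊎ y s p ≤ y₁ q
        above c≡f q with ownUnmarked? s₁ i y₁ q
        ... | no  other         = inj₁ (Refilling.fixed refilling q other)
        ... | yes (U , own , _) = inj₂ (same-level c≡f U own)

      accounted-shared : i ∉ isolated s → ∀ {z} → Flow (LowestAvailable s₁) y₁ z → Accounted s F p (record s₁ { y = z })
      accounted-shared i∉ {z} flow = record
        { marked′   = ≡.refl
        ; snapshot′ = ≡.refl
        ; invariant = invariant-shared flow
        ; serving   = serving-miss (refilling flow)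
        ; bound     = miss-bound (Refilling.grows (refilling flow)) (filled flow) above
        }
        where
        open Shared i∉
        above : c ≡ false → ∀ q → z q ≈ y₁ q ⊎ y s p ≤ y₁ q
        above c≡f q with Available? s₁ y₁ q
        ... | no unavailable = inj₁ (Refilling.fixed (refilling flow) q unavailable)
        ... | yes av@(U , _ , nonTight) with owner q Fin.≟ i
        ...   | yes own  = inj₂ (same-level c≡f U own)
        -- The raised page belongs to another non-tight agent with `F` false and is therefore on the
        -- top level, which is at least the level of `p`.
        ...   | no other = inj₂ (let V , e = unmarked₁ U in
          ≤-trans (topLevel (proj₁ (uncharged c≡f) , unmarked-p) V Fi (available-F av)
                     (nonTight-cong {y₁} {y s} (held₁-other other) nonTight))
                  (≤-reflexive (reflexive (≡.sym e))))
          where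
          Fi : F i ≡ false
          -- With `F i` true, the non-isolated `i` would have been released, and the request would
          -- be charged.
          Fi = ¬-not λ eq → proj₂ (uncharged c≡f) (eq , proj₁ (released⇒ eq i∉))

  -- The worth of one charged request: H + 1 for the growth of `A` in `A-charged`, and 1 for the
  -- refresh of `A` at the end of a phase.
  B : Carrier
  B = H + (1# + 1#)

  0≤B : 0# ≤ B
  0≤B = +-nonNegative (∑<-nonNegative n₀ 0≤1/[1+n]) (+-nonNegative 0≤1 0≤1)

  Φ : State → (Agent → Bool) → Alloc → Carrier
  Φ s F x = B * Ψ (marked s) (snapshot s) F x + A (marked s) (snapshot s) (y s)

  -- d is what the end of a phase adds to A; it is covered by the charge as well.
  Φ-step : ∀ {s F p s′} → Accounted s F p s′ → ∀ {a₀ d} →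
    A (marked s) (snapshot s) (y s) ≤ a₀ + d → d ≤ 𝟙 (charged (marked s) (snapshot s) F p) →
    ∀ {x x′} → Feasible x → Serves x p x′ →
    y s p + Φ s′ F x′ ≤ B * Ψ (marked s) (snapshot s) F x + a₀ + B * (4# * (1# - x p))
  Φ-step {s} {F} {p} {s′} accounted {a₀} {d} A≤ d≤c {x} {x′} feasible serves = rearrange-≤
    (bound ⊕ A≤ ⊕ d≤c ⊕ B*Ψ≤)
    (solve 10 (λ η a′ a a₀ d hc c bψ′ bψ bf →
        (bψ :+ a₀ :+ bf) :+ (η :+ a′ :+ a :+ d :+ (hc :+ c :+ bψ′))
        := (η :+ (bψ′ :+ a′)) :+ ((a :+ hc) :+ (a₀ :+ d) :+ c :+ (bψ :+ bf))) refl
      (y s p) (A (marked s′) (snapshot s′) (y s′)) (A (marked s) (snapshot s) (y s)) a₀ d ((H + 1#) * c) c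
      (B * Ψ (marked s′) (snapshot s′) F x′) (B * Ψ (marked s) (snapshot s) F x) (B * (4# * (1# - x p))))
    where
    open Accounted accounted
    c = 𝟙 (charged (marked s) (snapshot s) F p)
    Ψ≤ : c + Ψ (marked s′) (snapshot s′) F x′ ≤ Ψ (marked s) (snapshot s) F x + 4# * (1# - x p)
    Ψ≤ rewrite marked′ | snapshot′ = Ψ-step (marked s) (snapshot s) F p feasible serves
    B*Ψ≤ : (H + 1#) * c + c + B * Ψ (marked s′) (snapshot s′) F x′
         ≤ B * Ψ (marked s) (snapshot s) F x + B * (4# * (1# - x p))
    B*Ψ≤ = begin
      (H + 1#) * c + c + B * Ψ (marked s′) (snapshot s′) F x′
        ≈⟨ solve 3 (λ h c ψ → (h :+ :1) :* c :+ c :+ (h :+ (:1 :+ :1)) :* ψ := (h :+ (:1 :+ :1)) :* (c :+ ψ)) refl H c _ ⟩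
      B * (c + Ψ (marked s′) (snapshot s′) F x′)
        ≤⟨ *-monoʳ-≤ 0≤B Ψ≤ ⟩
      B * (Ψ (marked s) (snapshot s) F x + 4# * (1# - x p))
        ≈⟨ distribˡ _ _ _ ⟩
      B * Ψ (marked s) (snapshot s) F x + B * (4# * (1# - x p)) ∎

  -- `F′` is existential because the request may open a new phase. The inequality holds for every
  -- feasible move of a solution, so one trajectory of the algorithm can be compared with any
  -- solution.
  record Outcome (s : State) (F : Agent → Bool) (p : Page) (s′ : State) : Set (a ⊔ ℓ₁ ⊔ ℓ₂) where
    field
      F′        : Agent → Bool
      invariant : Invariant s′ F′
      serving   : Serving s p s′
      amortized : ∀ {x x′} → Feasible x → Serves x p x′ → y s p + Φ s′ F′ x′ ≤ Φ s F x + B * (4# * (1# - x p))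

  within-phase : ∀ {s F p s′} → Accounted s F p s′ → Outcome s F p s′
  within-phase {s} {F} {p} accounted = record
    { F′        = _
    ; invariant = Accounted.invariant accounted
    ; serving   = Accounted.serving accounted
    ; amortized = Φ-step accounted (≤-reflexive (sym (+-identityʳ _))) (0≤𝟙 (charged (marked s) (snapshot s) F p))
    }

  outcome : ∀ {s F p s′} → Invariant s F → Step s p s′ → Outcome s F p s′
  outcome {p = p} inv (hit y≈0)                   = within-phase (accounted-hit inv p y≈0)
  outcome {p = p} inv (isolatedMiss miss i∈ flow) = within-phase (accounted-isolated inv p miss i∈ flow)
  outcome {p = p} inv (sharedMiss miss i∉ _ flow) = within-phase (accounted-shared inv p miss i∉ flow)
  outcome {s} {F} {p} {s″} inv (newPhase miss i∉ stuck step) = next step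
    where
    open NewPhase inv miss stuck
    -- Ending a phase leaves `y` unchanged, so `p` is still a miss. Its owner is not isolated and
    -- eviction is possible, so only a shared miss remains.
    next : Step s′ p s″ → Outcome s F p s″
    next (hit y≈0)                       = contradiction y≈0 miss
    next (isolatedMiss _ i∈ _)           = contradiction i∈ shared-next
    next (newPhase _ _ stuck′ _)         = contradiction (canEvict (owner p)) stuck′
    next (sharedMiss miss i∉′ _ flow)    = record
      { F′        = F′
      ; invariant = Accounted.invariant accounted
      ; serving   = Accounted.serving accounted
      ; amortized = λ feasible serves → ≤-trans
          (Φ-step accounted (A-endPhase inv held≤max) 1≤charge feasible serves)
          (*-monoʳ-≤ 0≤B (Ψ-endPhase inv held≤max feasible) ⊕ ≤-refl ⊕ ≤-refl)
      }
      where
      accounted = accounted-shared invariant-endPhase p miss i∉′ flow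
      1≤charge : 1# ≤ 𝟙 (charged (marked s′) (snapshot s′) F′ p)
      1≤charge = ≤-reflexive (reflexive (≡.cong 𝟙 (≡.sym
        (charged-clean (marked s′) (snapshot s′) F′ (∉⇒lookup (proj₁ clean-next)) (∉⇒lookup (proj₂ clean-next))))))

  -- The algorithm as a solution, and the summation of its cost over a run.

  portion-feasible : ∀ {s F} → Invariant s F → Feasible (portion s)
  portion-feasible {s} inv = record
    { nonNegative = λ q → x≤y⇒0≤y-x (at-most-one q)
    ; at-most-one = λ q → rearrange-≤ (nonNegative q)
        (solve 1 (λ y → :1 :+ :0 := (:1 :- y) :+ y) refl (y s q))
    ; capacity    = ≤-reflexive (trans (sym (sum-agents _)) (sum-held≈k full))
    ; reserves    = reserved
    }
    where open Invariant inv

  portion-serves : ∀ {s F p s′} → Outcome s F p s′ → Serves (portion s) p (portion s′)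
  portion-serves {s} {p = p} {s′} out = record
    { feasible    = portion-feasible invariant
    ; requested   = trans (+-congˡ (-‿cong (proj₁ serving))) (solve 0 (:1 :- :0 := :1) refl)
    ; no-prefetch = λ q q≢p → rearrange-≤ (proj₂ serving q q≢p)
        (solve 2 (λ y z → (:1 :- y) :+ y := (:1 :- z) :+ z) refl (y s q) (y s′ q))
    }
    where open Outcome out

  run-invariant : ∀ {s F σ s′} → Invariant s F → Run s σ s′ → ∃ (Invariant s′)
  run-invariant inv []          = _ , inv
  run-invariant inv (step ∷ run) = run-invariant (Outcome.invariant (outcome inv step)) run

  run-serves : ∀ {s F σ s′} → Invariant s F → (run : Run s σ s′) → ServesAll (portion s) σ (trajectory run)
  run-serves inv []           = []
  run-serves inv (step ∷ run) = portion-serves (outcome inv step) ∷ run-serves (Outcome.invariant (outcome inv step)) run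

  cost-nonNegative : ∀ {x σ xs} → Feasible x → ServesAll x σ xs → 0# ≤ cost x σ xs
  cost-nonNegative feasible []                = ≤-refl
  cost-nonNegative feasible (serves ∷ served) = +-nonNegative
    (x≤y⇒0≤y-x (Feasible.at-most-one feasible _)) (cost-nonNegative (Serves.feasible serves) served)

  run-cost : ∀ {s F σ s′} → Invariant s F → (run : Run s σ s′) → ∀ {x xs} → Feasible x → ServesAll x σ xs →
    cost (portion s) σ (trajectory run) ≤ Φ s F x + B * (4# * cost x σ xs)
  run-cost {s} {F} inv [] feasible [] = ≤-trans
    (+-nonNegative (*-nonNegative 0≤B (Ψ-nonNegative (marked s) (snapshot s) F (Feasible.nonNegative feasible)))
                   (A-nonNegative inv))
    (≤-trans (≤-reflexive (sym (+-identityʳ _))) (≤-refl ⊕ *-nonNegative 0≤B (*-nonNegative (0≤fromℕ 4) ≤-refl)))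
  run-cost {s} {F} {σ = p ∷ σ} inv (_∷_ {s′ = s′} step run) {x} {x′ ∷ xs} feasible (serves ∷ served) = rearrange-≤
    (amortized feasible serves ⊕ run-cost invariant run (Serves.feasible serves) served)
    (solve 8 (λ η φ φ′ b f x c c′ → (φ :+ b :* (f :* ((:1 :- x) :+ c′))) :+ ((η :+ φ′) :+ c)
        := ((:1 :- (:1 :- η)) :+ c) :+ ((φ :+ b :* (f :* (:1 :- x))) :+ (φ′ :+ b :* (f :* c′)))) refl
      (y s p) (Φ s F x) (Φ s′ F′ x′) B 4# (x p) (cost (portion s′) σ (trajectory run)) (cost x′ σ xs))
    where open Outcome (outcome inv step)

  -- Bounds `Φ` at the start: `Ψ` is at most 4k and `A` at most 1, whatever the initial cache.
  initial-cost : Carrier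
  initial-cost = B * (4# * fromℕ k) + 1#

  module _ (cache : InitialCache) where
    open InitialCache cache

    private
      s₀ = initial cache
      in-cache : ∀ {q} → q ∈ pages → y s₀ q ≈ 0#
      in-cache q∈ rewrite []=⇒lookup q∈ = refl
      off-cache : ∀ {q} → q ∉ pages → y s₀ q ≈ 1#
      off-cache q∉ rewrite ∉⇒lookup q∉ = refl
      held-page : ∀ q → 1# - y s₀ q ≈ 𝟙 (lookup pages q)
      held-page q with lookup pages q
      ... | true  = solve 0 (:1 :- :0 := :1) refl
      ... | false = -‿inverseʳ 1#

    initial-invariant : Invariant s₀ (λ _ → false)
    initial-invariant = record
      { nonNegative = nonneg
      ; at-most-one = at-most-one
      ; full        = begin-equality
          sum (y s₀)
            ≈⟨ solve 2 (λ h s → s := (h :+ s) :- h) refl (sum (held (y s₀))) _ ⟩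
          sum (held (y s₀)) + sum (y s₀) - sum (held (y s₀))
            ≈⟨ +-cong (sum-held (y s₀)) (-‿cong (trans (sum-agents _) (trans (sum-cong-≋ held-page)
                 (trans (sym (fromℕ-∣∣ pages)) (reflexive (≡.cong fromℕ (InitialCache.full cache))))))) ⟩
          target ∎
      ; reserved    = λ i → ≤-trans (fromℕ-mono (reserve-ok i))
          (≤-reflexive (trans (fromℕ-count pages i) (agentSum-cong λ q _ → sym (held-page q))))
      ; marked⇒0    = λ q∈ → contradiction q∈ ∉⊥
      ; outside⇒1   = λ q∉ _ → off-cache q∉
      ; isolated⇒   = λ i∈ → contradiction i∈ ∉⊥
      ; released⇒   = λ ()
      ; uniform     = λ U U′ _ → trans (in-cache (proj₁ U)) (sym (in-cache (proj₁ U′)))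
      ; topLevel    = λ U U′ _ _ _ → ≤-reflexive (trans (in-cache (proj₁ U)) (sym (in-cache (proj₁ U′))))
      }
      where
      nonneg : ∀ q → 0# ≤ y s₀ q
      nonneg q with lookup pages q
      ... | true  = ≤-refl
      ... | false = 0≤1
      at-most-one : ∀ q → y s₀ q ≤ 1#
      at-most-one q with lookup pages q
      ... | true  = 0≤1
      ... | false = ≤-refl

    A-initial : A ⊥ pages (y s₀) ≤ 1#
    A-initial = rearrange-≤ (∑G≤0 ⊕ *-nonNegative (0≤1/[1+n] n₀) (sum-nonNegative {∣𝒫∣} λ q → 0≤𝟙 (lookup ⊥ q)))
      (solve 2 (λ g t → :1 :+ (g :+ :0) := (g :+ (:1 :- t)) :+ (:0 :+ t)) refl
        (∑G ⊥ pages (y s₀)) (1/[1+ n₀ ] * markedTotal ⊥))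
      where
      empty : ∀ θ q → capped (evictable ⊥ pages q) (y s₀ q) θ ≤ 0#
      empty θ q with lookup pages q | lookup ⊥ q
      ... | true  | true  = ≤-refl
      ... | true  | false = x⊓y≤x 0# θ
      ... | false | _     = ≤-refl
      ∑G≤0 : ∑G ⊥ pages (y s₀) ≤ 0#
      ∑G≤0 = ≤-trans (∑<-mono n₀ λ j → *-monoʳ-≤ (0≤1/[1+n] j)
          (≤-trans (sum-mono (empty 1/[1+ suc j ])) (≤-reflexive (sum-replicate-zero ∣𝒫∣))))
        (≤-reflexive (∑<-zero n₀ λ j → zeroʳ _))

    -- The constant is 28 = 4 · 7: `Ψ` grows by at most 4 per unit of the solution's cost, each unit
    -- of `Ψ` is worth `B`, and `B` is at most 7u.
    competitive : ∀ {σ s} (run : Run s₀ σ s) (opt : Solution σ) u → ln[1+ k ]≤ u →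
      cost (portion s₀) σ (trajectory run) ≤ fromℕ 28 * u * Solution.totalCost opt + initial-cost
    competitive {σ} run opt u ln≤u = begin
      cost (portion s₀) σ (trajectory run)
        ≤⟨ run-cost initial-invariant run feasible₀ served ⟩
      B * Ψ ⊥ pages (λ _ → false) x₀ + A ⊥ pages (y s₀) + B * (4# * totalCost)
        ≤⟨ *-monoʳ-≤ 0≤B (Ψ-initial pages feasible₀) ⊕ A-initial ⊕ *-monoˡ-≤ 0≤4opt B≤7u ⟩
      initial-cost + fromℕ 7 * u * (4# * totalCost)
        ≈⟨ trans (+-comm _ _) (+-congʳ (solve 4 (λ f s u c → s :* u :* (f :* c) := f :* s :* u :* c) refl 4# (fromℕ 7) u totalCost)) ⟩
      4# * fromℕ 7 * u * totalCost + initial-cost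
        ≈⟨ +-congʳ (*-congʳ (*-congʳ (fromℕ-* 4 7))) ⟨
      fromℕ 28 * u * totalCost + initial-cost ∎
      where
      open Solution opt
      0≤4opt : 0# ≤ 4# * totalCost
      0≤4opt = *-nonNegative (0≤fromℕ 4) (cost-nonNegative feasible₀ served)
      B≤7u : B ≤ fromℕ 7 * u
      B≤7u = harmonic-bound n₀ (≡.subst (λ k → ln[1+ k ]≤ u) k≡1+n₀ ln≤u)

theorem1 : ∀ {a ℓ₁ ℓ₂} → ∃ λ (C : ℕ) → (K : OrderedField a ℓ₁ ℓ₂) (I : Setting) →
  let open OrderedField K
      open Setting I
      open Caching K I
      open Marking
  in ∃ λ (b : Carrier) → (cache : InitialCache) →
       Feasible (portion (initial cache))
       × (∀ {σ s} → Run (initial cache) σ s → ∀ p → ∃[ s′ ] Step s p s′)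
       × (∀ {σ s} (run : Run (initial cache) σ s) →
            ServesAll (portion (initial cache)) σ (trajectory run)
            × (∀ (opt : Solution σ) u → ln[1+ k ]≤ u →
                 cost (portion (initial cache)) σ (trajectory run)
                   ≤ fromℕ C * u * Solution.totalCost opt + b))
theorem1 = 28 , λ K I → let open Analysis K I in initial-cost , λ cache →
    portion-feasible (initial-invariant cache)
  , (λ run → progress (proj₂ (run-invariant (initial-invariant cache) run)))
  , λ run → run-serves (initial-invariant cache) run , competitive cache run
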